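{- Let $0\le k\le n$, $n\ge1$. For Young diagrams $\lambda,\mu$ in the $k\times(n-k)$ rectangle, let $d^{\lambda,\mu}_\nu(\vec y)$ be the coefficients defined by the identity in $K_T(Gr(k,n))$ $$G^\lambda(\bar x;\vec y)\,G^\mu(\bar x;\overleftarrow{y})=\sum_\nu d^{\lambda,\mu}_\nu(\vec y)\,G^\nu(\bar x;\overleftarrow{y}),$$ where $\nu$ runs over Young diagrams in the $k\times(n-k)$ rectangle. Then $d^{\lambda,\mu}_\nu(\vec y)$ equals the sum of the modified weights of all equivariant puzzles in an up-pointing equilateral triangle of side $n$ whose boundary is as follows: the right side, read from the top corner to the bottom-right corner, encodes $\lambda$; the bottom horizontal side, read from right to left, encodes $\mu$; the left side, read from the top corner to the bottom-left corner, encodes $\nu$. Here the parameter of an elementary lozenge is $w=y_i/y_j$, where, numbering the unit edges of the bottom side $1,\dots,n$ from left to right, $j$ is the number of the bottom edge reached from the centre of the lozenge by going straight down-left (direction $240^\circ$), and $i$ is the number of the bottom edge reached from the centre by going straight down-right (direction $300^\circ$); thus $1\le j<i\le n$.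
   Context: **Young diagrams.** Fix $0\le k\le n$. A Young diagram $\lambda$ (English convention) in the $k\times(n-k)$ rectangle ($k$ rows, $n-k$ columns) is encoded by its frame, a $k$-subset of $\{1,\dots,n\}$: follow the border of $\lambda$ from the bottom-left to the top-right corner of the rectangle in $n$ unit steps (up or right), and record $i$ if the $i$-th step is up. So $\varnothing$ has frame $\{1,\dots,k\}$ and the full rectangle has frame $\{n-k+1,\dots,n\}$. **Polynomials.** Let $\bar x=(x_1,\dots,x_k)$, $\vec y=(y_1,\dots,y_n)$, $\overleftarrow{y}=(y_n,\dots,y_1)$. The double Grothendieck polynomials $G^\lambda(\bar x;\vec y)$ are defined inductively by $G^{\{n-k+1,\dots,n\}}(\bar x;\vec y)=\prod_{i=1}^k\prod_{j=1}^{n-k}(1-x_i/y_j)$ and $G^\mu=D_iG^\lambda$ whenever the frame of $\mu$ is obtained from that of $\lambda$ by replacing $i+1$ with $i$, where $D_if=\dfrac{y_if(\ldots,y_i,y_{i+1},\ldots)-y_{i+1}f(\ldots,y_{i+1},y_i,\ldots)}{y_i-y_{i+1}}$ acts on the $y$ variables. $G^\lambda(\bar x;\overleftarrow{y})$ is obtained from $G^\lambda(\bar x;\vec y)$ by substituting $y_i\mapsto y_{n+1-i}$. **Ring.** $K_T(Gr(k,n))$ is the quotient of $\mathbb Z[x_1^{\pm1},\dots,x_k^{\pm1},y_1^{\pm1},\dots,y_n^{\pm1}]^{\mathcal S_k}$ ($\mathcal S_k$ permuting the $x_i$) by the ideal of elements that vanish whenever $(x_1,\dots,x_k)$ is specialized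 to $(y_{i_1},\dots,y_{i_k})$ for any $i_1<\dots<i_k$. It is known that the classes of the $G^\lambda(\bar x;\vec y)$ (equally, of the $G^\lambda(\bar x;\overleftarrow{y})$) form a $\mathbb Z[y_1^{\pm1},\dots,y_n^{\pm1}]$-basis. **Equivariant puzzles.** Consider the triangular lattice of unit equilateral triangles with horizontal edges. Each unit triangle has a horizontal edge $h$, an edge $a$ in direction $60^\circ/240^\circ$ and an edge $b$ in direction $120^\circ/300^\circ$; for an up-pointing triangle $a$ is the left and $b$ the right edge; for a down-pointing triangle $a$ is the right and $b$ the left edge. Each edge has a state, a subset of $\{R,G\}$ (red, green), written $\emptyset,R,G,RG$. The allowed tiles, given by the states $(h,a,b)$, are $E=(\emptyset,\emptyset,\emptyset)$, $G_1=(G,G,\emptyset)$, $G_2=(G,RG,R)$, $R_1=(R,\emptyset,R)$, $R_2=(R,G,RG)$, $Q=(RG,G,R)$ (equivariant tile), for both up- and down-pointing triangles, and the $K$-tile $K=(\emptyset,RG,RG)$ for up-pointing triangles only. An equivariant puzzle in a domain is an assignment of an allowed tile to every unit triangle of the domain such that triangles sharing an edge assign it the same state. **Boundary conditions.** Horizontal boundary edges must be in state $R$ or $G$; boundary edges in direction $60^\circ/240^\circ$ in state $G$ or $\emptyset$; boundary edges in direction $120^\circ/300^\circ$ in state $R$ or $\emptyset$. A side of length $n$, read in a given direction, encodes the Young diagram whose frame is the set of positions (numbered $1,\dots,n$ along the reading direction) of the $G$ edges for horizontal and $60^\circ/240^\circ$ sides, and of the $\emptyset$ edges for $120^\circ/300^\circ$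 sides. **Modified weights.** An elementary lozenge is the union of an up-pointing unit triangle and the down-pointing unit triangle just below it, sharing a horizontal edge, both in the domain. Its modified weight depends on a parameter $w$ (depending on its location) and on its (upper tile, lower tile): $(G_2,G_1)$ has weight $w$; $(R_1,R_2)$ has weight $w$; $(Q,Q)$ has weight $1-w$; $(K,E)$ has weight $-1$; all the others, $(G_1,G_1),(G_1,G_2),(G_2,G_2),(R_1,R_1),(R_2,R_1),(R_2,R_2),(E,E)$, have weight $1$. The modified weight of an equivariant puzzle is the product of the modified weights of all its elementary lozenges (unit triangles not belonging to an elementary lozenge contribute no factor). -}

module Defs where

open import Algebra.Bundles using (RawRing)
import Algebra.Definitions.RawSemiring as RawSemiringDefinitions
open import Data.Bool.Base using (if_then_else_)
import Data.Bool.Properties as Bool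
open import Data.Fin.Base
  using (Fin; zero; suc; toℕ; _<_; _↑ˡ_; _↑ʳ_; splitAt; join; inject₁; inject≤; opposite)
open import Data.Fin.Permutation using (Permutation′; _⟨$⟩ʳ_)
open import Data.Fin.Permutation.Components using (transpose)
open import Data.Fin.Properties using (all?)
open import Data.Fin.Subset using (Subset; Side; inside; outside; ∣_∣; _∈_; _∉_)
open import Data.Integer.Base as ℤ using (ℤ; 0ℤ; 1ℤ; -1ℤ)
import Data.Integer.Properties as ℤ
open import Data.List.Base as List using (List; []; _∷_; _++_; cartesianProductWith; mapMaybe; filter)
import Data.Maybe.Base as Maybe
open import Data.Nat.Base as ℕ using (ℕ; zero; suc; _∸_)
import Data.Nat.Properties as ℕ
open import Data.Product.Base using (Σ-syntax; _×_; _,_; proj₁; proj₂)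
import Data.Sum.Base as Sum
open import Data.Unit.Base using (⊤; tt)
open import Data.Vec.Base as Vec using (Vec; []; _∷_; _∷ʳ_; _[_]≔_; lookup)
open import Data.Vec.Properties using (≡-dec)
open import Function.Base using (_∘_; id)
open import Function.Bundles using (_⇔_)
open import Level using (0ℓ)
open import Relation.Binary.Definitions using (DecidableEquality)
open import Relation.Binary.PropositionalEquality using (_≡_)
open import Relation.Nullary.Decidable using (Dec; yes; does; dec⇒maybe; _×-dec_)

-- Laurent polynomials over ℤ in m variables: lists of terms (coefficient ,
-- exponents).  The same exponents may occur several times; _≈_ compares
-- total coefficients.
Laurent : ℕ → Set
Laurent m = List (ℤ × Vec ℤ m)

coeff : ∀ {m} → Laurent m → Vec ℤ m → ℤ
coeff []             e = 0ℤ
coeff ((c , e′) ∷ f) e =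
  (if does (≡-dec ℤ._≟_ e′ e) then c else 0ℤ) ℤ.+ coeff f e

infix 4 _≈_
_≈_ : ∀ {m} → Laurent m → Laurent m → Set
f ≈ g = ∀ e → coeff f e ≡ coeff g e

infixl 6 _+_ _-_
infixl 7 _*_
infix  8 -_

0# 1# : ∀ {m} → Laurent m
0# = []
1# = (1ℤ , Vec.replicate _ 0ℤ) ∷ []

_+_ _*_ : ∀ {m} → Laurent m → Laurent m → Laurent m
f + g = f ++ g
f * g = cartesianProductWith (λ (c , e) (c′ , e′) → c ℤ.* c′ , Vec.zipWith ℤ._+_ e e′) f g

-_ : ∀ {m} → Laurent m → Laurent m
- f = List.map (λ (c , e) → ℤ.- c , e) f

_-_ : ∀ {m} → Laurent m → Laurent m → Laurent m
f - g = f + (- g)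

laurentRawRing : ℕ → RawRing 0ℓ 0ℓ
laurentRawRing m = record
  { Carrier = Laurent m ; _≈_ = _≈_
  ; _+_ = _+_ ; _*_ = _*_ ; -_ = -_ ; 0# = 0# ; 1# = 1# }

∏ : ∀ {m n} → (Fin n → Laurent m) → Laurent m
∏ {m} = RawSemiringDefinitions.product (RawRing.rawSemiring (laurentRawRing m))

∑ : ∀ {m} {A : Set} → List A → (A → Laurent m) → Laurent m
∑ xs f = List.foldr _+_ 0# (List.map f xs)

var var⁻¹ : ∀ {m} → Fin m → Laurent m
var   i = (1ℤ , Vec.replicate _ 0ℤ [ i ]≔ 1ℤ)  ∷ []
var⁻¹ i = (1ℤ , Vec.replicate _ 0ℤ [ i ]≔ -1ℤ) ∷ []

renameExponents : ∀ {m p} → (Fin m → Fin p) → Vec ℤ m → Vec ℤ p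
renameExponents ρ []      = Vec.replicate _ 0ℤ
renameExponents ρ (a ∷ e) =
  Vec.updateAt (renameExponents (ρ ∘ suc) e) (ρ zero) (λ b → a ℤ.+ b)

-- The ring homomorphism substituting var (ρ i) for var i; ρ need not be
-- injective.
rename : ∀ {m p} → (Fin m → Fin p) → Laurent m → Laurent p
rename ρ = List.map (λ (c , e) → c , renameExponents ρ e)

-- A Young diagram in the k × (n - k) rectangle, encoded by its frame.
-- Positions are numbered from 0, so {1,…,n} becomes Fin n.
Frame : ℕ → ℕ → Set
Frame n k = Σ[ p ∈ Subset n ] ∣ p ∣ ≡ k

subsets : ∀ n → List (Subset n)
subsets zero    = [] ∷ []
subsets (suc n) = List.map (outside ∷_) (subsets n) ++ List.map (inside ∷_) (subsets n)

frames : ∀ n k → List (Frame n k)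
frames n k = mapMaybe (λ p → Maybe.map (p ,_) (dec⇒maybe (∣ p ∣ ℕ.≟ k))) (subsets n)

IsFullRectangle : ∀ {n k} → Frame n k → Set
IsFullRectangle {n} {k} (p , _) = ∀ i → i ∈ p ⇔ n ∸ k ℕ.≤ toℕ i

-- i⁺ is i + 1, and ν is obtained from κ by replacing i⁺ with i.
Lowers : ∀ {n k} → Fin n → Fin n → Frame n k → Frame n k → Set
Lowers i i⁺ (κ , _) (ν , _) =
  toℕ i⁺ ≡ suc (toℕ i) × i⁺ ∈ κ × i ∉ κ × ν ≡ κ [ i⁺ ]≔ outside [ i ]≔ inside

-- The first k of the k + n variables are the x's, the others the y's.
module Grassmannian (k n : ℕ) where

  x : Fin k → Laurent (k ℕ.+ n)
  x i = var (i ↑ˡ n)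

  y y⁻¹ : Fin n → Laurent (k ℕ.+ n)
  y   j = var (k ↑ʳ j)
  y⁻¹ j = var⁻¹ (k ↑ʳ j)

  mapX : (Fin k → Fin k) → Laurent (k ℕ.+ n) → Laurent (k ℕ.+ n)
  mapX σ = rename (join k n ∘ Sum.map₁ σ ∘ splitAt k)

  mapY : (Fin n → Fin n) → Laurent (k ℕ.+ n) → Laurent (k ℕ.+ n)
  mapY σ = rename (join k n ∘ Sum.map₂ σ ∘ splitAt k)

  reverseY : Laurent (k ℕ.+ n) → Laurent (k ℕ.+ n)
  reverseY = mapY opposite

  fromY : Laurent n → Laurent (k ℕ.+ n)
  fromY = rename (k ↑ʳ_)

  specialize : (Fin k → Fin n) → Laurent (k ℕ.+ n) → Laurent n
  specialize ι = rename (Sum.[ ι , id ]′ ∘ splitAt k)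

  Symmetric : Laurent (k ℕ.+ n) → Set
  Symmetric f = (π : Permutation′ k) → mapX (π ⟨$⟩ʳ_) f ≈ f

  InIdeal : Laurent (k ℕ.+ n) → Set
  InIdeal f = Symmetric f ×
    ((ι : Fin k → Fin n) → (∀ {a b} → a < b → ι a < ι b) → specialize ι f ≈ 0#)

  -- Equality in K_T(Gr(k,n)): a partial equivalence relation, defined
  -- exactly on the 𝒮_k-invariant Laurent polynomials.
  infix 4 _≈ᴷ_
  _≈ᴷ_ : Laurent (k ℕ.+ n) → Laurent (k ℕ.+ n) → Set
  f ≈ᴷ g = Symmetric f × Symmetric g × InIdeal (f - g)

  -- g = Dᵢ f.  Laurent polynomials form a domain, so g is determined up to ≈.
  IsDividedDifference : Fin n → Fin n → Laurent (k ℕ.+ n) → Laurent (k ℕ.+ n) → Set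
  IsDividedDifference i i⁺ f g =
    (y i - y i⁺) * g ≈ y i * f - y i⁺ * mapY (transpose i i⁺) f

  record IsDoubleGrothendieck (G : Frame n k → Laurent (k ℕ.+ n)) : Set where
    field
      full  : ∀ κ → IsFullRectangle κ →
              G κ ≈ ∏ λ (i : Fin k) → ∏ λ (j : Fin (n ∸ k)) →
                1# - x i * y⁻¹ (inject≤ j (ℕ.m∸n≤m n k))
      lower : ∀ i i⁺ κ ν → Lowers i i⁺ κ ν → IsDividedDifference i i⁺ (G κ) (G ν)

-- A subset of {R , G}, as its indicator vector in this order.
State : Set
State = Subset 2

pattern ∅ₛ  = outside ∷ outside ∷ []
pattern Rₛ  = inside  ∷ outside ∷ []
pattern Gₛ  = outside ∷ inside  ∷ []
pattern RGₛ = inside  ∷ inside  ∷ []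

_≟ₛ_ : DecidableEquality State
_≟ₛ_ = ≡-dec Bool._≟_

data Orientation : Set where
  up down : Orientation

data Tile : Orientation → Set where
  E G₁ G₂ R₁ R₂ Q : ∀ {o} → Tile o
  K               : Tile up

tiles : ∀ o → List (Tile o)
tiles up   = E ∷ G₁ ∷ G₂ ∷ R₁ ∷ R₂ ∷ Q ∷ K ∷ []
tiles down = E ∷ G₁ ∷ G₂ ∷ R₁ ∷ R₂ ∷ Q ∷ []

-- States of the horizontal, the 60°/240° and the 120°/300° edge.
edges : ∀ {o} → Tile o → State × State × State
edges E  = ∅ₛ  , ∅ₛ  , ∅ₛ
edges G₁ = Gₛ  , Gₛ  , ∅ₛ
edges G₂ = Gₛ  , RGₛ , Rₛ
edges R₁ = Rₛ  , ∅ₛ  , Rₛ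
edges R₂ = Rₛ  , Gₛ  , RGₛ
edges Q  = RGₛ , Gₛ  , Rₛ
edges K  = ∅ₛ  , RGₛ , RGₛ

hEdge aEdge bEdge : ∀ {o} → Tile o → State
hEdge = proj₁ ∘ edges
aEdge = proj₁ ∘ proj₂ ∘ edges
bEdge = proj₂ ∘ proj₂ ∘ edges

-- Tilings of a triangle of side m, built from the top corner by adding rows
-- at the bottom.  Both kinds of tiles of a row are listed from left to right:
-- the c-th down-pointing triangle lies between the c-th and the (c+1)-st
-- up-pointing ones, below the c-th up-pointing triangle of the previous row.
data Tiling : ℕ → Set where
  empty : Tiling 0
  row   : ∀ {m} → Tiling m → Vec (Tile down) m → Vec (Tile up) (suc m) → Tiling (suc m)

vectors : ∀ {A : Set} → List A → ∀ m → List (Vec A m)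
vectors xs zero    = [] ∷ []
vectors xs (suc m) = cartesianProductWith _∷_ xs (vectors xs m)

tilings : ∀ m → List (Tiling m)
tilings zero    = empty ∷ []
tilings (suc m) =
  cartesianProductWith (λ T (ds , us) → row T ds us) (tilings m)
    (cartesianProductWith _,_ (vectors (tiles down) m) (vectors (tiles up) (suc m)))

bottomRow : ∀ {m} → Tiling m → Vec (Tile up) m
bottomRow empty          = []
bottomRow (row T ds us) = us

Matching : ∀ {m} → Vec (Tile up) m → Vec (Tile down) m → Vec (Tile up) (suc m) → Set
Matching above ds us = ∀ c →
  hEdge (lookup ds c) ≡ hEdge (lookup above c) ×
  bEdge (lookup ds c) ≡ bEdge (lookup us (inject₁ c)) ×
  aEdge (lookup ds c) ≡ aEdge (lookup us (suc c))

Consistent : ∀ {m} → Tiling m → Set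
Consistent empty         = ⊤
Consistent (row T ds us) = Consistent T × Matching (bottomRow T) ds us

-- The left and right sides are read from the top corner, the bottom side
-- from right to left.
leftSide rightSide bottomSide : ∀ {m} → Tiling m → Vec State m
leftSide empty          = []
leftSide (row T ds us)  = leftSide T ∷ʳ aEdge (Vec.head us)
rightSide empty         = []
rightSide (row T ds us) = rightSide T ∷ʳ bEdge (Vec.last us)
bottomSide T            = Vec.reverse (Vec.map hEdge (bottomRow T))

leftState rightState bottomState : Side → State
leftState   s = if s then Gₛ else ∅ₛ
rightState  s = if s then ∅ₛ else Rₛ
bottomState s = if s then Gₛ else Rₛ

IsPuzzle : ∀ {n} (right bottom left : Subset n) → Tiling n → Set
IsPuzzle right bottom left T =
  Consistent T ×
  rightSide T  ≡ Vec.map rightState right ×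
  bottomSide T ≡ Vec.map bottomState bottom ×
  leftSide T   ≡ Vec.map leftState left

consistent? : ∀ {m} (T : Tiling m) → Dec (Consistent T)
consistent? empty         = yes tt
consistent? (row T ds us) = consistent? T ×-dec all? λ c →
  (_ ≟ₛ _) ×-dec (_ ≟ₛ _) ×-dec (_ ≟ₛ _)

isPuzzle? : ∀ {n} (right bottom left : Subset n) (T : Tiling n) →
            Dec (IsPuzzle right bottom left T)
isPuzzle? right bottom left T =
  consistent? T ×-dec ≡-dec _≟ₛ_ _ _ ×-dec ≡-dec _≟ₛ_ _ _ ×-dec ≡-dec _≟ₛ_ _ _

puzzles : ∀ {n} (right bottom left : Subset n) → List (Tiling n)
puzzles {n} right bottom left = filter (isPuzzle? right bottom left) (tilings n)

-- Pairs of tiles with different horizontal edges do not occur in puzzles.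
lozengeWeight : ∀ {n} → Laurent n → (upper : Tile up) (lower : Tile down) → Laurent n
lozengeWeight w G₂ G₁ = w
lozengeWeight w R₁ R₂ = w
lozengeWeight w Q  Q  = 1# - w
lozengeWeight w K  E  = - 1#
lozengeWeight w _  _  = 1#

-- Here T is the top part, of side m, of a triangle of side n, and from the
-- c-th bottom edge of T, going straight down-left (down-right) leads to
-- the bottom edge dl c (dr c) of the whole triangle.  From the top edge of
-- the c-th down-pointing triangle of a row, one arrives at the bottom edge
-- c (going down-left) or c + 1 (going down-right) of this row.
weightIn : ∀ {m n} → (dl dr : Fin m → Fin n) → Tiling m → Laurent n
weightIn dl dr empty         = 1#
weightIn dl dr (row T ds us) =
  weightIn (dl ∘ inject₁) (dr ∘ suc) T *
  ∏ λ c → lozengeWeight (var (dr (suc c)) * var⁻¹ (dl (inject₁ c)))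
                        (lookup (bottomRow T) c) (lookup ds c)

modifiedWeight : ∀ {n} → Tiling n → Laurent n
modifiedWeight = weightIn id id

puzzleSum : ∀ {n k} (right bottom left : Frame n k) → Laurent n
puzzleSum (κ , _) (μ , _) (ν , _) = ∑ (puzzles κ μ ν) modifiedWeight

module Submission where

-- Following the lines that join opposite edges of its lozenges turns the sum
-- over puzzles into a partition function P^ν_{λμ}(y), whose local weights satisfy
-- Yang–Baxter equations and a compatibility relation at the bottom side.  Hence
-- exchanging y_i and y_{i+1} in P amounts to applying to λ, μ and ν the matrices
-- by which this exchange acts on G^λ(x;y), G^μ(x;ȳ) and G^ν(x;ȳ), where ȳ is the
-- reverse of y.  Let Φ_{λμ} be the difference of the two sides of the expansion.
-- If Φ_{λμ} vanishes at all fixed points x = y_S for all λ, and μ′ is obtained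
-- from μ by removing a box, then so does Φ_{λμ′}: the exchange acts on the Φ by an
-- invertible matrix for λ, times a matrix for μ whose entry at μ′ is nonzero.
-- The induction starts with the full rectangle μ, where the puzzles are frozen
-- and G^μ(x;ȳ) vanishes at all fixed points but one.  The same action, applied to
-- a linear relation between the G^ν(x;ȳ), shows that they are independent: at one
-- fixed point only G^∅ does not vanish, and the other coefficients are reached
-- by adding boxes.

open import Defs hiding (var; var⁻¹; ∑; ∏; _+_; _*_; _-_; -_; _≈_; 0#; 1#)
open import Algebra.Bundles using (CommutativeRing; Semiring)
open import Algebra.Solver.Ring.AlmostCommutativeRing
  using (fromCommutativeRing; _-Raw-AlmostCommutative⟶_)
open import Data.Bool.Base using (Bool; true; false; if_then_else_; _∧_)
import Data.Bool.Properties as Bool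
open import Data.Fin.Base as Fin
  using (Fin; zero; suc; toℕ; fromℕ; inject₁; inject≤; opposite; splitAt; join; combine; remQuot; _↑ˡ_; _↑ʳ_)
open import Data.Fin.Permutation using (Permutation′; permutation; _⟨$⟩ʳ_)
open import Data.Fin.Permutation.Components using (transpose)
import Data.Fin.Properties as Fin
open import Data.Fin.Subset using (Subset; Side; inside; outside; ∣_∣)
open import Data.Fin.Subset.Properties using (∣⊤∣≡n; ∣p∣≤n)
open import Data.Integer.Base as ℤ using (ℤ; -[1+_]; 0ℤ; 1ℤ; -1ℤ; _⊖_)
import Data.Integer.Properties as ℤ
open import Data.Integer.Solver using (module +-*-Solver)
open import Data.List.Base as List
  using (List; []; _∷_; _++_; length; filter; foldr; mapMaybe; cartesianProduct; cartesianProductWith)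
import Data.List.Properties as List
open import Data.Maybe.Base as Maybe using (Maybe; just; nothing; is-just)
open import Data.Nat.Base as ℕ using (ℕ; zero; suc; _≤_; _<_; _∸_; z≤n; s≤s) renaming (_+_ to _+ℕ_)
open import Data.Nat.Induction using (<-rec; <-wellFounded)
import Data.Nat.Properties as ℕ
open import Data.Product.Base using (Σ; ∃; ∃₂; _×_; _,_; proj₁; proj₂)
open import Data.Sum.Base as Sum using (_⊎_; inj₁; inj₂)
open import Data.Unit.Base using (⊤; tt)
open import Data.Vec.Base as Vec
  using (Vec; []; _∷_; _∷ʳ_; _[_]≔_; head; lookup; replicate; reverse; tabulate; updateAt; zipWith)
open import Data.Vec.Properties as Vec
  using (≡-dec; ∷-injectiveˡ; ∷-injectiveʳ; lookup∘tabulate; tabulate∘lookup; tabulate-cong; lookup-map; lookup-replicate;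
         lookup∘update; lookup∘update′; lookup∘updateAt; lookup∘updateAt′; lookup⇒[]=; []=⇒lookup;
         map-replicate; map-reverse; reverse-∷; reverse-involutive; reverse-injective; zipWith-comm; zipWith-assoc; zipWith-identityˡ)
open import Function.Base using (_∘_; id)
open import Function.Bundles using (_⇔_; mk⇔)
open import Function.Definitions using (Injective)
open import Induction.WellFounded using (Acc; acc)
open import Level using (0ℓ)
open import Relation.Binary.Definitions using (tri<; tri≈; tri>)
open import Relation.Binary.PropositionalEquality as ≡ using (_≡_; _≢_)
open import Relation.Nullary.Decidable using (Dec; yes; no; does; dec-true; dec⇒maybe; ¬?; _×-dec_)
open import Relation.Nullary.Negation using (¬_; contradiction)
open import Relation.Unary using (Decidable)

-- Only one of the three words is constrained when y_i and y_(i+1) are exchanged: the relation at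
-- the bottom side needs a G directly to the left of an R, which is where μ has a box that can be
-- removed. The words of λ and ν are arbitrary, so Φ has to be handled as a vector over all λ at
-- once, and the matrix for ν is moved from the values of G^ν to the puzzle sum by transposition. To
-- make the three exchanges concern the same pair of positions, all words are reread towards the
-- bottom side: position i of the right side, from the top, and of the left side, from the bottom,
-- are the ends of the lines that lead to the i-th bottom edge. Hence μ and ν appear reversed, and λ
-- does not. The main obstacle is the matrix for G itself. The definition describes the effect of
-- the exchange only where a box can be removed; that G^λ is invariant when i and i+1 are both in
-- the frame or both outside it has to be derived from the braid relation of the operators D_i. As
-- nothing can be divided, such identities are multiplied by differences of variables, which are
-- cancelled afterwards.

private variable
  n m k p : ℕ
  𝒜 ℬ 𝒞 : Set

-- Integer coefficients for the ring solver, and sums over lists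

module RingTools (R : CommutativeRing 0ℓ 0ℓ) where
  open CommutativeRing R hiding (zero)
  open import Data.Integer.Base using (+_)
  open import Algebra.Properties.Ring ring
    using (-‿distribˡ-*; -‿distribʳ-*; -0#≈0#; -‿+-comm; -‿involutive)
  open import Algebra.Properties.Semiring.Mult.TCOptimised semiring
    using (×-homo-+; ×1-homo-*; 1+×) renaming (_×_ to _·_)
  open import Relation.Binary.Reasoning.Setoid setoid

  ⟦_⟧ℤ : ℤ → Carrier
  ⟦ + n ⟧ℤ      = n · 1#
  ⟦ -[1+ n ] ⟧ℤ = - (suc n · 1#)

  ⟦⊖⟧ : ∀ m n → ⟦ m ⊖ n ⟧ℤ ≈ m · 1# - n · 1#
  ⟦⊖⟧ m zero = begin
    ⟦ m ⊖ 0 ⟧ℤ     ≡⟨ ≡.cong ⟦_⟧ℤ (ℤ.⊖-≥ {m} ℕ.z≤n) ⟩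
    m · 1#         ≈⟨ +-identityʳ _ ⟨
    m · 1# + 0#    ≈⟨ +-congˡ -0#≈0# ⟨
    m · 1# - 0#    ∎
  ⟦⊖⟧ zero (suc n) = sym (+-identityˡ _)
  ⟦⊖⟧ (suc m) (suc n) = begin
    ⟦ suc m ⊖ suc n ⟧ℤ                   ≡⟨ ≡.cong ⟦_⟧ℤ (ℤ.[1+m]⊖[1+n]≡m⊖n m n) ⟩
    ⟦ m ⊖ n ⟧ℤ                           ≈⟨ ⟦⊖⟧ m n ⟩
    m · 1# - n · 1#                      ≈⟨ +-identityˡ _ ⟨
    0# + (m · 1# - n · 1#)               ≈⟨ +-congʳ (-‿inverseʳ 1#) ⟨
    (1# - 1#) + (m · 1# - n · 1#)        ≈⟨ +-assoc _ _ _ ⟩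
    1# + (- 1# + (m · 1# - n · 1#))      ≈⟨ +-congˡ (+-assoc _ _ _) ⟨
    1# + ((- 1# + m · 1#) - n · 1#)      ≈⟨ +-congˡ (+-congʳ (+-comm _ _)) ⟩
    1# + ((m · 1# - 1#) - n · 1#)        ≈⟨ +-congˡ (+-assoc _ _ _) ⟩
    1# + (m · 1# + (- 1# - n · 1#))      ≈⟨ +-assoc _ _ _ ⟨
    1# + m · 1# + (- 1# - n · 1#)        ≈⟨ +-cong (sym (1+× m 1#)) (-‿+-comm _ _) ⟩
    suc m · 1# - (1# + n · 1#)           ≈⟨ +-congˡ (-‿cong (1+× n 1#)) ⟨
    suc m · 1# - suc n · 1#              ∎

  ⟦⟧-neg : ∀ i → ⟦ ℤ.- i ⟧ℤ ≈ - ⟦ i ⟧ℤ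
  ⟦⟧-neg (+ zero)  = sym -0#≈0#
  ⟦⟧-neg (+ suc n) = refl
  ⟦⟧-neg -[1+ n ]  = sym (-‿involutive _)

  ⟦⟧-+ : ∀ i j → ⟦ i ℤ.+ j ⟧ℤ ≈ ⟦ i ⟧ℤ + ⟦ j ⟧ℤ
  ⟦⟧-+ (+ m)      (+ n)      = ×-homo-+ 1# m n
  ⟦⟧-+ (+ m)      (-[1+ n ]) = ⟦⊖⟧ m (suc n)
  ⟦⟧-+ (-[1+ m ]) (+ n)      = trans (⟦⊖⟧ n (suc m)) (+-comm _ _)
  ⟦⟧-+ (-[1+ m ]) (-[1+ n ]) = begin
    - (suc (suc (m ℕ.+ n)) · 1#)        ≡⟨ ≡.cong (λ l → - (suc l · 1#)) (≡.sym (ℕ.+-suc m n)) ⟩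
    - ((suc m ℕ.+ suc n) · 1#)          ≈⟨ -‿cong (×-homo-+ 1# (suc m) (suc n)) ⟩
    - (suc m · 1# + suc n · 1#)         ≈⟨ -‿+-comm _ _ ⟨
    - (suc m · 1#) - suc n · 1#         ∎

  ⟦⟧-*⁺ : ∀ m j → ⟦ + m ℤ.* j ⟧ℤ ≈ m · 1# * ⟦ j ⟧ℤ
  ⟦⟧-*⁺ m (+ n) = begin
    ⟦ + m ℤ.* + n ⟧ℤ       ≡⟨ ≡.cong ⟦_⟧ℤ (ℤ.pos-* m n) ⟨
    (m ℕ.* n) · 1#         ≈⟨ ×1-homo-* m n ⟩
    m · 1# * (n · 1#)      ∎
  ⟦⟧-*⁺ m -[1+ n ] = begin
    ⟦ + m ℤ.* -[1+ n ] ⟧ℤ          ≡⟨ ≡.cong ⟦_⟧ℤ (ℤ.neg-distribʳ-* (+ m) (+ suc n)) ⟨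
    ⟦ ℤ.- (+ m ℤ.* + suc n) ⟧ℤ     ≈⟨ ⟦⟧-neg (+ m ℤ.* + suc n) ⟩
    - ⟦ + m ℤ.* + suc n ⟧ℤ         ≈⟨ -‿cong (⟦⟧-*⁺ m (+ suc n)) ⟩
    - (m · 1# * (suc n · 1#))      ≈⟨ -‿distribʳ-* _ _ ⟩
    m · 1# * - (suc n · 1#)        ∎

  ⟦⟧-* : ∀ i j → ⟦ i ℤ.* j ⟧ℤ ≈ ⟦ i ⟧ℤ * ⟦ j ⟧ℤ
  ⟦⟧-* (+ m)    j = ⟦⟧-*⁺ m j
  ⟦⟧-* -[1+ m ] j = begin
    ⟦ -[1+ m ] ℤ.* j ⟧ℤ           ≡⟨ ≡.cong ⟦_⟧ℤ (ℤ.neg-distribˡ-* (+ suc m) j) ⟨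
    ⟦ ℤ.- (+ suc m ℤ.* j) ⟧ℤ      ≈⟨ ⟦⟧-neg (+ suc m ℤ.* j) ⟩
    - ⟦ + suc m ℤ.* j ⟧ℤ          ≈⟨ -‿cong (⟦⟧-*⁺ (suc m) j) ⟩
    - (suc m · 1# * ⟦ j ⟧ℤ)       ≈⟨ -‿distribˡ-* _ _ ⟩
    - (suc m · 1#) * ⟦ j ⟧ℤ       ∎

  -- The solver compares coefficients, and equality in R need not be decidable; integers are enough
  -- for all identities below.
  ℤ⟶R : ℤ.+-*-rawRing -Raw-AlmostCommutative⟶ fromCommutativeRing R
  ℤ⟶R = record
    { ⟦_⟧ = ⟦_⟧ℤ ; +-homo = ⟦⟧-+ ; *-homo = ⟦⟧-* ; -‿homo = ⟦⟧-neg
    ; 0-homo = refl ; 1-homo = refl }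

  ℤ-weak≟ : ∀ i j → Maybe (⟦ i ⟧ℤ ≈ ⟦ j ⟧ℤ)
  ℤ-weak≟ i j with i ℤ.≟ j
  ... | yes ≡.refl = just refl
  ... | no _       = nothing

  open import Algebra.Solver.Ring ℤ.+-*-rawRing (fromCommutativeRing R) ℤ⟶R ℤ-weak≟ public
    using (solve; prove; _:=_; _:+_; _:*_; _:-_; :-_; con; var; Polynomial; ⟦_⟧; normalise; _≟N_; ⟦_⟧N-cong)

  -- The trivial rows of the exchange matrices, with `diag` equal to 1 and `off` equal to 0, appear
  -- in this form.
  unit-combination : ∀ x z → x ≈ 1# * x + 0# * z
  unit-combination = solve 2 (λ x z → x := con 1ℤ :* x :+ con 0ℤ :* z) refl

  ∑ : List 𝒜 → (𝒜 → Carrier) → Carrier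
  ∑ xs f = foldr _+_ 0# (List.map f xs)

  ∑-cong : ∀ (xs : List 𝒜) {f g} → (∀ x → f x ≈ g x) → ∑ xs f ≈ ∑ xs g
  ∑-cong []       f≈g = refl
  ∑-cong (x ∷ xs) f≈g = +-cong (f≈g x) (∑-cong xs f≈g)

  ∑-zero : ∀ (xs : List 𝒜) {f} → (∀ x → f x ≈ 0#) → ∑ xs f ≈ 0#
  ∑-zero []       f≈0 = refl
  ∑-zero (x ∷ xs) f≈0 = trans (+-cong (f≈0 x) (∑-zero xs f≈0)) (+-identityˡ 0#)

  ∑-+ : ∀ (xs : List 𝒜) f g → ∑ xs (λ x → f x + g x) ≈ ∑ xs f + ∑ xs g
  ∑-+ []       f g = sym (+-identityˡ 0#)
  ∑-+ (x ∷ xs) f g = trans (+-congˡ (∑-+ xs f g))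
    (solve 4 (λ a b c d → (a :+ b) :+ (c :+ d) := (a :+ c) :+ (b :+ d)) refl _ _ _ _)

  ∑-*ˡ : ∀ (xs : List 𝒜) c f → ∑ xs (λ x → c * f x) ≈ c * ∑ xs f
  ∑-*ˡ []       c f = sym (zeroʳ c)
  ∑-*ˡ (x ∷ xs) c f = trans (+-congˡ (∑-*ˡ xs c f)) (sym (distribˡ _ _ _))

  ∑-*ʳ : ∀ (xs : List 𝒜) c f → ∑ xs (λ x → f x * c) ≈ ∑ xs f * c
  ∑-*ʳ xs c f = trans (∑-cong xs λ x → *-comm _ _) (trans (∑-*ˡ xs c f) (*-comm _ _))

  ∑-neg : ∀ (xs : List 𝒜) f → ∑ xs (λ x → - f x) ≈ - ∑ xs f
  ∑-neg []       f = sym -0#≈0#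
  ∑-neg (x ∷ xs) f = trans (+-congˡ (∑-neg xs f)) (-‿+-comm _ _)

  ∑-++ : ∀ (xs ys : List 𝒜) f → ∑ (xs ++ ys) f ≈ ∑ xs f + ∑ ys f
  ∑-++ []       ys f = sym (+-identityˡ _)
  ∑-++ (x ∷ xs) ys f = trans (+-congˡ (∑-++ xs ys f)) (sym (+-assoc _ _ _))

  ∑-map : ∀ (g : 𝒜 → ℬ) xs f → ∑ (List.map g xs) f ≈ ∑ xs (f ∘ g)
  ∑-map g []       f = refl
  ∑-map g (x ∷ xs) f = +-congˡ (∑-map g xs f)

  ∑-comm : ∀ (xs : List 𝒜) (ys : List ℬ) (f : 𝒜 → ℬ → Carrier) →
           ∑ xs (λ x → ∑ ys (f x)) ≈ ∑ ys (λ y → ∑ xs λ x → f x y)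
  ∑-comm []       ys f = sym (∑-zero ys λ _ → refl)
  ∑-comm (x ∷ xs) ys f =
    trans (+-congˡ (∑-comm xs ys f)) (sym (∑-+ ys (f x) (λ y → ∑ xs λ x → f x y)))

  ∑-cartesianProductWith : ∀ (g : 𝒜 → ℬ → 𝒞) xs ys f →
    ∑ (cartesianProductWith g xs ys) f ≈ ∑ xs (λ x → ∑ ys λ y → f (g x y))
  ∑-cartesianProductWith g []       ys f = refl
  ∑-cartesianProductWith g (x ∷ xs) ys f =
    trans (∑-++ (List.map (g x) ys) _ f)
          (+-cong (∑-map (g x) ys f) (∑-cartesianProductWith g xs ys f))

  when : ∀ {P : Set} → Dec P → Carrier → Carrier
  when P? x = if does P? then x else 0#

  module _ {P Q : Set} where

    when-⇔ : (P? : Dec P) (Q? : Dec Q) → (P → Q) → (Q → P) → ∀ {x y} →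
             (P → x ≈ y) → when P? x ≈ when Q? y
    when-⇔ (yes p) (yes q) to from x≈y = x≈y p
    when-⇔ (no ¬p) (no ¬q) to from x≈y = refl
    when-⇔ (yes p) (no ¬q) to from x≈y = contradiction (to p) ¬q
    when-⇔ (no ¬p) (yes q) to from x≈y = contradiction (from q) ¬p

    when-× : (P? : Dec P) (Q? : Dec Q) → ∀ x → when P? (when Q? x) ≈ when (P? ×-dec Q?) x
    when-× (yes p) (yes q) x = refl
    when-× (yes p) (no ¬q) x = refl
    when-× (no ¬p) Q?      x = refl

  module _ {P : Set} where

    when-*ˡ : ∀ (P? : Dec P) c x → when P? (c * x) ≈ c * when P? x
    when-*ˡ P? c x with does P?
    ... | true  = refl
    ... | false = sym (zeroʳ c)

    when-*ʳ : ∀ (P? : Dec P) c x → when P? (x * c) ≈ when P? x * c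
    when-*ʳ P? c x with does P?
    ... | true  = refl
    ... | false = sym (zeroˡ c)

    when-∑ : ∀ (P? : Dec P) (xs : List 𝒜) f → ∑ xs (λ x → when P? (f x)) ≈ when P? (∑ xs f)
    when-∑ P? xs f with does P?
    ... | true  = refl
    ... | false = ∑-zero xs λ _ → refl

    when-yes : (P? : Dec P) → P → ∀ x → when P? x ≈ x
    when-yes (yes _) p x = refl
    when-yes (no ¬p) p x = contradiction p ¬p

    when-no : (P? : Dec P) → ¬ P → ∀ x → when P? x ≈ 0#
    when-no (yes p) ¬p x = contradiction p ¬p
    when-no (no _)  ¬p x = refl

  ∑-filter : ∀ {P : 𝒜 → Set} (P? : Decidable P) xs f →
             ∑ (filter P? xs) f ≈ ∑ xs (λ x → when (P? x) (f x))
  ∑-filter P? []       f = refl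
  ∑-filter P? (x ∷ xs) f with does (P? x)
  ... | true  = +-congˡ (∑-filter P? xs f)
  ... | false = trans (∑-filter P? xs f) (sym (+-identityˡ _))

-- Local weights and the Yang–Baxter equations

data Scalar : Set where
  one minusOne param oneMinusParam : Scalar

scalar : Tile up → Tile down → Scalar
scalar G₂ G₁ = param
scalar R₁ R₂ = param
scalar Q  Q  = oneMinusParam
scalar K  E  = minusOne
scalar _  _  = one

-- Keyed by the two upper edges, through which two lines enter. The a-line leaves through the lower
-- right edge, the b-line through the lower left one.
lozenges : State → State → List (Tile up × Tile down)
lozenges a b = filter (λ (u , d) → (hEdge d ≟ₛ hEdge u) ×-dec (aEdge u ≟ₛ a) ×-dec (bEdge u ≟ₛ b))
  (cartesianProduct (tiles up) (tiles down))

capTiles : (a b h : State) → List (Tile up)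
capTiles a b h = filter (λ u → (aEdge u ≟ₛ a) ×-dec (bEdge u ≟ₛ b) ×-dec (hEdge u ≟ₛ h)) (tiles up)

-- The kinds of rows of the exchange matrices on pairs of neighbouring states. Boundary states only
-- lead to `stay` and `split`; `scale` and `move` concern pairs of ∅ and RG on b-edges, which occur
-- inside a puzzle.
data Rule : Set where
  stay scale split move : Rule

-- Solutions of the Yang–Baxter equations for the weights of the lozenges.  On
-- the states that occur on the boundary, they describe how the exchange of two
-- neighbouring y's acts on the polynomials G (g-relation, h-relation).
ruleᵃ ruleᵇ : State → State → Rule
ruleᵃ Gₛ  ∅ₛ  = split
ruleᵃ Gₛ  RGₛ = split
ruleᵃ RGₛ ∅ₛ  = split
ruleᵃ _   _   = stay
ruleᵇ Rₛ  ∅ₛ  = split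
ruleᵇ Rₛ  RGₛ = split
ruleᵇ ∅ₛ  RGₛ = scale
ruleᵇ RGₛ ∅ₛ  = move
ruleᵇ _   _   = stay

-- Over bare operations, so that the same formulas can be read in a ring and as polynomials of the
-- solver.
module Weights (C : Set) (_+_ _*_ : C → C → C) (-_ : C → C) (0# 1# : C) where

  ∑ : {A : Set} → List A → (A → C) → C
  ∑ xs f = foldr _+_ 0# (List.map f xs)

  ⟦_⟧ₛ : Scalar → C → C
  ⟦ one ⟧ₛ           w = 1#
  ⟦ minusOne ⟧ₛ      w = - 1#
  ⟦ param ⟧ₛ         w = w
  ⟦ oneMinusParam ⟧ₛ w = 1# + (- w)

  -- Transfer operators are written in continuation form: k is a function of the
  -- outgoing edges.
  cross : C → (a b : State) → (State → State → C) → C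
  cross w a b k = ∑ (lozenges a b) λ (u , d) → ⟦ scalar u d ⟧ₛ w * k (bEdge d) (aEdge d)

  cap : (a b h : State) → C
  cap a b h = ∑ (capTiles a b h) λ _ → 1#

  diag off : Rule → C → C
  diag stay  t = 1#
  diag scale t = t
  diag split t = t
  diag move  t = 1#
  off stay  t = 0#
  off scale t = 0#
  off split t = 1# + (- t)
  off move  t = 1# + (- t)

  -- `actᵃ` takes `off` at the exchanged pair and is thus the transpose of the matrix with rows
  -- `ruleᵃ`: left words are later summed against values of G^ν, and `∑-actᵀ` moves the matrix
  -- across that sum.
  actᵃ actᵇ : C → (State → State → C) → State → State → C
  actᵃ t k x y = (diag (ruleᵃ x y) t * k x y) + (off (ruleᵃ y x) t * k y x)
  actᵇ t k x y = (diag (ruleᵇ x y) t * k x y) + (off (ruleᵇ x y) t * k y x)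

  cross₂ᵇ : C → C → (a b₁ b₂ : State) → (State → State → State → C) → C
  cross₂ᵇ w₁ w₂ a b₁ b₂ k =
    cross w₁ a b₁ λ d₁ a′ → cross w₂ a′ b₂ λ d₂ a″ → k a″ d₁ d₂

  -- The b-line comes from the upper right, so it meets the line of a₂, the higher one, before that
  -- of a₁.
  cross₂ᵃ : C → C → (b a₁ a₂ : State) → (State → State → State → C) → C
  cross₂ᵃ w₁ w₂ b a₁ a₂ k =
    cross w₂ a₂ b λ b′ c₂ → cross w₁ a₁ b′ λ b″ c₁ → k b″ c₁ c₂

  -- The puzzles of side 2: one lozenge above two bottom tiles.
  caps : C → (a₁ a₂ b₁ b₂ h₁ h₂ : State) → C
  caps w a₁ a₂ b₁ b₂ h₁ h₂ = cross w a₂ b₁ λ b′ a′ → cap a₁ b′ h₁ * cap a′ b₂ h₂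

  -- Found by computation: the cofactor of t t⁻¹ − 1 in the relation cap-exchange,
  -- when t and t⁻¹ are treated as independent variables.
  defect : C → (a₁ a₂ b₁ b₂ : State) → C
  defect t ∅ₛ  Gₛ  Rₛ  ∅ₛ  = t + (- 1#)
  defect t Gₛ  ∅ₛ  Rₛ  ∅ₛ  = - t
  defect t Gₛ  Gₛ  ∅ₛ  RGₛ = 1#
  defect t Gₛ  Gₛ  RGₛ ∅ₛ  = - 1#
  defect t Gₛ  RGₛ Rₛ  RGₛ = t
  defect t RGₛ Gₛ  Rₛ  RGₛ = 1# + (- t)
  defect t _   _   _   _   = 0#

-- Verification of the local relations by normal forms of polynomials

toFin : State → Fin 4
toFin ∅ₛ  = zero
toFin Rₛ  = suc zero
toFin Gₛ  = suc (suc zero)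
toFin RGₛ = suc (suc (suc zero))

fromFin : Fin 4 → State
fromFin zero                   = ∅ₛ
fromFin (suc zero)             = Rₛ
fromFin (suc (suc zero))       = Gₛ
fromFin (suc (suc (suc zero))) = RGₛ

fromFin∘toFin : ∀ s → fromFin (toFin s) ≡ s
fromFin∘toFin ∅ₛ  = ≡.refl
fromFin∘toFin Rₛ  = ≡.refl
fromFin∘toFin Gₛ  = ≡.refl
fromFin∘toFin RGₛ = ≡.refl

module Local (R : CommutativeRing 0ℓ 0ℓ) where
  open CommutativeRing R hiding (zero)
  open RingTools R hiding (∑)
  open Weights Carrier _+_ _*_ -_ 0# 1# public
  open import Relation.Binary.Reasoning.Setoid setoid

  cross-cong : ∀ w a b {k l} → (∀ x y → k x y ≈ l x y) → cross w a b k ≈ cross w a b l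
  cross-cong w a b k≈l = ∑-cong (lozenges a b) λ (u , d) → *-congˡ (k≈l _ _)

  module Reified (n : ℕ) (ρ : Vec Carrier n) where
    module P = Weights (Polynomial n) _:+_ _:*_ :-_ (con 0ℤ) (con 1ℤ)

    ⟦_⟧ρ : Polynomial n → Carrier
    ⟦ p ⟧ρ = ⟦ p ⟧ ρ

    ⟦∑⟧ : ∀ {A : Set} (xs : List A) f → ⟦ P.∑ xs f ⟧ρ ≡ ∑ xs (λ x → ⟦ f x ⟧ρ)
    ⟦∑⟧ []       f = ≡.refl
    ⟦∑⟧ (x ∷ xs) f = ≡.cong (⟦ f x ⟧ρ +_) (⟦∑⟧ xs f)

    ⟦scalar⟧ : ∀ c w → ⟦ P.⟦ c ⟧ₛ w ⟧ρ ≡ ⟦ c ⟧ₛ ⟦ w ⟧ρ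
    ⟦scalar⟧ one           w = ≡.refl
    ⟦scalar⟧ minusOne      w = ≡.refl
    ⟦scalar⟧ param         w = ≡.refl
    ⟦scalar⟧ oneMinusParam w = ≡.refl

    ⟦diag⟧ : ∀ r t → ⟦ P.diag r t ⟧ρ ≡ diag r ⟦ t ⟧ρ
    ⟦diag⟧ stay  t = ≡.refl
    ⟦diag⟧ scale t = ≡.refl
    ⟦diag⟧ split t = ≡.refl
    ⟦diag⟧ move  t = ≡.refl

    ⟦off⟧ : ∀ r t → ⟦ P.off r t ⟧ρ ≡ off r ⟦ t ⟧ρ
    ⟦off⟧ stay  t = ≡.refl
    ⟦off⟧ scale t = ≡.refl
    ⟦off⟧ split t = ≡.refl
    ⟦off⟧ move  t = ≡.refl

    ⟦cross⟧ : ∀ w a b k l → (∀ x y → ⟦ k x y ⟧ρ ≈ l x y) →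
              ⟦ P.cross w a b k ⟧ρ ≈ cross ⟦ w ⟧ρ a b l
    ⟦cross⟧ w a b k l k≈l = trans
      (reflexive (⟦∑⟧ (lozenges a b) _))
      (∑-cong (lozenges a b) λ (u , d) → *-cong (reflexive (⟦scalar⟧ (scalar u d) w)) (k≈l _ _))

    ⟦cross₂ᵇ⟧ : ∀ w₁ w₂ a b₁ b₂ k l → (∀ x y z → ⟦ k x y z ⟧ρ ≈ l x y z) →
                ⟦ P.cross₂ᵇ w₁ w₂ a b₁ b₂ k ⟧ρ ≈ cross₂ᵇ ⟦ w₁ ⟧ρ ⟦ w₂ ⟧ρ a b₁ b₂ l
    ⟦cross₂ᵇ⟧ w₁ w₂ a b₁ b₂ k l k≈l =
      ⟦cross⟧ w₁ a b₁ (λ d₁ a′ → P.cross w₂ a′ b₂ λ d₂ a″ → k a″ d₁ d₂)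
                      (λ d₁ a′ → cross ⟦ w₂ ⟧ρ a′ b₂ λ d₂ a″ → l a″ d₁ d₂) λ d₁ a′ →
      ⟦cross⟧ w₂ a′ b₂ (λ d₂ a″ → k a″ d₁ d₂) (λ d₂ a″ → l a″ d₁ d₂) λ d₂ a″ → k≈l a″ d₁ d₂

    ⟦cross₂ᵃ⟧ : ∀ w₁ w₂ b a₁ a₂ k l → (∀ x y z → ⟦ k x y z ⟧ρ ≈ l x y z) →
                ⟦ P.cross₂ᵃ w₁ w₂ b a₁ a₂ k ⟧ρ ≈ cross₂ᵃ ⟦ w₁ ⟧ρ ⟦ w₂ ⟧ρ b a₁ a₂ l
    ⟦cross₂ᵃ⟧ w₁ w₂ b a₁ a₂ k l k≈l =
      ⟦cross⟧ w₂ a₂ b (λ b′ c₂ → P.cross w₁ a₁ b′ λ b″ c₁ → k b″ c₁ c₂)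
                      (λ b′ c₂ → cross ⟦ w₁ ⟧ρ a₁ b′ λ b″ c₁ → l b″ c₁ c₂) λ b′ c₂ →
      ⟦cross⟧ w₁ a₁ b′ (λ b″ c₁ → k b″ c₁ c₂) (λ b″ c₁ → l b″ c₁ c₂) λ b″ c₁ → k≈l b″ c₁ c₂

    ⟦actᵃ⟧ : ∀ t k l → (∀ x y → ⟦ k x y ⟧ρ ≈ l x y) →
             ∀ x y → ⟦ P.actᵃ t k x y ⟧ρ ≈ actᵃ ⟦ t ⟧ρ l x y
    ⟦actᵃ⟧ t k l k≈l x y = +-cong
      (*-cong (reflexive (⟦diag⟧ (ruleᵃ x y) t)) (k≈l x y))
      (*-cong (reflexive (⟦off⟧ (ruleᵃ y x) t)) (k≈l y x))

    ⟦actᵇ⟧ : ∀ t k l → (∀ x y → ⟦ k x y ⟧ρ ≈ l x y) →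
             ∀ x y → ⟦ P.actᵇ t k x y ⟧ρ ≈ actᵇ ⟦ t ⟧ρ l x y
    ⟦actᵇ⟧ t k l k≈l x y = +-cong
      (*-cong (reflexive (⟦diag⟧ (ruleᵇ x y) t)) (k≈l x y))
      (*-cong (reflexive (⟦off⟧ (ruleᵇ x y) t)) (k≈l y x))

    ⟦cap⟧ : ∀ a b h → ⟦ P.cap a b h ⟧ρ ≡ cap a b h
    ⟦cap⟧ a b h = ⟦∑⟧ (capTiles a b h) _

    -- The local relations are sums over tiles for up to 256 boundary words. Comparing normal forms
    -- for all words reduces each relation to one Boolean computation.
    agree : ∀ m → (Vec State m → Polynomial n × Polynomial n) → Bool
    agree zero    f = is-just (normalise (proj₁ (f [])) ≟N normalise (proj₂ (f [])))
    agree (suc m) f = agree m (f ∘ (∅ₛ ∷_)) ∧ agree m (f ∘ (Rₛ ∷_)) ∧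
                      agree m (f ∘ (Gₛ ∷_)) ∧ agree m (f ∘ (RGₛ ∷_))

    agree-sound : ∀ m f → agree m f ≡ true → ∀ v → ⟦ proj₁ (f v) ⟧ρ ≈ ⟦ proj₂ (f v) ⟧ρ
    agree-sound zero f eq [] with normalise (proj₁ (f [])) ≟N normalise (proj₂ (f []))
    ... | just eq′ = prove ρ (proj₁ (f [])) (proj₂ (f [])) (⟦ eq′ ⟧N-cong ρ)
    agree-sound (suc m) f eq (s ∷ v) = agree-sound m (f ∘ (s ∷_)) (each s) v
      where
      rest₁ = Bool.∧-conicalʳ (agree m (f ∘ (∅ₛ ∷_))) _ eq
      rest₂ = Bool.∧-conicalʳ (agree m (f ∘ (Rₛ ∷_))) _ rest₁
      each : ∀ s → agree m (f ∘ (s ∷_)) ≡ true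
      each ∅ₛ  = Bool.∧-conicalˡ (agree m (f ∘ (∅ₛ ∷_))) _ eq
      each Rₛ  = Bool.∧-conicalˡ (agree m (f ∘ (Rₛ ∷_))) _ rest₁
      each Gₛ  = Bool.∧-conicalˡ (agree m (f ∘ (Gₛ ∷_))) _ rest₂
      each RGₛ = Bool.∧-conicalʳ (agree m (f ∘ (Gₛ ∷_))) _ rest₂

  module YangBaxter (w t : Carrier) (k : State → State → State → Carrier) where
    -- The variables of the polynomials are w, t and the 64 values of k.
    decode₂ : State → Fin 4 × Fin 4 → Carrier
    decode₂ x (y , z) = k x (fromFin y) (fromFin z)

    decode₁ : Fin 4 × Fin 16 → Carrier
    decode₁ (x , i) = decode₂ (fromFin x) (remQuot {4} 4 i)

    decode : Fin 64 → Carrier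
    decode i = decode₁ (remQuot {4} 16 i)

    open Reified 66 (w ∷ t ∷ tabulate decode)

    W T : Polynomial 66
    W = var zero
    T = var (suc zero)

    κ : State → State → State → Polynomial 66
    κ x y z = var (2 ↑ʳ combine (toFin x) (combine {4} {4} (toFin y) (toFin z)))

    ⟦κ⟧ : ∀ x y z → ⟦ κ x y z ⟧ρ ≡ k x y z
    ⟦κ⟧ x y z =
      ≡.trans (lookup∘tabulate decode (combine X YZ))
      (≡.trans (≡.cong decode₁ (Fin.remQuot-combine {4} {16} X YZ))
      (≡.trans (≡.cong₂ decode₂ (fromFin∘toFin x) (Fin.remQuot-combine {4} {4} Y Z))
               (≡.cong₂ (k x) (fromFin∘toFin y) (fromFin∘toFin z))))
      where
      X = toFin x
      Y = toFin y
      Z = toFin z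
      YZ = combine {4} {4} Y Z

    ybᵇ : Vec State 3 → Polynomial 66 × Polynomial 66
    ybᵇ (a ∷ b₁ ∷ b₂ ∷ []) =
      P.actᵇ T (λ x y → P.cross₂ᵇ W (T :* W) a x y κ) b₁ b₂ ,
      P.cross₂ᵇ (T :* W) W a b₁ b₂ (λ a′ → P.actᵇ T (κ a′))

    -- The type checker runs the comparison for all 64 choices of a, b₁, b₂.
    agree-ybᵇ : agree 3 ybᵇ ≡ true
    agree-ybᵇ = ≡.refl

    -- This lets an exchange of two b-lines slide through an a-line. Both sides are linear in k, so
    -- the values of k can be taken as indeterminates, and finitely many polynomial identities
    -- remain.
    yang-baxterᵇ : ∀ a b₁ b₂ →
      actᵇ t (λ x y → cross₂ᵇ w (t * w) a x y k) b₁ b₂ ≈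
      cross₂ᵇ (t * w) w a b₁ b₂ (λ a′ → actᵇ t (k a′))
    yang-baxterᵇ a b₁ b₂ = begin
      actᵇ t (λ x y → cross₂ᵇ w (t * w) a x y k) b₁ b₂
        ≈⟨ ⟦actᵇ⟧ T (λ x y → P.cross₂ᵇ W (T :* W) a x y κ) (λ x y → cross₂ᵇ w (t * w) a x y k) (λ x y → ⟦cross₂ᵇ⟧ W (T :* W) a x y κ k λ p q r → reflexive (⟦κ⟧ p q r)) b₁ b₂ ⟨
      ⟦ proj₁ (ybᵇ (a ∷ b₁ ∷ b₂ ∷ [])) ⟧ρ
        ≈⟨ agree-sound 3 ybᵇ agree-ybᵇ (a ∷ b₁ ∷ b₂ ∷ []) ⟩
      ⟦ proj₂ (ybᵇ (a ∷ b₁ ∷ b₂ ∷ [])) ⟧ρ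
        ≈⟨ ⟦cross₂ᵇ⟧ (T :* W) W a b₁ b₂ (λ a′ → P.actᵇ T (κ a′)) (λ a′ → actᵇ t (k a′)) (λ a′ →
             ⟦actᵇ⟧ T (κ a′) (k a′) λ x y → reflexive (⟦κ⟧ a′ x y)) ⟩
      cross₂ᵇ (t * w) w a b₁ b₂ (λ a′ → actᵇ t (k a′)) ∎

    ybᵃ : Vec State 3 → Polynomial 66 × Polynomial 66
    ybᵃ (b ∷ a₁ ∷ a₂ ∷ []) =
      P.actᵃ T (λ x y → P.cross₂ᵃ (T :* W) W b x y κ) a₁ a₂ ,
      P.cross₂ᵃ W (T :* W) b a₁ a₂ (λ b′ → P.actᵃ T (κ b′))

    agree-ybᵃ : agree 3 ybᵃ ≡ true
    agree-ybᵃ = ≡.refl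

    yang-baxterᵃ : ∀ b a₁ a₂ →
      actᵃ t (λ x y → cross₂ᵃ (t * w) w b x y k) a₁ a₂ ≈
      cross₂ᵃ w (t * w) b a₁ a₂ (λ b′ → actᵃ t (k b′))
    yang-baxterᵃ b a₁ a₂ = begin
      actᵃ t (λ x y → cross₂ᵃ (t * w) w b x y k) a₁ a₂
        ≈⟨ ⟦actᵃ⟧ T (λ x y → P.cross₂ᵃ (T :* W) W b x y κ) (λ x y → cross₂ᵃ (t * w) w b x y k) (λ x y → ⟦cross₂ᵃ⟧ (T :* W) W b x y κ k λ p q r → reflexive (⟦κ⟧ p q r)) a₁ a₂ ⟨
      ⟦ proj₁ (ybᵃ (b ∷ a₁ ∷ a₂ ∷ [])) ⟧ρ
        ≈⟨ agree-sound 3 ybᵃ agree-ybᵃ (b ∷ a₁ ∷ a₂ ∷ []) ⟩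
      ⟦ proj₂ (ybᵃ (b ∷ a₁ ∷ a₂ ∷ [])) ⟧ρ
        ≈⟨ ⟦cross₂ᵃ⟧ W (T :* W) b a₁ a₂ (λ b′ → P.actᵃ T (κ b′)) (λ b′ → actᵃ t (k b′)) (λ b′ →
             ⟦actᵃ⟧ T (κ b′) (k b′) λ x y → reflexive (⟦κ⟧ b′ x y)) ⟩
      cross₂ᵃ w (t * w) b a₁ a₂ (λ b′ → actᵃ t (k b′)) ∎

  module CapExchange (t t⁻¹ : Carrier) (t*t⁻¹≈1 : t * t⁻¹ ≈ 1#) where
    open Reified 2 (t ∷ t⁻¹ ∷ [])

    T T⁻¹ : Polynomial 2
    T = var zero
    T⁻¹ = var (suc zero)

    exchange : Vec State 4 → Polynomial 2 × Polynomial 2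
    exchange (a₁ ∷ a₂ ∷ b₁ ∷ b₂ ∷ []) =
      (T :* P.actᵇ T⁻¹ (λ x y → P.caps T a₁ a₂ x y Gₛ Rₛ) b₁ b₂ :+
       (con 1ℤ :- T) :* P.actᵇ T⁻¹ (λ x y → P.caps T a₁ a₂ x y Rₛ Gₛ) b₁ b₂) ,
      (P.actᵃ T (λ x y → P.caps T⁻¹ x y b₁ b₂ Gₛ Rₛ) a₁ a₂ :+
       (T :* T⁻¹ :- con 1ℤ) :* P.defect T a₁ a₂ b₁ b₂)

    agree-exchange : agree 4 exchange ≡ true
    agree-exchange = ≡.refl

    ⟦caps⟧ : ∀ w a₁ a₂ b₁ b₂ h₁ h₂ →
      ⟦ P.caps w a₁ a₂ b₁ b₂ h₁ h₂ ⟧ρ ≈ caps ⟦ w ⟧ρ a₁ a₂ b₁ b₂ h₁ h₂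
    ⟦caps⟧ w a₁ a₂ b₁ b₂ h₁ h₂ = ⟦cross⟧ w a₂ b₁
      (λ b′ a′ → P.cap a₁ b′ h₁ :* P.cap a′ b₂ h₂) (λ b′ a′ → cap a₁ b′ h₁ * cap a′ b₂ h₂) λ b′ a′ →
      *-cong (reflexive (⟦cap⟧ a₁ b′ h₁)) (reflexive (⟦cap⟧ a′ b₂ h₂))

    -- At the bottom side an exchange of two b-lines turns into one of two a-lines. The coefficients
    -- t and 1 - t are those with which the exchange acts on G^μ(x;ȳ) where a box can be removed
    -- (`h-relation`).
    cap-exchange : ∀ a₁ a₂ b₁ b₂ →
      t * actᵇ t⁻¹ (λ x y → caps t a₁ a₂ x y Gₛ Rₛ) b₁ b₂ +
      (1# - t) * actᵇ t⁻¹ (λ x y → caps t a₁ a₂ x y Rₛ Gₛ) b₁ b₂ ≈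
      actᵃ t (λ x y → caps t⁻¹ x y b₁ b₂ Gₛ Rₛ) a₁ a₂
    cap-exchange a₁ a₂ b₁ b₂ = begin
      t * actᵇ t⁻¹ (λ x y → caps t a₁ a₂ x y Gₛ Rₛ) b₁ b₂ +
      (1# - t) * actᵇ t⁻¹ (λ x y → caps t a₁ a₂ x y Rₛ Gₛ) b₁ b₂
        ≈⟨ +-cong (*-congˡ (⟦actᵇ⟧ T⁻¹ (λ x y → P.caps T a₁ a₂ x y Gₛ Rₛ) (λ x y → caps t a₁ a₂ x y Gₛ Rₛ) (λ x y → ⟦caps⟧ T a₁ a₂ x y Gₛ Rₛ) b₁ b₂))
                  (*-congˡ (⟦actᵇ⟧ T⁻¹ (λ x y → P.caps T a₁ a₂ x y Rₛ Gₛ) (λ x y → caps t a₁ a₂ x y Rₛ Gₛ) (λ x y → ⟦caps⟧ T a₁ a₂ x y Rₛ Gₛ) b₁ b₂)) ⟨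
      ⟦ proj₁ (exchange v) ⟧ρ
        ≈⟨ agree-sound 4 exchange agree-exchange v ⟩
      ⟦ P.actᵃ T (λ x y → P.caps T⁻¹ x y b₁ b₂ Gₛ Rₛ) a₁ a₂ ⟧ρ + (t * t⁻¹ - 1#) * D
        ≈⟨ +-cong (⟦actᵃ⟧ T (λ x y → P.caps T⁻¹ x y b₁ b₂ Gₛ Rₛ) (λ x y → caps t⁻¹ x y b₁ b₂ Gₛ Rₛ) (λ x y → ⟦caps⟧ T⁻¹ x y b₁ b₂ Gₛ Rₛ) a₁ a₂)
                  (*-congʳ (trans (+-congʳ t*t⁻¹≈1) (-‿inverseʳ 1#))) ⟩
      actᵃ t (λ x y → caps t⁻¹ x y b₁ b₂ Gₛ Rₛ) a₁ a₂ + 0# * D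
        ≈⟨ trans (+-congˡ (zeroˡ D)) (+-identityʳ _) ⟩
      actᵃ t (λ x y → caps t⁻¹ x y b₁ b₂ Gₛ Rₛ) a₁ a₂ ∎
      where
      v = a₁ ∷ a₂ ∷ b₁ ∷ b₂ ∷ []
      D = ⟦ P.defect T a₁ a₂ b₁ b₂ ⟧ρ

-- The lattice model of a triangle

-- A pair of neighbouring positions, given as a path into a word, so that exchanges can be treated
-- by recursion along words.
data Adj : ℕ → Set where
  here  : ∀ {n} → Adj (suc (suc n))
  there : ∀ {n} → Adj n → Adj (suc n)

swapAt : ∀ {A : Set} {n} → Adj n → Vec A n → Vec A n
swapAt here      (x ∷ y ∷ v) = y ∷ x ∷ v
swapAt (there i) (x ∷ v)     = x ∷ swapAt i v

entryˡ entryʳ : ∀ {A : Set} {n} → Adj n → Vec A n → A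
entryˡ here      (x ∷ y ∷ v) = x
entryˡ (there i) (x ∷ v)     = entryˡ i v
entryʳ here      (x ∷ y ∷ v) = y
entryʳ (there i) (x ∷ v)     = entryʳ i v

-- The frames of empty diagrams.
data Descending : ∀ {n} → Subset n → Set where
  allOutside : ∀ {n} → Descending (replicate n outside)
  inside∷_   : ∀ {n} {q : Subset n} → Descending q → Descending (inside ∷ q)

-- Strips of lozenges along the left side

Lozenge : Set
Lozenge = Tile up × Tile down

-- Opaque, so that sums over these lists are not unfolded term by term.
opaque
  upTiles : List (Tile up)
  upTiles = tiles up

  downTiles : List (Tile down)
  downTiles = tiles down

lozengeTypes : List Lozenge
lozengeTypes = cartesianProduct upTiles downTiles

-- Tilings grow by rows, but lines run through strips. The strip is listed from the bottom upwards,
-- and `c` is the tile in the bottom left corner; `∑-glue` shows that every tiling arises in this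
-- way exactly once.
glue : Vec Lozenge m → Tile up → Tiling m → Tiling (suc m)
glue []            c empty         = row empty [] (c ∷ [])
glue ((u , d) ∷ s) c (row T ds us) = row (glue s u T) (d ∷ ds) (c ∷ us)

leftEdges : Tiling m → Vec State m
leftEdges empty         = []
leftEdges (row T ds us) = aEdge (head us) ∷ leftEdges T

outgoing : Vec Lozenge m → State → State
outgoing []            b = b
outgoing ((u , d) ∷ s) b = bEdge d

StripFits : Vec Lozenge m → Vec State m → State → Set
StripFits []            []       b = ⊤
StripFits ((u , d) ∷ s) (a ∷ as) b =
  (hEdge d ≡ hEdge u × aEdge u ≡ a × bEdge u ≡ outgoing s b) × StripFits s as b

stripFits? : ∀ (s : Vec Lozenge m) as b → Dec (StripFits s as b)
stripFits? []            []       b = yes tt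
stripFits? ((u , d) ∷ s) (a ∷ as) b =
  ((_ ≟ₛ _) ×-dec (_ ≟ₛ _) ×-dec (_ ≟ₛ _)) ×-dec stripFits? s as b

-- `IsPuzzle` with the left and bottom sides reread from the bottom left corner.
Fits : Tiling m → (left right bottom : Vec State m) → Set
Fits T as bs hs =
  Consistent T × rightSide T ≡ bs × Vec.map hEdge (bottomRow T) ≡ hs × leftEdges T ≡ as

fits? : ∀ (T : Tiling m) as bs hs → Dec (Fits T as bs hs)
fits? T as bs hs = consistent? T ×-dec ≡-dec _≟ₛ_ _ _ ×-dec ≡-dec _≟ₛ_ _ _ ×-dec ≡-dec _≟ₛ_ _ _

top : Vec Lozenge m → Tile up → Tile up
top []            c = c
top ((u , d) ∷ s) c = top s u

-- The conditions along a glued strip in the form in which `Consistent` produces them, sorted by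
-- down-pointing tiles. `StripFits` sorts them by lozenges, as the transfer operators do; `chain⁻`
-- and `chain⁺` translate.
Chain : Vec Lozenge m → Tile up → Vec State m → Set
Chain []            c []       = ⊤
Chain ((u , d) ∷ s) c (l ∷ ls) =
  (hEdge d ≡ hEdge u × bEdge d ≡ bEdge c × aEdge d ≡ l) × Chain s u ls

bottomRow-glue : ∀ (s : Vec Lozenge m) c T → bottomRow (glue s c T) ≡ c ∷ bottomRow T
bottomRow-glue []            c empty         = ≡.refl
bottomRow-glue ((u , d) ∷ s) c (row T ds us) = ≡.refl

leftEdges-glue : ∀ (s : Vec Lozenge m) c T →
  leftEdges (glue s c T) ≡ aEdge c ∷ Vec.map (aEdge ∘ proj₁) s
leftEdges-glue []            c empty         = ≡.refl
leftEdges-glue ((u , d) ∷ s) c (row T ds us) = ≡.cong (aEdge c ∷_) (leftEdges-glue s u T)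

last-∷ : ∀ {A : Set} (x : A) (v : Vec A (suc m)) → Vec.last (x ∷ v) ≡ Vec.last v
last-∷ x (y ∷ v) = ≡.refl

rightSide-glue : ∀ (s : Vec Lozenge m) c T →
  rightSide (glue s c T) ≡ bEdge (top s c) ∷ rightSide T
rightSide-glue []            c empty         = ≡.refl
rightSide-glue ((u , d) ∷ s) c (row T ds us) =
  ≡.cong₂ _∷ʳ_ (rightSide-glue s u T) (≡.cong bEdge (last-∷ c us))

consistent-glue⁺ : ∀ (s : Vec Lozenge m) c T → Consistent T → Chain s c (leftEdges T) →
                   Consistent (glue s c T)
consistent-glue⁺ []            c empty         con chain = tt , λ ()
consistent-glue⁺ ((u , d) ∷ s) c (row T ds (x ∷ us)) (con , matching) (fit , chain) =
  consistent-glue⁺ s u T con chain ,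
  ≡.subst (λ above → Matching above (d ∷ ds) (c ∷ x ∷ us)) (≡.sym (bottomRow-glue s u T))
    λ { zero → fit ; (suc c) → matching c }

consistent-glue⁻ : ∀ (s : Vec Lozenge m) c T → Consistent (glue s c T) →
                   Consistent T × Chain s c (leftEdges T)
consistent-glue⁻ []            c empty         con = tt , tt
consistent-glue⁻ ((u , d) ∷ s) c (row T ds (x ∷ us)) (con , matching)
  with con′ , chain ← consistent-glue⁻ s u T con
  with matching′ ← ≡.subst (λ above → Matching above (d ∷ ds) (c ∷ x ∷ us)) (bottomRow-glue s u T) matching =
  (con′ , matching′ ∘ suc) , matching′ zero , chain

chain⁻ : ∀ (s : Vec Lozenge m) c {ls as b} →
  Chain s c ls → Vec.map (aEdge ∘ proj₁) s ≡ as → bEdge (top s c) ≡ b →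
  StripFits s as b × bEdge c ≡ outgoing s b × ls ≡ Vec.map (aEdge ∘ proj₂) s
chain⁻ [] c {[]} chain ≡.refl eq = tt , eq , ≡.refl
chain⁻ ((u , d) ∷ s) c {l ∷ ls} ((hd , bd , ad) , chain) ≡.refl eq
  with fits , eq′ , ls≡ ← chain⁻ s u chain ≡.refl eq =
  ((hd , ≡.refl , eq′) , fits) , ≡.sym bd , ≡.cong₂ _∷_ (≡.sym ad) ls≡

chain⁺ : ∀ (s : Vec Lozenge m) c {as b} → StripFits s as b → bEdge c ≡ outgoing s b →
  Chain s c (Vec.map (aEdge ∘ proj₂) s) × Vec.map (aEdge ∘ proj₁) s ≡ as × bEdge (top s c) ≡ b
chain⁺ [] c {[]} fits eq = tt , ≡.refl , eq
chain⁺ ((u , d) ∷ s) c {a ∷ as} ((hd , au , bu) , fits) eq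
  with chain , as≡ , top≡ ← chain⁺ s u fits bu =
  ((hd , ≡.sym eq , ≡.refl) , chain) , ≡.cong₂ _∷_ au as≡ , top≡

fits-glue⁻ : ∀ (s : Vec Lozenge m) c T {a as b bs h hs} →
  Fits (glue s c T) (a ∷ as) (b ∷ bs) (h ∷ hs) →
  StripFits s as b × (aEdge c ≡ a × bEdge c ≡ outgoing s b × hEdge c ≡ h) ×
  Fits T (Vec.map (aEdge ∘ proj₂) s) bs hs
fits-glue⁻ s c T (con , right , bottom , left)
  rewrite bottomRow-glue s c T | leftEdges-glue s c T | rightSide-glue s c T
  with con′ , chain ← consistent-glue⁻ s c T con
  with fits , bc , ls≡ ← chain⁻ s c chain (∷-injectiveʳ left) (∷-injectiveˡ right) =
  fits , (∷-injectiveˡ left , bc , ∷-injectiveˡ bottom) ,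
  con′ , ∷-injectiveʳ right , ∷-injectiveʳ bottom , ls≡

fits-glue⁺ : ∀ (s : Vec Lozenge m) c T {a as b bs h hs} →
  StripFits s as b × (aEdge c ≡ a × bEdge c ≡ outgoing s b × hEdge c ≡ h) ×
  Fits T (Vec.map (aEdge ∘ proj₂) s) bs hs →
  Fits (glue s c T) (a ∷ as) (b ∷ bs) (h ∷ hs)
fits-glue⁺ s c T (fits , (ac , bc , hc) , con , right , bottom , left)
  rewrite bottomRow-glue s c T | leftEdges-glue s c T | rightSide-glue s c T
  with chain , as≡ , top≡ ← chain⁺ s c fits bc =
  consistent-glue⁺ s c T con (≡.subst (Chain s c) (≡.sym left) chain) ,
  ≡.cong₂ _∷_ top≡ right , ≡.cong₂ _∷_ hc bottom , ≡.cong₂ _∷_ ac as≡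

-- The partition function and its exchange relation

module Amplitude (R : CommutativeRing 0ℓ 0ℓ) (I : Set)
  (y y⁻¹ : I → CommutativeRing.Carrier R)
  (y*y⁻¹≈1 : ∀ i → CommutativeRing._≈_ R (CommutativeRing._*_ R (y i) (y⁻¹ i)) (CommutativeRing.1# R)) where
  open CommutativeRing R hiding (zero)
  open RingTools R hiding (∑; ⟦_⟧)
  open Local R
  open import Relation.Binary.Reasoning.Setoid setoid

  w : I → I → Carrier
  w i j = y i * y⁻¹ j

  w-trans : ∀ i j l → w i j * w j l ≈ w i l
  w-trans i j l = begin
    (y i * y⁻¹ j) * (y j * y⁻¹ l)  ≈⟨ solve 4 (λ a b c d → (a :* b) :* (c :* d) := (c :* b) :* (a :* d)) refl _ _ _ _ ⟩
    (y j * y⁻¹ j) * (y i * y⁻¹ l)  ≈⟨ *-congʳ (y*y⁻¹≈1 j) ⟩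
    1# * (y i * y⁻¹ l)             ≈⟨ *-identityˡ _ ⟩
    w i l                          ∎

  w-inverse : ∀ i j → w i j * w j i ≈ 1#
  w-inverse i j = trans (w-trans i j i) (y*y⁻¹≈1 i)

  ⟦⟧ₛ-cong : ∀ c {w w′} → w ≈ w′ → ⟦ c ⟧ₛ w ≈ ⟦ c ⟧ₛ w′
  ⟦⟧ₛ-cong one           w≈w′ = refl
  ⟦⟧ₛ-cong minusOne      w≈w′ = refl
  ⟦⟧ₛ-cong param         w≈w′ = w≈w′
  ⟦⟧ₛ-cong oneMinusParam w≈w′ = +-congˡ (-‿cong w≈w′)

  cross-congʷ : ∀ {w w′} a b k → w ≈ w′ → cross w a b k ≈ cross w′ a b k
  cross-congʷ a b k w≈w′ = ∑-cong (lozenges a b) λ (u , d) → *-congʳ (⟦⟧ₛ-cong (scalar u d) w≈w′)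

  Linear : {A : Set} → ((A → Carrier) → Carrier) → Set
  Linear F = ∀ c d k l → F (λ x → c * k x + d * l x) ≈ c * F k + d * F l

  ∑-linear : ∀ {A : Set} (xs : List A) → Linear (∑ xs)
  ∑-linear xs c d k l = trans (∑-+ xs _ _) (+-cong (∑-*ˡ xs c k) (∑-*ˡ xs d l))

  cross-linear : ∀ w a b c d k l →
    cross w a b (λ x z → c * k x z + d * l x z) ≈ c * cross w a b k + d * cross w a b l
  cross-linear w a b c d k l = trans
    (∑-cong (lozenges a b) λ _ →
      solve 5 (λ s c d k l → s :* (c :* k :+ d :* l) := c :* (s :* k) :+ d :* (s :* l)) refl _ _ _ _ _)
    (∑-linear (lozenges a b) c d _ _)

  -- The line j meets the last of the lines ys first.
  pass : I → Vec I m → Vec State m → State → (Vec State m → State → Carrier) → Carrier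
  pass j []       []       b k = k [] b
  pass j (i ∷ ys) (a ∷ as) b k =
    pass j ys as b λ as′ b′ → cross (w i j) a b′ λ b″ a′ → k (a′ ∷ as′) b″

  pass-cong : ∀ j (ys : Vec I m) as b {k l} → (∀ v s → k v s ≈ l v s) →
              pass j ys as b k ≈ pass j ys as b l
  pass-cong j []       []       b k≈l = k≈l [] b
  pass-cong j (i ∷ ys) (a ∷ as) b k≈l =
    pass-cong j ys as b λ as′ b′ → cross-cong (w i j) a b′ λ b″ a′ → k≈l (a′ ∷ as′) b″

  pass-linear : ∀ j (ys : Vec I m) as b c d k l →
    pass j ys as b (λ v s → c * k v s + d * l v s) ≈ c * pass j ys as b k + d * pass j ys as b l
  pass-linear j []       []       b c d k l = refl
  pass-linear j (i ∷ ys) (a ∷ as) b c d k l = trans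
    (pass-cong j ys as b λ as′ b′ → cross-linear (w i j) a b′ c d (λ b″ a′ → k (a′ ∷ as′) b″) (λ b″ a′ → l (a′ ∷ as′) b″))
    (pass-linear j ys as b c d _ _)

  pass-zero : ∀ j (ys : Vec I m) as b → pass j ys as b (λ _ _ → 0#) ≈ 0#
  pass-zero j ys as b = begin
    pass j ys as b (λ _ _ → 0#)
      ≈⟨ pass-cong j ys as b (λ _ _ → solve 0 (con ℤ.0ℤ := con ℤ.0ℤ :* con ℤ.0ℤ :+ con ℤ.0ℤ :* con ℤ.0ℤ) refl) ⟩
    pass j ys as b (λ _ _ → 0# * 0# + 0# * 0#)
      ≈⟨ pass-linear j ys as b 0# 0# (λ _ _ → 0#) (λ _ _ → 0#) ⟩
    0# * pass j ys as b (λ _ _ → 0#) + 0# * pass j ys as b (λ _ _ → 0#)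
      ≈⟨ solve 1 (λ x → con ℤ.0ℤ :* x :+ con ℤ.0ℤ :* x := con ℤ.0ℤ) refl _ ⟩
    0# ∎

  pass-∑ : ∀ j (ys : Vec I m) as b {A : Set} (xs : List A) (c : A → Carrier) (k : A → Vec State m → State → Carrier) →
    pass j ys as b (λ v s → ∑ xs λ x → c x * k x v s) ≈ ∑ xs λ x → c x * pass j ys as b (k x)
  pass-∑ j ys as b []       c k = pass-zero j ys as b
  pass-∑ j ys as b (x ∷ xs) c k = begin
    pass j ys as b (λ v s → c x * k x v s + ∑ xs (λ x → c x * k x v s))
      ≈⟨ pass-cong j ys as b (λ v s → +-congˡ (sym (*-identityˡ _))) ⟩
    pass j ys as b (λ v s → c x * k x v s + 1# * ∑ xs (λ x → c x * k x v s))
      ≈⟨ pass-linear j ys as b (c x) 1# (k x) _ ⟩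
    c x * pass j ys as b (k x) + 1# * pass j ys as b (λ v s → ∑ xs (λ x → c x * k x v s))
      ≈⟨ +-congˡ (trans (*-identityˡ _) (pass-∑ j ys as b xs c k)) ⟩
    c x * pass j ys as b (k x) + ∑ xs (λ x → c x * pass j ys as b (k x)) ∎

  -- A strip and a lozenge whose incoming edges do not depend on each other can be summed in either
  -- order.
  pass-cross : ∀ j (ys : Vec I m) as b v a c (k : Vec State m → State → State → State → Carrier) →
    pass j ys as b (λ as′ b′ → cross v a c (k as′ b′)) ≈
    cross v a c (λ x z → pass j ys as b (λ as′ b′ → k as′ b′ x z))
  pass-cross j ys as b v a c k = pass-∑ j ys as b (lozenges a c) (λ (u , d) → ⟦ scalar u d ⟧ₛ v) λ (u , d) as′ b′ → k as′ b′ (bEdge d) (aEdge d)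

  actAtᵃ actAtᵇ : Adj m → Carrier → (Vec State m → Carrier) → Vec State m → Carrier
  actAtᵃ i t k v =
    diag (ruleᵃ (entryˡ i v) (entryʳ i v)) t * k v +
    off (ruleᵃ (entryʳ i v) (entryˡ i v)) t * k (swapAt i v)
  actAtᵇ i t k v =
    diag (ruleᵇ (entryˡ i v) (entryʳ i v)) t * k v +
    off (ruleᵇ (entryˡ i v) (entryʳ i v)) t * k (swapAt i v)

  ratio : Adj m → Vec I m → Carrier
  ratio i ys = w (entryʳ i ys) (entryˡ i ys)

  -- The line j meets the lines after the exchanged pair first, then the pair itself, where
  -- `yang-baxterᵃ` applies. Linearity carries the matrix through all other crossings.
  pass-actᵃ : ∀ (i : Adj m) j ys as b k →
    actAtᵃ i (ratio i ys) (λ as → pass j (swapAt i ys) as b k) as ≈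
    pass j ys as b (λ as′ b′ → actAtᵃ i (ratio i ys) (λ v → k v b′) as′)
  pass-actᵃ here j (l₁ ∷ l₂ ∷ ys) (a₁ ∷ a₂ ∷ as) b k = begin
    actᵃ t (λ x z → pass j ys as b λ as′ b₀ → cross₂ᵃ (w l₂ j) (w l₁ j) b₀ x z (λ b′ c₁ c₂ → k (c₁ ∷ c₂ ∷ as′) b′)) a₁ a₂
      ≈⟨ pass-linear j ys as b _ _ _ _ ⟨
    pass j ys as b (λ as′ b₀ →
      actᵃ t (λ x z → cross₂ᵃ (w l₂ j) (w l₁ j) b₀ x z (λ b′ c₁ c₂ → k (c₁ ∷ c₂ ∷ as′) b′)) a₁ a₂)
      ≈⟨ pass-cong j ys as b (λ as′ b₀ → +-cong (*-congˡ (fix as′ b₀ a₁ a₂)) (*-congˡ (fix as′ b₀ a₂ a₁))) ⟨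
    pass j ys as b (λ as′ b₀ →
      actᵃ t (λ x z → cross₂ᵃ (t * w l₁ j) (w l₁ j) b₀ x z (λ b′ c₁ c₂ → k (c₁ ∷ c₂ ∷ as′) b′)) a₁ a₂)
      ≈⟨ pass-cong j ys as b (λ as′ b₀ →
           YangBaxter.yang-baxterᵃ (w l₁ j) t (λ b′ c₁ c₂ → k (c₁ ∷ c₂ ∷ as′) b′) b₀ a₁ a₂) ⟩
    pass j ys as b (λ as′ b₀ →
      cross₂ᵃ (w l₁ j) (t * w l₁ j) b₀ a₁ a₂ (λ b′ → actᵃ t (λ c₁ c₂ → k (c₁ ∷ c₂ ∷ as′) b′)))
      ≈⟨ pass-cong j ys as b (λ as′ b₀ → cross-congʷ a₂ b₀ (λ b′ c₂ → cross (w l₁ j) a₁ b′ λ b″ c₁ → actᵃ t (λ x z → k (x ∷ z ∷ as′) b″) c₁ c₂) (w-trans l₂ l₁ j)) ⟩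
    pass j ys as b (λ as′ b₀ →
      cross₂ᵃ (w l₁ j) (w l₂ j) b₀ a₁ a₂ (λ b′ → actᵃ t (λ c₁ c₂ → k (c₁ ∷ c₂ ∷ as′) b′))) ∎
    where
    t = w l₂ l₁
    fix : ∀ as′ b₀ x z →
      cross₂ᵃ (t * w l₁ j) (w l₁ j) b₀ x z (λ b′ c₁ c₂ → k (c₁ ∷ c₂ ∷ as′) b′) ≈
      cross₂ᵃ (w l₂ j) (w l₁ j) b₀ x z (λ b′ c₁ c₂ → k (c₁ ∷ c₂ ∷ as′) b′)
    fix as′ b₀ x z = cross-cong (w l₁ j) z b₀ λ b′ c₂ → cross-congʷ x b′ (λ b″ c₁ → k (c₁ ∷ c₂ ∷ as′) b″) (w-trans l₂ l₁ j)
  pass-actᵃ (there i) j (l ∷ ys) (a ∷ as) b k = begin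
    actAtᵃ i t (λ as → pass j (swapAt i ys) as b λ as′ b′ → cross (w l j) a b′ λ b″ a′ → k (a′ ∷ as′) b″) as
      ≈⟨ pass-actᵃ i j ys as b _ ⟩
    pass j ys as b (λ as′ b′ → actAtᵃ i t (λ v → cross (w l j) a b′ λ b″ a′ → k (a′ ∷ v) b″) as′)
      ≈⟨ pass-cong j ys as b (λ as′ b′ → cross-linear (w l j) a b′ _ _ (λ b″ a′ → k (a′ ∷ as′) b″) (λ b″ a′ → k (a′ ∷ swapAt i as′) b″)) ⟨
    pass j ys as b (λ as′ b′ → cross (w l j) a b′ λ b″ a′ → actAtᵃ i t (λ v → k (a′ ∷ v) b″) as′) ∎
    where t = ratio i ys

  pass₂ : I → I → Vec I m → Vec State m → (b₁ b₂ : State) →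
          (Vec State m → State → State → Carrier) → Carrier
  pass₂ j l ys as b₁ b₂ k =
    pass j ys as b₁ λ as′ d₁ → pass l ys as′ b₂ λ as″ d₂ → k as″ d₁ d₂

  -- The crossing of j with i and the crossings of l with `ys` involve different lines. So both j
  -- and l may cross all of `ys` before either of them crosses i.
  pass₂-∷ : ∀ j l i (ys : Vec I m) a as b₁ b₂ k →
    pass₂ j l (i ∷ ys) (a ∷ as) b₁ b₂ k ≈
    pass₂ j l ys as b₁ b₂ (λ as″ c₁ c₂ → cross₂ᵇ (w i j) (w i l) a c₁ c₂ λ a″ → k (a″ ∷ as″))
  pass₂-∷ j l i ys a as b₁ b₂ k = pass-cong j ys as b₁ λ as′ c₁ →
    sym (pass-cross l ys as′ b₂ (w i j) a c₁ λ as″ c₂ d₁ a′ → cross (w i l) a′ c₂ λ d₂ a″ → k (a″ ∷ as″) d₁ d₂)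

  pass₂-cong : ∀ j l (ys : Vec I m) as b₁ b₂ {k k′} → (∀ v x z → k v x z ≈ k′ v x z) →
               pass₂ j l ys as b₁ b₂ k ≈ pass₂ j l ys as b₁ b₂ k′
  pass₂-cong j l ys as b₁ b₂ k≈k′ =
    pass-cong j ys as b₁ λ as′ d₁ → pass-cong l ys as′ b₂ λ as″ d₂ → k≈k′ as″ d₁ d₂

  pass₂-linear : ∀ j l (ys : Vec I m) as b₁ b₂ c d k k′ →
    pass₂ j l ys as b₁ b₂ (λ v x z → c * k v x z + d * k′ v x z) ≈
    c * pass₂ j l ys as b₁ b₂ k + d * pass₂ j l ys as b₁ b₂ k′
  pass₂-linear j l ys as b₁ b₂ c d k k′ = trans
    (pass-cong j ys as b₁ λ as′ d₁ → pass-linear l ys as′ b₂ c d _ _)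
    (pass-linear j ys as b₁ c d _ _)

  -- The exchange of two b-lines travels down their two strips, past one a-line at a time, each time
  -- by `yang-baxterᵇ`; the labels j and l change places behind it.
  pass₂-actᵇ : ∀ j l (ys : Vec I m) as b₁ b₂ k →
    actᵇ (w j l) (λ x z → pass₂ j l ys as x z k) b₁ b₂ ≈
    pass₂ l j ys as b₁ b₂ (λ v → actᵇ (w j l) (k v))
  pass₂-actᵇ j l []       []       b₁ b₂ k = refl
  pass₂-actᵇ j l (i ∷ ys) (a ∷ as) b₁ b₂ k = begin
    actᵇ t (λ x z → pass₂ j l (i ∷ ys) (a ∷ as) x z k) b₁ b₂
      ≈⟨ +-cong (*-congˡ (pass₂-∷ j l i ys a as b₁ b₂ k)) (*-congˡ (pass₂-∷ j l i ys a as b₂ b₁ k)) ⟩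
    actᵇ t (λ x z → pass₂ j l ys as x z λ v c₁ c₂ → cross₂ᵇ (w i j) (w i l) a c₁ c₂ λ a″ → k (a″ ∷ v)) b₁ b₂
      ≈⟨ pass₂-actᵇ j l ys as b₁ b₂ _ ⟩
    pass₂ l j ys as b₁ b₂ (λ v → actᵇ t (λ c₁ c₂ → cross₂ᵇ (w i j) (w i l) a c₁ c₂ λ a″ → k (a″ ∷ v)))
      ≈⟨ pass₂-cong l j ys as b₁ b₂ (λ v c₁ c₂ → +-cong (*-congˡ (fix v c₁ c₂)) (*-congˡ (fix v c₂ c₁))) ⟨
    pass₂ l j ys as b₁ b₂ (λ v → actᵇ t (λ c₁ c₂ → cross₂ᵇ (w i j) (t * w i j) a c₁ c₂ λ a″ → k (a″ ∷ v)))
      ≈⟨ pass₂-cong l j ys as b₁ b₂ (λ v c₁ c₂ →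
           YangBaxter.yang-baxterᵇ (w i j) t (λ a″ → k (a″ ∷ v)) a c₁ c₂) ⟩
    pass₂ l j ys as b₁ b₂ (λ v c₁ c₂ → cross₂ᵇ (t * w i j) (w i j) a c₁ c₂ λ a″ → actᵇ t (k (a″ ∷ v)))
      ≈⟨ pass₂-cong l j ys as b₁ b₂ (λ v c₁ c₂ → cross-congʷ a c₁ (λ d₁ a′ → cross (w i j) a′ c₂ λ d₂ a″ → actᵇ t (k (a″ ∷ v)) d₁ d₂) t*w≈w) ⟩
    pass₂ l j ys as b₁ b₂ (λ v c₁ c₂ → cross₂ᵇ (w i l) (w i j) a c₁ c₂ λ a″ → actᵇ t (k (a″ ∷ v)))
      ≈⟨ pass₂-∷ l j i ys a as b₁ b₂ (λ v → actᵇ t (k v)) ⟨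
    pass₂ l j (i ∷ ys) (a ∷ as) b₁ b₂ (λ v → actᵇ t (k v)) ∎
    where
    t = w j l
    t*w≈w : t * w i j ≈ w i l
    t*w≈w = trans (*-comm _ _) (w-trans i j l)
    fix : ∀ v x z →
      (cross₂ᵇ (w i j) (t * w i j) a x z λ a″ → k (a″ ∷ v)) ≈
      (cross₂ᵇ (w i j) (w i l) a x z λ a″ → k (a″ ∷ v))
    fix v x z = cross-cong (w i j) a x λ d₁ a′ → cross-congʷ a′ z (λ d₂ a″ → k (a″ ∷ v) d₁ d₂) t*w≈w

  -- The line through the topmost right edge cuts off a strip along the left side,
  -- which leaves a triangle of size m − 1.  All words are read from the bottom
  -- left corner, except right, which is read from the top.
  amplitude : Vec I m → (left right bottom : Vec State m) → Carrier
  amplitude []       []       []       []       = 1#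
  amplitude (j ∷ ys) (a ∷ as) (b ∷ bs) (h ∷ hs) =
    pass j ys as b λ as′ b′ → cap a b′ h * amplitude ys as′ bs hs

  -- Postpones the lozenge where the second b-line's a-partner crosses the first b-line, so that the
  -- triangle of side 2 in the bottom left corner is reached last and `cap-exchange` applies to it.
  amplitude₂ : ∀ j l (ys : Vec I m) a₁ a₂ as b₁ b₂ bs h₁ h₂ hs →
    amplitude (j ∷ l ∷ ys) (a₁ ∷ a₂ ∷ as) (b₁ ∷ b₂ ∷ bs) (h₁ ∷ h₂ ∷ hs) ≈
    pass₂ j l ys as b₁ b₂ (λ v x z → caps (w l j) a₁ a₂ x z h₁ h₂ * amplitude ys v bs hs)
  amplitude₂ j l ys a₁ a₂ as b₁ b₂ bs h₁ h₂ hs = pass-cong j ys as b₁ λ as′ b₀ → begin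
    (cross (w l j) a₂ b₀ λ b′ a′ → cap a₁ b′ h₁ * pass l ys as′ b₂ λ v z → cap a′ z h₂ * A v)
      ≈⟨ cross-cong (w l j) a₂ b₀ (λ b′ a′ → pull (cap a₁ b′ h₁) as′ (λ v z → cap a′ z h₂ * A v)) ⟩
    (cross (w l j) a₂ b₀ λ b′ a′ → pass l ys as′ b₂ λ v z → cap a₁ b′ h₁ * (cap a′ z h₂ * A v))
      ≈⟨ pass-cross l ys as′ b₂ (w l j) a₂ b₀ (λ v z b′ a′ → cap a₁ b′ h₁ * (cap a′ z h₂ * A v)) ⟨
    (pass l ys as′ b₂ λ v z → cross (w l j) a₂ b₀ λ b′ a′ → cap a₁ b′ h₁ * (cap a′ z h₂ * A v))
      ≈⟨ pass-cong l ys as′ b₂ (λ v z → factor v b₀ z) ⟩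
    (pass l ys as′ b₂ λ v z → caps (w l j) a₁ a₂ b₀ z h₁ h₂ * A v) ∎
    where
    A = λ v → amplitude ys v bs hs
    pull : ∀ c as′ k → c * pass l ys as′ b₂ k ≈ pass l ys as′ b₂ (λ v z → c * k v z)
    pull c as′ k = begin
      c * pass l ys as′ b₂ k                                 ≈⟨ solve 2 (λ x p → x :* p := x :* p :+ con 0ℤ :* p) refl _ _ ⟩
      c * pass l ys as′ b₂ k + 0# * pass l ys as′ b₂ k       ≈⟨ pass-linear l ys as′ b₂ c 0# k k ⟨
      pass l ys as′ b₂ (λ v z → c * k v z + 0# * k v z)      ≈⟨ pass-cong l ys as′ b₂ (λ v z → solve 2 (λ x p → x :* p := x :* p :+ con 0ℤ :* p) refl _ _) ⟨
      pass l ys as′ b₂ (λ v z → c * k v z)                   ∎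
    factor : ∀ v b₀ z →
      (cross (w l j) a₂ b₀ λ b′ a′ → cap a₁ b′ h₁ * (cap a′ z h₂ * A v)) ≈
      caps (w l j) a₁ a₂ b₀ z h₁ h₂ * A v
    factor v b₀ z = trans
      (∑-cong (lozenges a₂ b₀) λ _ → solve 4 (λ a b c d → a :* (b :* (c :* d)) := (a :* (b :* c)) :* d) refl _ _ _ _)
      (∑-*ʳ (lozenges a₂ b₀) (A v) _)

  -- For the first two lines, the exchange enters at the right side, descends along both strips by
  -- `pass₂-actᵇ`, is turned round at the bottom by `cap-exchange` and leaves at the left side. For
  -- a later pair, the strip of the first line still separates the smaller triangle from the left
  -- side, and `pass-actᵃ` carries the exchange across it.
  exchange : ∀ (i : Adj m) ys as bs hs → entryˡ i hs ≡ Gₛ → entryʳ i hs ≡ Rₛ →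
    ratio i ys * actAtᵇ i (w (entryˡ i ys) (entryʳ i ys)) (λ v → amplitude ys as v hs) bs +
    (1# - ratio i ys) * actAtᵇ i (w (entryˡ i ys) (entryʳ i ys)) (λ v → amplitude ys as v (swapAt i hs)) bs ≈
    actAtᵃ i (ratio i ys) (λ v → amplitude (swapAt i ys) v bs hs) as
  exchange here (j ∷ l ∷ ys) (a₁ ∷ a₂ ∷ as) (b₁ ∷ b₂ ∷ bs) (.Gₛ ∷ .Rₛ ∷ hs) ≡.refl ≡.refl = begin
    t * actᵇ τ (λ x z → A x z Gₛ Rₛ) b₁ b₂ + (1# - t) * actᵇ τ (λ x z → A x z Rₛ Gₛ) b₁ b₂
      ≈⟨ +-cong (*-congˡ (half Gₛ Rₛ)) (*-congˡ (half Rₛ Gₛ)) ⟩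
    t * pass₂ l j ys as b₁ b₂ (λ v x z → actᵇ τ (C Gₛ Rₛ) x z * B v) +
    (1# - t) * pass₂ l j ys as b₁ b₂ (λ v x z → actᵇ τ (C Rₛ Gₛ) x z * B v)
      ≈⟨ pass₂-linear l j ys as b₁ b₂ t (1# - t) _ _ ⟨
    pass₂ l j ys as b₁ b₂ (λ v x z →
      t * (actᵇ τ (C Gₛ Rₛ) x z * B v) + (1# - t) * (actᵇ τ (C Rₛ Gₛ) x z * B v))
      ≈⟨ pass₂-cong l j ys as b₁ b₂ (λ v x z → local v x z) ⟩
    pass₂ l j ys as b₁ b₂ (λ v x z →
      D * (caps τ a₁ a₂ x z Gₛ Rₛ * B v) + O * (caps τ a₂ a₁ x z Gₛ Rₛ * B v))
      ≈⟨ pass₂-linear l j ys as b₁ b₂ D O _ _ ⟩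
    D * pass₂ l j ys as b₁ b₂ (λ v x z → caps τ a₁ a₂ x z Gₛ Rₛ * B v) +
    O * pass₂ l j ys as b₁ b₂ (λ v x z → caps τ a₂ a₁ x z Gₛ Rₛ * B v)
      ≈⟨ +-cong (*-congˡ (amplitude₂ l j ys a₁ a₂ as b₁ b₂ bs Gₛ Rₛ hs))
                (*-congˡ (amplitude₂ l j ys a₂ a₁ as b₁ b₂ bs Gₛ Rₛ hs)) ⟨
    actᵃ t (λ x z → amplitude (l ∷ j ∷ ys) (x ∷ z ∷ as) (b₁ ∷ b₂ ∷ bs) (Gₛ ∷ Rₛ ∷ hs)) a₁ a₂ ∎
    where
    t = w l j
    τ = w j l
    A = λ x z h₁ h₂ → amplitude (j ∷ l ∷ ys) (a₁ ∷ a₂ ∷ as) (x ∷ z ∷ bs) (h₁ ∷ h₂ ∷ hs)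
    B = λ v → amplitude ys v bs hs
    C = λ h₁ h₂ x z → caps t a₁ a₂ x z h₁ h₂
    D = diag (ruleᵃ a₁ a₂) t
    O = off (ruleᵃ a₂ a₁) t
    half : ∀ h₁ h₂ → actᵇ τ (λ x z → A x z h₁ h₂) b₁ b₂ ≈
                     pass₂ l j ys as b₁ b₂ (λ v x z → actᵇ τ (C h₁ h₂) x z * B v)
    half h₁ h₂ = begin
      actᵇ τ (λ x z → A x z h₁ h₂) b₁ b₂
        ≈⟨ +-cong (*-congˡ (amplitude₂ j l ys a₁ a₂ as b₁ b₂ bs h₁ h₂ hs))
                  (*-congˡ (amplitude₂ j l ys a₁ a₂ as b₂ b₁ bs h₁ h₂ hs)) ⟩
      actᵇ τ (λ x z → pass₂ j l ys as x z λ v c₁ c₂ → C h₁ h₂ c₁ c₂ * B v) b₁ b₂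
        ≈⟨ pass₂-actᵇ j l ys as b₁ b₂ _ ⟩
      pass₂ l j ys as b₁ b₂ (λ v → actᵇ τ (λ c₁ c₂ → C h₁ h₂ c₁ c₂ * B v))
        ≈⟨ pass₂-cong l j ys as b₁ b₂ (λ v x z →
             solve 5 (λ d c o c′ b → d :* (c :* b) :+ o :* (c′ :* b) := (d :* c :+ o :* c′) :* b) refl _ _ _ _ _) ⟩
      pass₂ l j ys as b₁ b₂ (λ v x z → actᵇ τ (C h₁ h₂) x z * B v) ∎
    local : ∀ v x z →
      t * (actᵇ τ (C Gₛ Rₛ) x z * B v) + (1# - t) * (actᵇ τ (C Rₛ Gₛ) x z * B v) ≈
      D * (caps τ a₁ a₂ x z Gₛ Rₛ * B v) + O * (caps τ a₂ a₁ x z Gₛ Rₛ * B v)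
    local v x z = begin
      t * (actᵇ τ (C Gₛ Rₛ) x z * B v) + (1# - t) * (actᵇ τ (C Rₛ Gₛ) x z * B v)
        ≈⟨ solve 5 (λ t p s q b → t :* (p :* b) :+ s :* (q :* b) := (t :* p :+ s :* q) :* b) refl
             t (actᵇ τ (C Gₛ Rₛ) x z) (1# - t) (actᵇ τ (C Rₛ Gₛ) x z) (B v) ⟩
      (t * actᵇ τ (C Gₛ Rₛ) x z + (1# - t) * actᵇ τ (C Rₛ Gₛ) x z) * B v
        ≈⟨ *-congʳ (CapExchange.cap-exchange t τ (w-inverse l j) a₁ a₂ x z) ⟩
      (D * caps τ a₁ a₂ x z Gₛ Rₛ + O * caps τ a₂ a₁ x z Gₛ Rₛ) * B v
        ≈⟨ solve 5 (λ d c o c′ b → d :* (c :* b) :+ o :* (c′ :* b) := (d :* c :+ o :* c′) :* b) refl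
             D (caps τ a₁ a₂ x z Gₛ Rₛ) O (caps τ a₂ a₁ x z Gₛ Rₛ) (B v) ⟨
      D * (caps τ a₁ a₂ x z Gₛ Rₛ * B v) + O * (caps τ a₂ a₁ x z Gₛ Rₛ * B v) ∎
  exchange (there i) (j ∷ ys) (a ∷ as) (b ∷ bs) (h ∷ hs) eqG eqR = begin
    t * (D * P (F bs hs) + O * P (F bs′ hs)) + (1# - t) * (D * P (F bs hs′) + O * P (F bs′ hs′))
      ≈⟨ +-cong (*-congˡ (pass-linear j ys as b D O _ _)) (*-congˡ (pass-linear j ys as b D O _ _)) ⟨
    t * P (λ v s → D * F bs hs v s + O * F bs′ hs v s) +
    (1# - t) * P (λ v s → D * F bs hs′ v s + O * F bs′ hs′ v s)
      ≈⟨ pass-linear j ys as b t (1# - t) _ _ ⟨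
    P (λ v s → t * (D * F bs hs v s + O * F bs′ hs v s) +
               (1# - t) * (D * F bs hs′ v s + O * F bs′ hs′ v s))
      ≈⟨ pass-cong j ys as b (λ v s → local v s) ⟩
    P (λ v s → actAtᵃ i t (λ v → cap a s h * amplitude (swapAt i ys) v bs hs) v)
      ≈⟨ pass-actᵃ i j ys as b _ ⟨
    actAtᵃ i t (λ v → pass j (swapAt i ys) v b λ as′ b′ → cap a b′ h * amplitude (swapAt i ys) as′ bs hs) as ∎
    where
    t = ratio i ys
    τ = w (entryˡ i ys) (entryʳ i ys)
    D = diag (ruleᵇ (entryˡ i bs) (entryʳ i bs)) τ
    O = off (ruleᵇ (entryˡ i bs) (entryʳ i bs)) τ
    bs′ = swapAt i bs
    hs′ = swapAt i hs
    P = pass j ys as b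
    F = λ bs hs v s → cap a s h * amplitude ys v bs hs
    local : ∀ v s →
      t * (D * F bs hs v s + O * F bs′ hs v s) + (1# - t) * (D * F bs hs′ v s + O * F bs′ hs′ v s) ≈
      actAtᵃ i t (λ v → cap a s h * amplitude (swapAt i ys) v bs hs) v
    local v s = begin
      t * (D * F bs hs v s + O * F bs′ hs v s) + (1# - t) * (D * F bs hs′ v s + O * F bs′ hs′ v s)
        ≈⟨ solve 9 (λ t d o s c p q p′ q′ →
             t :* (d :* (c :* p) :+ o :* (c :* q)) :+ s :* (d :* (c :* p′) :+ o :* (c :* q′)) :=
             c :* (t :* (d :* p :+ o :* q) :+ s :* (d :* p′ :+ o :* q′))) refl
             t D O (1# - t) (cap a s h) (amplitude ys v bs hs) (amplitude ys v bs′ hs)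
             (amplitude ys v bs hs′) (amplitude ys v bs′ hs′) ⟩
      cap a s h * (t * actAtᵇ i τ (λ z → amplitude ys v z hs) bs +
                   (1# - t) * actAtᵇ i τ (λ z → amplitude ys v z hs′) bs)
        ≈⟨ *-congˡ (exchange i ys v bs hs eqG eqR) ⟩
      cap a s h * actAtᵃ i t (λ v → amplitude (swapAt i ys) v bs hs) v
        ≈⟨ solve 5 (λ c d p o q → c :* (d :* p :+ o :* q) := d :* (c :* p) :+ o :* (c :* q)) refl _ _ _ _ _ ⟩
      actAtᵃ i t (λ v → cap a s h * amplitude (swapAt i ys) v bs hs) v ∎

  -- Frozen boundary conditions

  skip : ∀ {c x r} → x ≈ 0# → c * x + r ≈ r
  skip {c} {x} {r} x≈0 = trans (+-congʳ (trans (*-congˡ x≈0) (zeroʳ c))) (+-identityˡ r)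

  single : ∀ {x} → 1# * x + 0# ≈ x
  single = trans (+-identityʳ _) (*-identityˡ _)

  -- In every lozenge with a boundary state on the upper left, a b-line that enters outside state ∅
  -- also leaves outside it.
  cross-∅-off : ∀ v x {s} {k : State → State → Carrier} → (∀ s a → s ≢ ∅ₛ → k s a ≈ 0#) →
                s ≢ ∅ₛ → cross v (leftState x) s k ≈ 0#
  cross-∅-off v x       {∅ₛ}  k≈0 s≢∅ = contradiction ≡.refl s≢∅
  cross-∅-off v outside {Rₛ}  k≈0 s≢∅ = trans (skip (k≈0 _ _ λ ())) (skip (k≈0 _ _ λ ()))
  cross-∅-off v outside {Gₛ}  k≈0 s≢∅ = refl
  cross-∅-off v outside {RGₛ} k≈0 s≢∅ = refl
  cross-∅-off v inside  {Rₛ}  k≈0 s≢∅ = skip (k≈0 _ _ λ ())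
  cross-∅-off v inside  {Gₛ}  k≈0 s≢∅ = refl
  cross-∅-off v inside  {RGₛ} k≈0 s≢∅ = trans (skip (k≈0 _ _ λ ())) (skip (k≈0 _ _ λ ()))

  cross-∅-on : ∀ v x {k : State → State → Carrier} → (∀ s a → s ≢ ∅ₛ → k s a ≈ 0#) →
               cross v (leftState x) ∅ₛ k ≈ k ∅ₛ (leftState x)
  cross-∅-on v outside k≈0 = single
  cross-∅-on v inside  k≈0 = trans (+-cong (*-identityˡ _) (skip (k≈0 _ _ λ ()))) (+-identityʳ _)

  pass-∅-off : ∀ {k : Vec State m → State → Carrier} → (∀ v s → s ≢ ∅ₛ → k v s ≈ 0#) →
               ∀ j (ys : Vec I m) a {s} → s ≢ ∅ₛ → pass j ys (Vec.map leftState a) s k ≈ 0#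
  pass-∅-on : ∀ {k : Vec State m → State → Carrier} → (∀ v s → s ≢ ∅ₛ → k v s ≈ 0#) →
              ∀ j (ys : Vec I m) a → pass j ys (Vec.map leftState a) ∅ₛ k ≈ k (Vec.map leftState a) ∅ₛ
  pass-∅-off k≈0 j []       []      s≢∅ = k≈0 [] _ s≢∅
  pass-∅-off {k = k} k≈0 j (i ∷ ys) (x ∷ a) s≢∅ =
    pass-∅-off (λ v s s≢∅ → cross-∅-off (w i j) x {k = λ s a → k (a ∷ v) s} (λ s a → k≈0 (a ∷ v) s) s≢∅) j ys a s≢∅
  pass-∅-on k≈0 j []       []      = refl
  pass-∅-on {k = k} k≈0 j (i ∷ ys) (x ∷ a) = trans
    (pass-∅-on (λ v s s≢∅ → cross-∅-off (w i j) x {k = λ s a → k (a ∷ v) s} (λ s a → k≈0 (a ∷ v) s) s≢∅) j ys a)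
    (cross-∅-on (w i j) x {k = λ s x′ → k (x′ ∷ Vec.map leftState a) s} λ s x′ → k≈0 (x′ ∷ Vec.map leftState a) s)

  cross-R-off : ∀ v {a} b {k : State → State → Carrier} → (∀ s a → a ≢ ∅ₛ → k s a ≈ 0#) →
                a ≢ ∅ₛ → cross v a (rightState b) k ≈ 0#
  cross-R-off v {∅ₛ}  b       k≈0 a≢∅ = contradiction ≡.refl a≢∅
  cross-R-off v {Rₛ}  outside k≈0 a≢∅ = refl
  cross-R-off v {Gₛ}  outside k≈0 a≢∅ = skip (k≈0 _ _ λ ())
  cross-R-off v {RGₛ} outside k≈0 a≢∅ = trans (skip (k≈0 _ _ λ ())) (skip (k≈0 _ _ λ ()))
  cross-R-off v {Rₛ}  inside  k≈0 a≢∅ = refl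
  cross-R-off v {Gₛ}  inside  k≈0 a≢∅ = trans (skip (k≈0 _ _ λ ())) (skip (k≈0 _ _ λ ()))
  cross-R-off v {RGₛ} inside  k≈0 a≢∅ = refl

  cross-R-on : ∀ v b {k : State → State → Carrier} → (∀ s a → a ≢ ∅ₛ → k s a ≈ 0#) →
               cross v ∅ₛ (rightState b) k ≈ k (rightState b) ∅ₛ
  cross-R-on v outside k≈0 = trans (+-cong (*-identityˡ _) (skip (k≈0 _ _ λ ()))) (+-identityʳ _)
  cross-R-on v inside  k≈0 = single

  ∅s : ∀ m → Vec State m
  ∅s m = replicate m ∅ₛ

  -- If one of the lines crossed earlier is not in state ∅, the claim follows from them alone. If
  -- all of them are in state ∅, then b reaches the last crossing unchanged, as a boundary state,
  -- and `cross-R-off` applies.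
  pass-R-off : ∀ {k : Vec State m → State → Carrier} → (∀ v s → v ≢ ∅s m → k v s ≈ 0#) →
               ∀ j (ys : Vec I m) {as} b → as ≢ ∅s m → pass j ys as (rightState b) k ≈ 0#
  pass-R-on : ∀ {k : Vec State m → State → Carrier} → (∀ v s → v ≢ ∅s m → k v s ≈ 0#) →
              ∀ j (ys : Vec I m) b → pass j ys (∅s m) (rightState b) k ≈ k (∅s m) (rightState b)
  cross-vanishes : ∀ {k : Vec State (suc m) → State → Carrier} → (∀ v s → v ≢ ∅s (suc m) → k v s ≈ 0#) →
                   ∀ u a v s → v ≢ ∅s m → cross u a s (λ s′ a′ → k (a′ ∷ v) s′) ≈ 0#
  cross-vanishes k≈0 u a v s v≢∅ =
    ∑-zero (lozenges a s) λ _ → trans (*-congˡ (k≈0 _ _ (v≢∅ ∘ ≡.cong Vec.tail))) (zeroʳ _)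
  pass-R-off k≈0 j []       {[]}     b as≢∅ = contradiction ≡.refl as≢∅
  pass-R-off {suc m} {k} k≈0 j (i ∷ ys) {a ∷ as} b as≢∅ with ≡-dec-State as (∅s m)
    where
    ≡-dec-State = ≡-dec {n = m} _≟ₛ_
  ... | no  as′≢∅  = pass-R-off (cross-vanishes k≈0 (w i j) a) j ys b as′≢∅
  ... | yes ≡.refl = trans
    (pass-R-on (cross-vanishes k≈0 (w i j) a) j ys b)
    (cross-R-off (w i j) {a} b {k = λ s a → k (a ∷ ∅s m) s} (λ s a a≢∅ → k≈0 (a ∷ ∅s m) s λ { ≡.refl → a≢∅ ≡.refl }) λ { ≡.refl → as≢∅ ≡.refl })
  pass-R-on k≈0 j []       b = refl
  pass-R-on {suc m} {k} k≈0 j (i ∷ ys) b = trans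
    (pass-R-on (cross-vanishes k≈0 (w i j) ∅ₛ) j ys b)
    (cross-R-on (w i j) b {k = λ s a → k (a ∷ ∅s m) s} λ s a a≢∅ → k≈0 (a ∷ ∅s m) s λ { ≡.refl → a≢∅ ≡.refl })

  -- Above a bottom R and beside a b-edge in a boundary state, only the tile `R₁` fits. This forces
  -- the left edge to be ∅ and the b-edge to be R, strip by strip.
  amplitude-R-off : ∀ (ys : Vec I m) as b → as ≢ ∅s m ⊎ b ≢ replicate m outside →
    amplitude ys as (Vec.map rightState b) (Vec.map bottomState (replicate m outside)) ≈ 0#
  amplitude-R-vanishes : ∀ (ys : Vec I m) b a v s → v ≢ ∅s m →
    cap a s Rₛ * amplitude ys v (Vec.map rightState b) (Vec.map bottomState (replicate m outside)) ≈ 0#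
  amplitude-R-vanishes ys b a v s v≢∅ = trans (*-congˡ (amplitude-R-off ys v b (inj₁ v≢∅))) (zeroʳ _)
  cap-R-off : ∀ a b → a ≢ ∅ₛ → cap a (rightState b) Rₛ ≈ 0#
  cap-R-off ∅ₛ  b       a≢∅ = contradiction ≡.refl a≢∅
  cap-R-off Rₛ  outside a≢∅ = refl
  cap-R-off Gₛ  outside a≢∅ = refl
  cap-R-off RGₛ outside a≢∅ = refl
  cap-R-off Rₛ  inside  a≢∅ = refl
  cap-R-off Gₛ  inside  a≢∅ = refl
  cap-R-off RGₛ inside  a≢∅ = refl
  amplitude-R-off []       []       []      (inj₁ ne) = contradiction ≡.refl ne
  amplitude-R-off []       []       []      (inj₂ ne) = contradiction ≡.refl ne
  amplitude-R-off {suc m} (j ∷ ys) (a ∷ as) (x ∷ b) ne with ≡-dec-State as (∅s m)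
    where
    ≡-dec-State = ≡-dec {n = m} _≟ₛ_
  ... | no as≢∅    = pass-R-off (amplitude-R-vanishes ys b a) j ys x as≢∅
  ... | yes ≡.refl = trans (pass-R-on (amplitude-R-vanishes ys b a) j ys x) (rest a x ne)
    where
    rest : ∀ a x → a ∷ ∅s m ≢ ∅s (suc m) ⊎ x ∷ b ≢ replicate (suc m) outside →
      cap a (rightState x) Rₛ * amplitude ys (∅s m) (Vec.map rightState b) (Vec.map bottomState (replicate m outside)) ≈ 0#
    rest a x (inj₁ ne) = trans (*-congʳ (cap-R-off a x λ { ≡.refl → ne ≡.refl })) (zeroˡ _)
    rest a inside (inj₂ ne) with a ≟ₛ ∅ₛ
    ... | no a≢∅     = trans (*-congʳ (cap-R-off a inside a≢∅)) (zeroˡ _)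
    ... | yes ≡.refl = zeroˡ _
    rest a outside (inj₂ ne) =
      trans (*-congˡ (amplitude-R-off ys (∅s m) b (inj₂ λ { ≡.refl → ne ≡.refl }))) (zeroʳ _)

  amplitude-R-on : ∀ (ys : Vec I m) →
    amplitude ys (∅s m) (Vec.map rightState (replicate m outside)) (Vec.map bottomState (replicate m outside)) ≈ 1#
  amplitude-R-on []       = refl
  amplitude-R-on {suc m} (j ∷ ys) = begin
    _  ≈⟨ pass-R-on (amplitude-R-vanishes ys (replicate m outside) ∅ₛ) j ys outside ⟩
    _  ≈⟨ *-cong (+-identityʳ 1#) (amplitude-R-on ys) ⟩
    _  ≈⟨ *-identityˡ 1# ⟩
    1# ∎

  cap-G : ∀ (x : Side) s → s ≢ ∅ₛ → cap (leftState x) s Gₛ ≈ 0#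
  cap-G outside ∅ₛ  s≢∅ = refl
  cap-G outside Rₛ  s≢∅ = refl
  cap-G outside Gₛ  s≢∅ = refl
  cap-G outside RGₛ s≢∅ = refl
  cap-G inside  ∅ₛ  s≢∅ = contradiction ≡.refl s≢∅
  cap-G inside  Rₛ  s≢∅ = refl
  cap-G inside  Gₛ  s≢∅ = refl
  cap-G inside  RGₛ s≢∅ = refl

  -- Above a bottom G and beside a left boundary state, only the tile `G₁` fits. The b-line must
  -- therefore arrive in state ∅, has been in it from the right side on, and leaves the other left
  -- edges as they were.
  amplitude-G : ∀ j (ys : Vec I m) x a b₀ bs hs →
    amplitude (j ∷ ys) (leftState x ∷ Vec.map leftState a) (rightState b₀ ∷ bs) (Gₛ ∷ hs) ≈
    cap (leftState x) (rightState b₀) Gₛ * amplitude ys (Vec.map leftState a) bs hs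
  amplitude-G j ys x a outside bs hs = begin
    _  ≈⟨ pass-∅-off (λ v s s≢∅ → trans (*-congʳ (cap-G x s s≢∅)) (zeroˡ _)) j ys a (λ ()) ⟩
    0# ≈⟨ zeroˡ _ ⟨
    _  ≈⟨ *-congʳ (cap-G x Rₛ (λ ())) ⟨
    _  ∎
  amplitude-G j ys x a inside bs hs =
    pass-∅-on (λ v s s≢∅ → trans (*-congʳ (cap-G x s s≢∅)) (zeroˡ _)) j ys a

  -- Read from the left, the bottom side of the full rectangle is a block of G's followed by a block
  -- of R's: `amplitude-G` peels off the first block, and `amplitude-R-on` deals with the second.
  amplitude-descending-on : ∀ (ys : Vec I m) {q} → Descending q →
    amplitude ys (Vec.map leftState q) (Vec.map rightState q) (Vec.map bottomState q) ≈ 1#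
  amplitude-descending-on {m} ys allOutside = begin
    _  ≡⟨ ≡.cong (λ v → amplitude ys v (Vec.map rightState (replicate m outside)) (Vec.map bottomState (replicate m outside))) (map-replicate leftState outside m) ⟩
    _  ≈⟨ amplitude-R-on ys ⟩
    1# ∎
  amplitude-descending-on (j ∷ ys) {inside ∷ q} (inside∷ desc) = begin
    _        ≈⟨ amplitude-G j ys inside q inside _ _ ⟩
    _        ≈⟨ *-cong (+-identityʳ 1#) (amplitude-descending-on ys desc) ⟩
    1# * 1#  ≈⟨ *-identityˡ 1# ⟩
    1#       ∎

  amplitude-descending-off : ∀ (ys : Vec I m) {q} → Descending q → ∀ a b → a ≢ q ⊎ b ≢ q →
    amplitude ys (Vec.map leftState a) (Vec.map rightState b) (Vec.map bottomState q) ≈ 0#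
  amplitude-descending-off ys allOutside a b (inj₁ ne) = amplitude-R-off ys _ b (inj₁ (ne ∘ unmap a))
    where
    unmap : ∀ {m} (a : Subset m) → Vec.map leftState a ≡ ∅s m → a ≡ replicate m outside
    unmap []            eq = ≡.refl
    unmap (outside ∷ a) eq = ≡.cong (outside ∷_) (unmap a (≡.cong Vec.tail eq))
    unmap (inside ∷ a)  ()
  amplitude-descending-off ys allOutside a b (inj₂ ne) = amplitude-R-off ys _ b (inj₂ ne)
  amplitude-descending-off (j ∷ ys) {inside ∷ q} (inside∷ desc) (x ∷ a) (z ∷ b) ne =
    trans (amplitude-G j ys x a z _ _) (rest x z ne)
    where
    A = amplitude ys (Vec.map leftState a) (Vec.map rightState b) (Vec.map bottomState q)
    rest : ∀ x z → x ∷ a ≢ inside ∷ q ⊎ z ∷ b ≢ inside ∷ q →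
           cap (leftState x) (rightState z) Gₛ * A ≈ 0#
    rest outside inside  ne = zeroˡ _
    rest outside outside ne = zeroˡ _
    rest inside  outside ne = zeroˡ _
    rest inside inside (inj₁ ne) =
      trans (*-congˡ (amplitude-descending-off ys desc a b (inj₁ (ne ∘ ≡.cong (inside ∷_))))) (zeroʳ _)
    rest inside inside (inj₂ ne) =
      trans (*-congˡ (amplitude-descending-off ys desc a b (inj₂ (ne ∘ ≡.cong (inside ∷_))))) (zeroʳ _)

  -- Puzzles as terms of the partition function

  open import Algebra.Definitions.RawSemiring (Semiring.rawSemiring semiring) using (product)

  weight : (dl dr : Fin m → I) → Tiling m → Carrier
  weight dl dr empty         = 1#
  weight dl dr (row T ds us) =
    weight (dl ∘ inject₁) (dr ∘ suc) T *
    product λ c → ⟦ scalar (lookup (bottomRow T) c) (lookup ds c) ⟧ₛ (w (dr (suc c)) (dl (inject₁ c)))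

  stripWeight : I → Vec I m → Vec Lozenge m → Carrier
  stripWeight j []       []            = 1#
  stripWeight j (i ∷ ys) ((u , d) ∷ s) = ⟦ scalar u d ⟧ₛ (w i j) * stripWeight j ys s

  -- From every lozenge of the left strip, going down-left leads to the first bottom edge, so all
  -- its weights have the denominator `dl zero`.
  weight-glue : ∀ (dl dr : Fin (suc m) → I) (s : Vec Lozenge m) c T →
    weight dl dr (glue s c T) ≈
    weight (dl ∘ suc) (dr ∘ suc) T * stripWeight (dl zero) (tabulate (dr ∘ suc)) s
  weight-glue dl dr []            c empty         = refl
  weight-glue dl dr ((u , d) ∷ s) c (row T ds us) = begin
    weight (dl ∘ inject₁) (dr ∘ suc) (glue s u T) * rowWeight (bottomRow (glue s u T))
      ≡⟨ ≡.cong (λ v → weight (dl ∘ inject₁) (dr ∘ suc) (glue s u T) * rowWeight v) (bottomRow-glue s u T) ⟩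
    weight (dl ∘ inject₁) (dr ∘ suc) (glue s u T) * (W * Π)
      ≈⟨ *-congʳ (weight-glue (dl ∘ inject₁) (dr ∘ suc) s u T) ⟩
    (weight (dl ∘ suc ∘ inject₁) (λ c → dr (suc (suc c))) T * S) * (W * Π)
      ≈⟨ solve 4 (λ t s w p → (t :* s) :* (w :* p) := (t :* p) :* (w :* s)) refl _ S W Π ⟩
    (weight (dl ∘ suc ∘ inject₁) (λ c → dr (suc (suc c))) T * Π) * (W * S) ∎
    where
    rowWeight : Vec (Tile up) _ → Carrier
    rowWeight v = product λ c → ⟦ scalar (lookup v c) (lookup (d ∷ ds) c) ⟧ₛ (w (dr (suc c)) (dl (inject₁ c)))
    W = ⟦ scalar u d ⟧ₛ (w (dr (suc zero)) (dl zero))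
    Π = product λ c → ⟦ scalar (lookup (bottomRow T) c) (lookup ds c) ⟧ₛ (w (dr (suc (suc c))) (dl (suc (inject₁ c))))
    S = stripWeight (dl zero) (tabulate (λ c → dr (suc (suc c)))) s

  opaque
    unfolding upTiles downTiles

    cross-lozengeTypes : ∀ v a b k → cross v a b k ≈
      ∑ lozengeTypes λ (u , d) →
        when ((hEdge d ≟ₛ hEdge u) ×-dec (aEdge u ≟ₛ a) ×-dec (bEdge u ≟ₛ b))
             (⟦ scalar u d ⟧ₛ v * k (bEdge d) (aEdge d))
    cross-lozengeTypes v a b k = ∑-filter
      (λ (u , d) → (hEdge d ≟ₛ hEdge u) ×-dec (aEdge u ≟ₛ a) ×-dec (bEdge u ≟ₛ b))
      (cartesianProduct (tiles up) (tiles down)) _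

    cap-upTiles : ∀ a b h → cap a b h ≈
      ∑ upTiles λ c → when ((aEdge c ≟ₛ a) ×-dec (bEdge c ≟ₛ b) ×-dec (hEdge c ≟ₛ h)) 1#
    cap-upTiles a b h = ∑-filter
      (λ c → (aEdge c ≟ₛ a) ×-dec (bEdge c ≟ₛ b) ×-dec (hEdge c ≟ₛ h)) (tiles up) λ _ → 1#

    ∑-tilings : ∀ m f → ∑ (tilings (suc m)) f ≈
      ∑ (tilings m) λ T → ∑ (vectors downTiles m) λ ds → ∑ (vectors upTiles (suc m)) λ us → f (row T ds us)
    ∑-tilings m f = trans
      (∑-cartesianProductWith (λ T (ds , us) → row T ds us) (tilings m) _ f)
      (∑-cong (tilings m) λ T → ∑-cartesianProductWith _,_ (vectors (tiles down) m) (vectors (tiles up) (suc m)) _)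

  module _ {A B C D E : Set} (xs : List A) (ys : List B) (zs : List C) where
    ∑-rotate₃ : (f : A → B → C → Carrier) →
      ∑ xs (λ x → ∑ ys λ y → ∑ zs (f x y)) ≈ ∑ zs λ z → ∑ xs λ x → ∑ ys λ y → f x y z
    ∑-rotate₃ f = trans (∑-cong xs λ x → ∑-comm ys zs (f x)) (∑-comm xs zs _)

    module _ (vs : List D) where
      ∑-rotate₄ : (f : A → B → C → D → Carrier) →
        ∑ xs (λ x → ∑ ys λ y → ∑ zs λ z → ∑ vs (f x y z)) ≈
        ∑ vs λ v → ∑ xs λ x → ∑ ys λ y → ∑ zs λ z → f x y z v
      ∑-rotate₄ f = trans (∑-cong xs λ x → trans (∑-cong ys λ y → ∑-comm zs vs (f x y)) (∑-comm ys vs _)) (∑-comm xs vs _)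

      ∑-rotate₅ : (us : List E) (f : A → B → C → D → E → Carrier) →
        ∑ xs (λ x → ∑ ys λ y → ∑ zs λ z → ∑ vs λ v → ∑ us (f x y z v)) ≈
        ∑ us λ u → ∑ xs λ x → ∑ ys λ y → ∑ zs λ z → ∑ vs λ v → f x y z v u
      ∑-rotate₅ us f = trans
        (∑-cong xs λ x → trans (∑-cong ys λ y → trans (∑-cong zs λ z → ∑-comm vs us (f x y z)) (∑-comm zs us _)) (∑-comm ys us _))
        (∑-comm xs us _)

  ∑-vectors : ∀ {A : Set} (xs : List A) m f →
    ∑ (vectors xs (suc m)) f ≈ ∑ xs λ x → ∑ (vectors xs m) λ v → f (x ∷ v)
  ∑-vectors xs m f = ∑-cartesianProductWith _∷_ xs (vectors xs m) f

  -- Induction on the side: the bottom row is taken off, the strip is glued to the rest, and the row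
  -- is put back. Once both sides are sums over single tiles, they differ only in the order of
  -- summation.
  ∑-glue : ∀ m f → ∑ (tilings (suc m)) f ≈
    ∑ (tilings m) λ T → ∑ upTiles λ c → ∑ (vectors lozengeTypes m) λ s → f (glue s c T)
  ∑-glue zero f = trans (∑-tilings 0 f)
    (+-congʳ (trans (+-identityʳ _) (∑-vectors upTiles 0 λ us → f (row empty [] us))))
  ∑-glue (suc m) f = begin
    ∑ (tilings (suc (suc m))) f
      ≈⟨ ∑-tilings (suc m) f ⟩
    (∑ (tilings (suc m)) λ T → ∑ (vectors downTiles (suc m)) λ ds → ∑ (vectors upTiles (suc (suc m))) λ us → f (row T ds us))
      ≈⟨ ∑-glue m _ ⟩
    (∑ (tilings m) λ T → ∑ upTiles λ u → ∑ (vectors lozengeTypes m) λ s →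
      ∑ (vectors downTiles (suc m)) λ ds → ∑ (vectors upTiles (suc (suc m))) λ us → f (row (glue s u T) ds us))
      ≈⟨ ∑-cong (tilings m) (λ T → rearrange T) ⟩
    (∑ (tilings m) λ T → ∑ (vectors downTiles m) λ ds → ∑ (vectors upTiles (suc m)) λ us →
      ∑ upTiles λ c → ∑ (vectors lozengeTypes (suc m)) λ s → f (glue s c (row T ds us)))
      ≈⟨ ∑-tilings m _ ⟨
    (∑ (tilings (suc m)) λ T → ∑ upTiles λ c → ∑ (vectors lozengeTypes (suc m)) λ s → f (glue s c T)) ∎
    where
    rearrange : ∀ T →
      (∑ upTiles λ u → ∑ (vectors lozengeTypes m) λ s →
        ∑ (vectors downTiles (suc m)) λ ds → ∑ (vectors upTiles (suc (suc m))) λ us → f (row (glue s u T) ds us)) ≈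
      (∑ (vectors downTiles m) λ ds → ∑ (vectors upTiles (suc m)) λ us →
        ∑ upTiles λ c → ∑ (vectors lozengeTypes (suc m)) λ s → f (glue s c (row T ds us)))
    rearrange T = begin
      (∑ us₁ λ u → ∑ ss λ s → ∑ (vectors downTiles (suc m)) λ ds → ∑ (vectors upTiles (suc (suc m))) λ us → f (row (glue s u T) ds us))
        ≈⟨ (∑-cong us₁ λ u → ∑-cong ss λ s → trans
             (∑-vectors downTiles m λ ds → ∑ (vectors upTiles (suc (suc m))) λ us → f (row (glue s u T) ds us))
             (∑-cong ds₁ λ d → ∑-cong dss λ ds → ∑-vectors upTiles (suc m) λ us → f (row (glue s u T) (d ∷ ds) us))) ⟩
      (∑ us₁ λ u → ∑ ss λ s → ∑ ds₁ λ d → ∑ dss λ ds → ∑ us₁ λ c → ∑ uss λ us → f (row (glue s u T) (d ∷ ds) (c ∷ us)))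
        ≈⟨ ∑-rotate₄ {E = ⊤} us₁ ss ds₁ dss _ ⟩
      (∑ dss λ ds → ∑ us₁ λ u → ∑ ss λ s → ∑ ds₁ λ d → ∑ us₁ λ c → ∑ uss λ us → f (row (glue s u T) (d ∷ ds) (c ∷ us)))
        ≈⟨ (∑-cong dss λ ds → ∑-rotate₅ us₁ ss ds₁ us₁ uss _) ⟩
      (∑ dss λ ds → ∑ uss λ us → ∑ us₁ λ u → ∑ ss λ s → ∑ ds₁ λ d → ∑ us₁ λ c → f (row (glue s u T) (d ∷ ds) (c ∷ us)))
        ≈⟨ (∑-cong dss λ ds → ∑-cong uss λ us → ∑-rotate₄ {E = ⊤} us₁ ss ds₁ us₁ _) ⟩
      (∑ dss λ ds → ∑ uss λ us → ∑ us₁ λ c → ∑ us₁ λ u → ∑ ss λ s → ∑ ds₁ λ d → f (row (glue s u T) (d ∷ ds) (c ∷ us)))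
        ≈⟨ (∑-cong dss λ ds → ∑-cong uss λ us → ∑-cong us₁ λ c → ∑-cong us₁ λ u → ∑-comm ss ds₁ λ s d → f (row (glue s u T) (d ∷ ds) (c ∷ us))) ⟩
      (∑ dss λ ds → ∑ uss λ us → ∑ us₁ λ c → ∑ us₁ λ u → ∑ ds₁ λ d → ∑ ss λ s → f (row (glue s u T) (d ∷ ds) (c ∷ us)))
        ≈⟨ (∑-cong dss λ ds → ∑-cong uss λ us → ∑-cong us₁ λ c → trans
             (∑-vectors lozengeTypes m λ s → f (glue s c (row T ds us)))
             (∑-cartesianProductWith _,_ us₁ ds₁ λ p → ∑ ss λ s → f (glue (p ∷ s) c (row T ds us)))) ⟨
      (∑ dss λ ds → ∑ uss λ us → ∑ us₁ λ c → ∑ (vectors lozengeTypes (suc m)) λ s → f (glue s c (row T ds us))) ∎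
      where
      us₁ = upTiles
      ds₁ = downTiles
      ss  = vectors lozengeTypes m
      dss = vectors ds₁ m
      uss = vectors us₁ (suc m)

  -- Turns the nested sums over matching lozenges into one sum over all strips with an indicator,
  -- which can be compared with `∑-glue`.
  pass-strips : ∀ j (ys : Vec I m) as b k →
    pass j ys as b k ≈
    ∑ (vectors lozengeTypes m) λ s →
      when (stripFits? s as b) (stripWeight j ys s * k (Vec.map (aEdge ∘ proj₂) s) (outgoing s b))
  pass-strips j []       []       b k = sym (trans (+-identityʳ _) (*-identityˡ _))
  pass-strips {suc m} j (i ∷ ys) (a ∷ as) b k = begin
    pass j ys as b (λ as′ b′ → cross (w i j) a b′ λ b″ a′ → k (a′ ∷ as′) b″)
      ≈⟨ pass-strips j ys as b _ ⟩
    (∑ ss λ s → when (stripFits? s as b) (stripWeight j ys s *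
      cross (w i j) a (outgoing s b) λ b″ a′ → k (a′ ∷ Vec.map (aEdge ∘ proj₂) s) b″))
      ≈⟨ (∑-cong ss λ s → expand s) ⟩
    (∑ ss λ s → ∑ lozengeTypes λ p → when (stripFits? (p ∷ s) (a ∷ as) b) (value p s))
      ≈⟨ ∑-comm ss lozengeTypes _ ⟩
    (∑ lozengeTypes λ p → ∑ ss λ s → when (stripFits? (p ∷ s) (a ∷ as) b) (value p s))
      ≈⟨ ∑-vectors lozengeTypes m _ ⟨
    (∑ (vectors lozengeTypes (suc m)) λ s →
      when (stripFits? s (a ∷ as) b) (stripWeight j (i ∷ ys) s * k (Vec.map (aEdge ∘ proj₂) s) (outgoing s b))) ∎
    where
    ss = vectors lozengeTypes m
    value : Lozenge → Vec Lozenge m → Carrier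
    value p s = stripWeight j (i ∷ ys) (p ∷ s) * k (Vec.map (aEdge ∘ proj₂) (p ∷ s)) (outgoing (p ∷ s) b)
    expand : ∀ s →
      when (stripFits? s as b) (stripWeight j ys s *
        cross (w i j) a (outgoing s b) λ b″ a′ → k (a′ ∷ Vec.map (aEdge ∘ proj₂) s) b″) ≈
      ∑ lozengeTypes λ p → when (stripFits? (p ∷ s) (a ∷ as) b) (value p s)
    expand s = begin
      when S? (σ * cross (w i j) a (outgoing s b) λ b″ a′ → κ b″ a′)
        ≈⟨ when-⇔ S? S? id id (λ _ → *-congˡ (cross-lozengeTypes (w i j) a (outgoing s b) κ)) ⟩
      when S? (σ * ∑ lozengeTypes λ p → when (P? p) (summand p))
        ≈⟨ when-⇔ S? S? id id (λ _ → sym (∑-*ˡ lozengeTypes σ _)) ⟩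
      when S? (∑ lozengeTypes λ p → σ * when (P? p) (summand p))
        ≈⟨ when-∑ S? lozengeTypes _ ⟨
      (∑ lozengeTypes λ p → when S? (σ * when (P? p) (summand p)))
        ≈⟨ (∑-cong lozengeTypes λ p → trans
             (when-⇔ S? S? id id (λ _ → sym (when-*ˡ (P? p) σ (summand p))))
             (trans (when-× S? (P? p) _)
             (when-⇔ (S? ×-dec P? p) (stripFits? (p ∷ s) (a ∷ as) b)
               (λ (f , g) → g , f) (λ (g , f) → f , g)
               (λ _ → solve 3 (λ σ c k → σ :* (c :* k) := (c :* σ) :* k) refl _ _ _)))) ⟩
      (∑ lozengeTypes λ p → when (stripFits? (p ∷ s) (a ∷ as) b) (value p s)) ∎
      where
      S? = stripFits? s as b
      σ = stripWeight j ys s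
      κ = λ b″ a′ → k (a′ ∷ Vec.map (aEdge ∘ proj₂) s) b″
      P? : (p : Lozenge) → Dec _
      P? (u , d) = (hEdge d ≟ₛ hEdge u) ×-dec (aEdge u ≟ₛ a) ×-dec (bEdge u ≟ₛ outgoing s b)
      summand : Lozenge → Carrier
      summand (u , d) = ⟦ scalar u d ⟧ₛ (w i j) * κ (bEdge d) (aEdge d)

  -- Condition and weight of a glued tiling both split into the parts of the strip, of the corner
  -- tile and of the smaller tiling, to which the induction applies.
  puzzle-amplitude : ∀ (lab : Fin m → I) as bs hs →
    ∑ (tilings m) (λ T → when (fits? T as bs hs) (weight lab lab T)) ≈
    amplitude (tabulate lab) as bs hs
  puzzle-amplitude lab []       []       []       = +-identityʳ _
  puzzle-amplitude {suc m} lab (a ∷ as) (b ∷ bs) (h ∷ hs) = begin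
    (∑ (tilings (suc m)) λ T → when (fits? T (a ∷ as) (b ∷ bs) (h ∷ hs)) (weight lab lab T))
      ≈⟨ ∑-glue m _ ⟩
    (∑ (tilings m) λ T → ∑ upTiles λ c → ∑ ss λ s →
      when (fits? (glue s c T) (a ∷ as) (b ∷ bs) (h ∷ hs)) (weight lab lab (glue s c T)))
      ≈⟨ (∑-cong (tilings m) λ T → ∑-cong upTiles λ c → ∑-cong ss λ s → separate T c s) ⟩
    (∑ (tilings m) λ T → ∑ upTiles λ c → ∑ ss λ s → summand s c T)
      ≈⟨ (∑-rotate₃ {D = ⊤} {E = ⊤} (tilings m) upTiles ss λ T c s → summand s c T) ⟩
    (∑ ss λ s → ∑ (tilings m) λ T → ∑ upTiles λ c → summand s c T)
      ≈⟨ (∑-cong ss λ s → ∑-comm (tilings m) upTiles λ T c → summand s c T) ⟩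
    (∑ ss λ s → ∑ upTiles λ c → ∑ (tilings m) λ T → summand s c T)
      ≈⟨ (∑-cong ss λ s → collect s) ⟩
    (∑ ss λ s → when (stripFits? s as b) (stripWeight j ys s *
      (cap a (outgoing s b) h * amplitude ys (Vec.map (aEdge ∘ proj₂) s) bs hs)))
      ≈⟨ pass-strips j ys as b _ ⟨
    pass j ys as b (λ as′ b′ → cap a b′ h * amplitude ys as′ bs hs) ∎
    where
    j = lab zero
    ys = tabulate (lab ∘ suc)
    ss = vectors lozengeTypes m
    cap? : (s : Vec Lozenge m) (c : Tile up) → Dec (aEdge c ≡ a × bEdge c ≡ outgoing s b × hEdge c ≡ h)
    cap? s c = (aEdge c ≟ₛ a) ×-dec (bEdge c ≟ₛ outgoing s b) ×-dec (hEdge c ≟ₛ h)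
    top? : (s : Vec Lozenge m) (T : Tiling m) → Dec (Fits T (Vec.map (aEdge ∘ proj₂) s) bs hs)
    top? s T = fits? T (Vec.map (aEdge ∘ proj₂) s) bs hs
    τ : Tiling m → Carrier
    τ T = weight (lab ∘ suc) (lab ∘ suc) T
    summand : Vec Lozenge m → Tile up → Tiling m → Carrier
    summand s c T = when (stripFits? s as b) (stripWeight j ys s * (when (cap? s c) 1# * when (top? s T) (τ T)))
    separate : ∀ T c s → when (fits? (glue s c T) (a ∷ as) (b ∷ bs) (h ∷ hs)) (weight lab lab (glue s c T)) ≈ summand s c T
    separate T c s = begin
      when (fits? (glue s c T) (a ∷ as) (b ∷ bs) (h ∷ hs)) (weight lab lab (glue s c T))
        ≈⟨ when-⇔ (fits? (glue s c T) (a ∷ as) (b ∷ bs) (h ∷ hs)) (S? ×-dec (C? ×-dec T?)) (fits-glue⁻ s c T) (fits-glue⁺ s c T)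
             (λ _ → trans (weight-glue lab lab s c T) (solve 2 (λ t σ → t :* σ := σ :* (con 1ℤ :* t)) refl _ _)) ⟩
      when (S? ×-dec (C? ×-dec T?)) (σ * (1# * τ T))
        ≈⟨ when-× S? (C? ×-dec T?) _ ⟨
      when S? (when (C? ×-dec T?) (σ * (1# * τ T)))
        ≈⟨ when-⇔ S? S? id id (λ _ → trans (when-*ˡ (C? ×-dec T?) σ _) (*-congˡ
             (trans (sym (when-× C? T? _)) (trans (when-⇔ C? C? id id (λ _ → when-*ˡ T? 1# (τ T))) (when-*ʳ C? _ 1#))))) ⟩
      summand s c T ∎
      where
      S? = stripFits? s as b
      C? = cap? s c
      T? = top? s T
      σ = stripWeight j ys s
    collect : ∀ s → (∑ upTiles λ c → ∑ (tilings m) λ T → summand s c T) ≈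
      when (stripFits? s as b) (stripWeight j ys s *
        (cap a (outgoing s b) h * amplitude ys (Vec.map (aEdge ∘ proj₂) s) bs hs))
    collect s = begin
      (∑ upTiles λ c → ∑ (tilings m) λ T → when S? (σ * (C c * V T)))
        ≈⟨ (∑-cong upTiles λ c → trans (when-∑ S? (tilings m) _)
             (when-⇔ S? S? id id λ _ → trans (∑-*ˡ (tilings m) σ _) (*-congˡ (∑-*ˡ (tilings m) (C c) V)))) ⟩
      (∑ upTiles λ c → when S? (σ * (C c * ∑ (tilings m) V)))
        ≈⟨ trans (when-∑ S? upTiles _)
             (when-⇔ S? S? id id λ _ → trans (∑-*ˡ upTiles σ _) (*-congˡ (∑-*ʳ upTiles (∑ (tilings m) V) C))) ⟩
      when S? (σ * (∑ upTiles C * ∑ (tilings m) V))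
        ≈⟨ when-⇔ S? S? id id (λ _ → *-congˡ (*-cong
             (sym (cap-upTiles a (outgoing s b) h))
             (puzzle-amplitude (lab ∘ suc) (Vec.map (aEdge ∘ proj₂) s) bs hs))) ⟩
      when S? (σ * (cap a (outgoing s b) h * amplitude ys (Vec.map (aEdge ∘ proj₂) s) bs hs)) ∎
      where
      S? = stripFits? s as b
      σ = stripWeight j ys s
      C = λ c → when (cap? s c) 1#
      V = λ T → when (top? s T) (τ T)

-- Subsets, their enumerations and the simple reflections

module _ where
  open import Relation.Binary.PropositionalEquality using (refl; sym; trans; cong; cong₂; subst)

  left right : Adj n → Fin n
  left here      = zero
  left (there i) = suc (left i)
  right here      = suc zero
  right (there i) = suc (right i)

  τ : Adj n → Fin n → Fin n
  τ here      zero          = suc zero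
  τ here      (suc zero)    = zero
  τ here      (suc (suc j)) = suc (suc j)
  τ (there i) zero          = zero
  τ (there i) (suc j)       = suc (τ i j)

  τ-involutive : ∀ (i : Adj n) j → τ i (τ i j) ≡ j
  τ-involutive here      zero          = refl
  τ-involutive here      (suc zero)    = refl
  τ-involutive here      (suc (suc j)) = refl
  τ-involutive (there i) zero          = refl
  τ-involutive (there i) (suc j)       = cong suc (τ-involutive i j)

  τ-left : ∀ (i : Adj n) → τ i (left i) ≡ right i
  τ-left here      = refl
  τ-left (there i) = cong suc (τ-left i)

  τ-right : ∀ (i : Adj n) → τ i (right i) ≡ left i
  τ-right here      = refl
  τ-right (there i) = cong suc (τ-right i)

  τ-other : ∀ (i : Adj n) j → j ≢ left i → j ≢ right i → τ i j ≡ j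
  τ-other here      zero          j≢l j≢r = contradiction refl j≢l
  τ-other here      (suc zero)    j≢l j≢r = contradiction refl j≢r
  τ-other here      (suc (suc j)) j≢l j≢r = refl
  τ-other (there i) zero          j≢l j≢r = refl
  τ-other (there i) (suc j)       j≢l j≢r = cong suc (τ-other i j (j≢l ∘ cong suc) (j≢r ∘ cong suc))

  left≢right : ∀ (i : Adj n) → left i ≢ right i
  left≢right (there i) eq = left≢right i (Fin.suc-injective eq)

  toℕ-right : ∀ (i : Adj n) → toℕ (right i) ≡ suc (toℕ (left i))
  toℕ-right here      = refl
  toℕ-right (there i) = cong suc (toℕ-right i)

  adjacent : ∀ (a b : Fin n) → toℕ b ≡ suc (toℕ a) → Σ (Adj n) λ i → left i ≡ a × right i ≡ b
  adjacent zero    (suc zero) eq = here , refl , refl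
  adjacent (suc a) (suc b)    eq with i , l , r ← adjacent a b (ℕ.suc-injective eq) =
    there i , cong suc l , cong suc r

  τ-unique : ∀ (i : Adj n) {σ : Fin n → Fin n} → σ (left i) ≡ right i → σ (right i) ≡ left i →
             (∀ j → j ≢ left i → j ≢ right i → σ j ≡ j) → ∀ j → σ j ≡ τ i j
  τ-unique i σl σr σo j with j Fin.≟ left i | j Fin.≟ right i
  ... | yes refl | _        = trans σl (sym (τ-left i))
  ... | no _     | yes refl = trans σr (sym (τ-right i))
  ... | no j≢l   | no j≢r   = trans (σo j j≢l j≢r) (sym (τ-other i j j≢l j≢r))

  transpose≗τ : ∀ (i : Adj n) j → transpose (left i) (right i) j ≡ τ i j
  transpose≗τ i j with j Fin.≟ left i
  ... | yes refl = sym (τ-left i)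
  ... | no j≢l with j Fin.≟ right i
  ...   | yes refl = sym (τ-right i)
  ...   | no j≢r   = sym (τ-other i j j≢l j≢r)

  module _ (i : Adj n) where
    private
      mirrored : Σ (Adj n) λ j → left j ≡ opposite (right i) × right j ≡ opposite (left i)
      mirrored = adjacent (opposite (right i)) (opposite (left i)) (begin
        toℕ (opposite (left i))              ≡⟨ Fin.opposite-prop (left i) ⟩
        n ℕ.∸ suc (toℕ (left i))             ≡⟨ cong (n ℕ.∸_) (toℕ-right i) ⟨
        n ℕ.∸ toℕ (right i)                  ≡⟨ lemma (Fin.toℕ<n (right i)) ⟩
        suc (n ℕ.∸ suc (toℕ (right i)))      ≡⟨ cong suc (Fin.opposite-prop (right i)) ⟨
        suc (toℕ (opposite (right i)))       ∎)
        where
        open ≡.≡-Reasoning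
        lemma : ∀ {a b} → a < b → b ℕ.∸ a ≡ suc (b ℕ.∸ suc a)
        lemma {zero}  {suc b} _         = refl
        lemma {suc a} {suc b} (s≤s a<b) = lemma a<b

    mirror : Adj n
    mirror = proj₁ mirrored

    left-mirror : left mirror ≡ opposite (right i)
    left-mirror = proj₁ (proj₂ mirrored)

    right-mirror : right mirror ≡ opposite (left i)
    right-mirror = proj₂ (proj₂ mirrored)

    τ-mirror : ∀ j → τ mirror (opposite j) ≡ opposite (τ i j)
    τ-mirror j = sym (trans (cong (opposite ∘ τ i) (sym (Fin.opposite-involutive j)))
      (τ-unique mirror {λ j → opposite (τ i (opposite j))}
        (via left-mirror (τ-right i) right-mirror)
        (via right-mirror (τ-left i) left-mirror)
        (λ j j≢l j≢r → trans
          (cong opposite (τ-other i (opposite j)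
            (λ eq → j≢r (trans (flip eq) (sym right-mirror)))
            (λ eq → j≢l (trans (flip eq) (sym left-mirror)))))
          (Fin.opposite-involutive j))
        (opposite j)))
      where
      flip : ∀ {j a} → opposite j ≡ a → j ≡ opposite a
      flip {j} eq = trans (sym (Fin.opposite-involutive j)) (cong opposite eq)
      via : ∀ {a b c d} → a ≡ opposite b → τ i b ≡ d → c ≡ opposite d → opposite (τ i (opposite a)) ≡ c
      via {b = b} refl τb refl = cong opposite (trans (cong (τ i) (Fin.opposite-involutive b)) τb)

  lookup-∷ʳ-inject₁ : ∀ (v : Vec 𝒜 n) x j → lookup (v ∷ʳ x) (inject₁ j) ≡ lookup v j
  lookup-∷ʳ-inject₁ (z ∷ v) x zero    = refl
  lookup-∷ʳ-inject₁ (z ∷ v) x (suc j) = lookup-∷ʳ-inject₁ v x j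

  lookup-∷ʳ-fromℕ : ∀ (v : Vec 𝒜 n) x → lookup (v ∷ʳ x) (fromℕ n) ≡ x
  lookup-∷ʳ-fromℕ []      x = refl
  lookup-∷ʳ-fromℕ (z ∷ v) x = lookup-∷ʳ-fromℕ v x

  lookup-reverse-opposite : ∀ (v : Vec 𝒜 n) j → lookup (reverse v) (opposite j) ≡ lookup v j
  lookup-reverse-opposite (x ∷ v) zero    =
    trans (cong (λ u → lookup u (fromℕ _)) (reverse-∷ x v)) (lookup-∷ʳ-fromℕ (reverse v) x)
  lookup-reverse-opposite (x ∷ v) (suc j) = trans
    (cong (λ u → lookup u (inject₁ (opposite j))) (reverse-∷ x v))
    (trans (lookup-∷ʳ-inject₁ (reverse v) x (opposite j)) (lookup-reverse-opposite v j))

  lookup-reverse : ∀ (v : Vec 𝒜 n) j → lookup (reverse v) j ≡ lookup v (opposite j)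
  lookup-reverse v j = trans (cong (lookup (reverse v)) (sym (Fin.opposite-involutive j))) (lookup-reverse-opposite v (opposite j))

  lookup-ext : ∀ {u v : Vec 𝒜 n} → (∀ j → lookup u j ≡ lookup v j) → u ≡ v
  lookup-ext {u = u} {v} eq = trans (sym (tabulate∘lookup u)) (trans (tabulate-cong eq) (tabulate∘lookup v))

  lookup-swapAt : ∀ (i : Adj n) (v : Vec 𝒜 n) j → lookup (swapAt i v) j ≡ lookup v (τ i j)
  lookup-swapAt here      (x ∷ y ∷ v) zero          = refl
  lookup-swapAt here      (x ∷ y ∷ v) (suc zero)    = refl
  lookup-swapAt here      (x ∷ y ∷ v) (suc (suc j)) = refl
  lookup-swapAt (there i) (x ∷ v)     zero          = refl
  lookup-swapAt (there i) (x ∷ v)     (suc j)       = lookup-swapAt i v j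

  entryˡ-lookup : ∀ (i : Adj n) (v : Vec 𝒜 n) → entryˡ i v ≡ lookup v (left i)
  entryˡ-lookup here      (x ∷ y ∷ v) = refl
  entryˡ-lookup (there i) (x ∷ v)     = entryˡ-lookup i v

  entryʳ-lookup : ∀ (i : Adj n) (v : Vec 𝒜 n) → entryʳ i v ≡ lookup v (right i)
  entryʳ-lookup here      (x ∷ y ∷ v) = refl
  entryʳ-lookup (there i) (x ∷ v)     = entryʳ-lookup i v

  swapAt-involutive : ∀ (i : Adj n) (v : Vec 𝒜 n) → swapAt i (swapAt i v) ≡ v
  swapAt-involutive here      (x ∷ y ∷ v) = refl
  swapAt-involutive (there i) (x ∷ v)     = cong (x ∷_) (swapAt-involutive i v)

  swapAt-map : ∀ {B : Set} (f : 𝒜 → B) (i : Adj n) v → swapAt i (Vec.map f v) ≡ Vec.map f (swapAt i v)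
  swapAt-map f here      (x ∷ y ∷ v) = refl
  swapAt-map f (there i) (x ∷ v)     = cong (f x ∷_) (swapAt-map f i v)

  entryˡ-map : ∀ {B : Set} (f : 𝒜 → B) (i : Adj n) v → entryˡ i (Vec.map f v) ≡ f (entryˡ i v)
  entryˡ-map f here      (x ∷ y ∷ v) = refl
  entryˡ-map f (there i) (x ∷ v)     = entryˡ-map f i v

  entryʳ-map : ∀ {B : Set} (f : 𝒜 → B) (i : Adj n) v → entryʳ i (Vec.map f v) ≡ f (entryʳ i v)
  entryʳ-map f here      (x ∷ y ∷ v) = refl
  entryʳ-map f (there i) (x ∷ v)     = entryʳ-map f i v

  entryˡ-swapAt : ∀ (i : Adj n) (v : Vec 𝒜 n) → entryˡ i (swapAt i v) ≡ entryʳ i v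
  entryˡ-swapAt here      (x ∷ y ∷ v) = refl
  entryˡ-swapAt (there i) (x ∷ v)     = entryˡ-swapAt i v

  entryʳ-swapAt : ∀ (i : Adj n) (v : Vec 𝒜 n) → entryʳ i (swapAt i v) ≡ entryˡ i v
  entryʳ-swapAt here      (x ∷ y ∷ v) = refl
  entryʳ-swapAt (there i) (x ∷ v)     = entryʳ-swapAt i v

  swapAt-equal : ∀ (i : Adj n) (v : Vec 𝒜 n) → entryˡ i v ≡ entryʳ i v → swapAt i v ≡ v
  swapAt-equal here      (x ∷ y ∷ v) refl = refl
  swapAt-equal (there i) (x ∷ v)     eq   = cong (x ∷_) (swapAt-equal i v eq)

  reverse-swapAt : ∀ (i : Adj n) (v : Vec 𝒜 n) → swapAt (mirror i) (reverse v) ≡ reverse (swapAt i v)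
  reverse-swapAt i v = lookup-ext λ j → begin
    lookup (swapAt (mirror i) (reverse v)) j       ≡⟨ lookup-swapAt (mirror i) (reverse v) j ⟩
    lookup (reverse v) (τ (mirror i) j)            ≡⟨ cong (lookup (reverse v) ∘ τ (mirror i)) (Fin.opposite-involutive j) ⟨
    lookup (reverse v) (τ (mirror i) (opposite (opposite j))) ≡⟨ cong (lookup (reverse v)) (τ-mirror i (opposite j)) ⟩
    lookup (reverse v) (opposite (τ i (opposite j)))  ≡⟨ lookup-reverse-opposite v _ ⟩
    lookup v (τ i (opposite j))                    ≡⟨ lookup-swapAt i v (opposite j) ⟨
    lookup (swapAt i v) (opposite j)               ≡⟨ lookup-reverse (swapAt i v) j ⟨
    lookup (reverse (swapAt i v)) j                ∎
    where
    open ≡.≡-Reasoning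

  entryˡ-mirror : ∀ (i : Adj n) (v : Vec 𝒜 n) → entryˡ (mirror i) (reverse v) ≡ entryʳ i v
  entryˡ-mirror i v = trans (entryˡ-lookup (mirror i) (reverse v)) (trans (cong (lookup (reverse v)) (left-mirror i))
    (trans (lookup-reverse-opposite v (right i)) (sym (entryʳ-lookup i v))))

  entryʳ-mirror : ∀ (i : Adj n) (v : Vec 𝒜 n) → entryʳ (mirror i) (reverse v) ≡ entryˡ i v
  entryʳ-mirror i v = trans (entryʳ-lookup (mirror i) (reverse v)) (trans (cong (lookup (reverse v)) (right-mirror i))
    (trans (lookup-reverse-opposite v (left i)) (sym (entryˡ-lookup i v))))

  -- The frames of full rectangles.
  data Sorted : Subset n → Set where
    allInside : Sorted (replicate n inside)
    outside∷_ : ∀ {p : Subset n} → Sorted p → Sorted (outside ∷ p)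

  Raised : Adj n → Subset n → Set
  Raised i q = entryˡ i q ≡ outside × entryʳ i q ≡ inside

  sorted-or-lowered : ∀ (p : Subset n) → Sorted p ⊎ ∃₂ λ i q → Raised i q × p ≡ swapAt i q
  sorted-or-lowered [] = inj₁ allInside
  sorted-or-lowered (x ∷ p) with sorted-or-lowered p
  ... | inj₂ (i , q , raised , refl) = inj₂ (there i , x ∷ q , raised , refl)
  sorted-or-lowered (outside ∷ p) | inj₁ sorted              = inj₁ (outside∷ sorted)
  sorted-or-lowered (inside ∷ _)  | inj₁ allInside           = inj₁ allInside
  sorted-or-lowered (inside ∷ _)  | inj₁ (outside∷_ {p = p} _) = inj₂ (here , outside ∷ inside ∷ p , (refl , refl) , refl)

  outsides : Subset n → ℕ
  outsides []            = 0
  outsides (outside ∷ p) = suc (outsides p)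
  outsides (inside ∷ p)  = outsides p

  -- The number of boxes missing from the full rectangle: each is a pair of an element and a later
  -- non-element.
  rank : Subset n → ℕ
  rank []            = 0
  rank (outside ∷ p) = rank p
  rank (inside ∷ p)  = outsides p ℕ.+ rank p

  outsides-swapAt : ∀ (i : Adj n) p → outsides (swapAt i p) ≡ outsides p
  outsides-swapAt here (outside ∷ outside ∷ p) = refl
  outsides-swapAt here (outside ∷ inside ∷ p)  = refl
  outsides-swapAt here (inside ∷ outside ∷ p)  = refl
  outsides-swapAt here (inside ∷ inside ∷ p)   = refl
  outsides-swapAt (there i) (outside ∷ p)      = cong suc (outsides-swapAt i p)
  outsides-swapAt (there i) (inside ∷ p)       = outsides-swapAt i p

  rank-swapAt : ∀ (i : Adj n) q → Raised i q → rank (swapAt i q) ≡ suc (rank q)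
  rank-swapAt here (outside ∷ inside ∷ q) (refl , refl) = refl
  rank-swapAt (there i) (outside ∷ q) raised = rank-swapAt i q raised
  rank-swapAt (there i) (inside ∷ q)  raised = trans
    (cong₂ ℕ._+_ (outsides-swapAt i q) (rank-swapAt i q raised)) (ℕ.+-suc (outsides q) (rank q))

  rank-raised : ∀ (i : Adj n) q → Raised i q → rank q < rank (swapAt i q)
  rank-raised i q raised = ℕ.≤-reflexive (sym (rank-swapAt i q raised))

  rank-rec : (P : Subset n → Set) → (∀ p → (∀ q → rank q < rank p → P q) → P p) → ∀ p → P p
  rank-rec P step p = <-rec (λ r → ∀ p → rank p ≡ r → P p)
    (λ r rec p eq → step p λ q q<p → rec (subst (rank q <_) eq q<p) q refl) (rank p) p refl

  lowering-rec : (P : Subset n → Set) → (∀ p → Sorted p → P p) →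
                 (∀ i q → Raised i q → P q → P (swapAt i q)) → ∀ p → P p
  lowering-rec P base step = rank-rec P λ p rec → case p rec (sorted-or-lowered p)
    where
    case : ∀ p → (∀ q → rank q < rank p → P q) → Sorted p ⊎ ∃₂ (λ i q → Raised i q × p ≡ swapAt i q) → P p
    case p rec (inj₁ sorted) = base p sorted
    case p rec (inj₂ (i , q , raised , refl)) = step i q raised (rec q (rank-raised i q raised))

  ∣swapAt∣ : ∀ (i : Adj n) p → ∣ swapAt i p ∣ ≡ ∣ p ∣
  ∣swapAt∣ here (outside ∷ outside ∷ p) = refl
  ∣swapAt∣ here (outside ∷ inside ∷ p)  = refl
  ∣swapAt∣ here (inside ∷ outside ∷ p)  = refl
  ∣swapAt∣ here (inside ∷ inside ∷ p)   = refl
  ∣swapAt∣ (there i) (outside ∷ p)      = ∣swapAt∣ i p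
  ∣swapAt∣ (there i) (inside ∷ p)       = cong suc (∣swapAt∣ i p)

  -- Pairs of simple reflections, and the vanishing condition

  data Consecutive : Adj n → Adj n → Set where
    here  : Consecutive {suc (suc (suc n))} here (there here)
    there : ∀ {i j : Adj n} → Consecutive i j → Consecutive (there i) (there j)

  data Far : Adj n → Adj n → Set where
    hereˡ : ∀ {j : Adj n} → Far here (there (there j))
    hereʳ : ∀ {i : Adj n} → Far (there (there i)) here
    there : ∀ {i j : Adj n} → Far i j → Far (there i) (there j)

  data Position {n} : Adj n → Adj n → Set where
    equal  : ∀ {i} → Position i i
    before : ∀ {i j} → Consecutive i j → Position i j
    after  : ∀ {i j} → Consecutive j i → Position i j
    far    : ∀ {i j} → Far i j → Position i j

  position : ∀ (i j : Adj n) → Position i j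
  position here              here              = equal
  position here              (there here)      = before here
  position here              (there (there j)) = far hereˡ
  position (there here)      here              = after here
  position (there (there i)) here              = far hereʳ
  position (there i)         (there j)         with position i j
  ... | equal    = equal
  ... | before c = before (there c)
  ... | after c  = after (there c)
  ... | far f    = far (there f)

  far-left : ∀ {i j : Adj n} → Far i j → τ i (left j) ≡ left j
  far-left hereˡ     = refl
  far-left hereʳ     = refl
  far-left (there f) = cong suc (far-left f)

  far-right : ∀ {i j : Adj n} → Far i j → τ i (right j) ≡ right j
  far-right hereˡ     = refl
  far-right hereʳ     = refl
  far-right (there f) = cong suc (far-right f)

  far-τ : ∀ {i j : Adj n} → Far i j → ∀ l → τ i (τ j l) ≡ τ j (τ i l)
  far-τ hereˡ     zero                = refl
  far-τ hereˡ     (suc zero)          = refl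
  far-τ hereˡ     (suc (suc l))       = refl
  far-τ hereʳ     zero                = refl
  far-τ hereʳ     (suc zero)          = refl
  far-τ hereʳ     (suc (suc l))       = refl
  far-τ (there f) zero                = refl
  far-τ (there f) (suc l)             = cong suc (far-τ f l)

  far-entryˡ : ∀ {i j : Adj n} → Far i j → ∀ (v : Vec 𝒜 n) → entryˡ i (swapAt j v) ≡ entryˡ i v
  far-entryˡ hereˡ     (x ∷ y ∷ v)     = refl
  far-entryˡ hereʳ     (x ∷ y ∷ v)     = refl
  far-entryˡ (there f) (x ∷ v)         = far-entryˡ f v

  far-entryʳ : ∀ {i j : Adj n} → Far i j → ∀ (v : Vec 𝒜 n) → entryʳ i (swapAt j v) ≡ entryʳ i v
  far-entryʳ hereˡ     (x ∷ y ∷ v)     = refl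
  far-entryʳ hereʳ     (x ∷ y ∷ v)     = refl
  far-entryʳ (there f) (x ∷ v)         = far-entryʳ f v

  braid : ∀ {i j : Adj n} → Consecutive i j → ∀ l → τ i (τ j (τ i l)) ≡ τ j (τ i (τ j l))
  braid here      zero                = refl
  braid here      (suc zero)          = refl
  braid here      (suc (suc zero))    = refl
  braid here      (suc (suc (suc l))) = refl
  braid (there c) zero                = refl
  braid (there c) (suc l)             = cong suc (braid c l)

  right≡left : ∀ {i j : Adj n} → Consecutive i j → right i ≡ left j
  right≡left here      = refl
  right≡left (there c) = cong suc (right≡left c)

  τ-right⁺ : ∀ {i j : Adj n} → Consecutive i j → τ i (right j) ≡ right j
  τ-right⁺ here      = refl
  τ-right⁺ (there c) = cong suc (τ-right⁺ c)

  τ-left⁻ : ∀ {i j : Adj n} → Consecutive i j → τ j (left i) ≡ left i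
  τ-left⁻ here      = refl
  τ-left⁻ (there c) = cong suc (τ-left⁻ c)

  left≢right⁺ : ∀ {i j : Adj n} → Consecutive i j → left i ≢ right j
  left≢right⁺ (there c) eq = left≢right⁺ c (Fin.suc-injective eq)

  -- Lowering at j makes the entries at i equal only if they come from a
  -- word that is raised at i as well.
  before-raised : ∀ {i j : Adj n} → Consecutive i j → ∀ q → Raised j q →
    entryˡ i (swapAt j q) ≡ entryʳ i (swapAt j q) →
    Raised i (swapAt i q) × entryˡ j (swapAt i q) ≡ entryʳ j (swapAt i q)
  before-raised here (x ∷ outside ∷ inside ∷ q) (refl , refl) refl = (refl , refl) , refl
  before-raised (there c) (x ∷ q) raised eq = before-raised c q raised eq

  after-raised : ∀ {i j : Adj n} → Consecutive j i → ∀ q → Raised j q →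
    entryˡ i (swapAt j q) ≡ entryʳ i (swapAt j q) →
    Raised i (swapAt i q) × entryˡ j (swapAt i q) ≡ entryʳ j (swapAt i q)
  after-raised here (outside ∷ inside ∷ x ∷ q) (refl , refl) refl = (refl , refl) , refl
  after-raised (there c) (x ∷ q) raised eq = after-raised c q raised eq

  -- For some m, p has more elements ≥ m than S; then G^p vanishes at the fixed
  -- point S.
  data Exceeds : Subset n → Subset n → Set where
    now   : ∀ {p S : Subset n} → ∣ S ∣ < ∣ p ∣ → Exceeds p S
    later : ∀ {x z} {p S : Subset n} → Exceeds p S → Exceeds (x ∷ p) (z ∷ S)

  exceeds-irrefl : ∀ {p : Subset n} → ¬ Exceeds p p
  exceeds-irrefl (now lt)  = ℕ.<-irrefl refl lt
  exceeds-irrefl (later e) = exceeds-irrefl e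

  exceeds-now : ∀ (i : Adj n) q S → ∣ S ∣ < ∣ swapAt i q ∣ → Exceeds q S × Exceeds q (swapAt i S)
  exceeds-now i q S lt =
    now lt′ , now (subst (_< ∣ q ∣) (sym (∣swapAt∣ i S)) lt′)
    where lt′ = subst (∣ S ∣ <_) (∣swapAt∣ i q) lt

  -- Only the threshold between the two positions notices the swap. There q has one element more
  -- than `swapAt i q`, while S gains at most one.
  exceeds-raised : ∀ (i : Adj n) q S → Raised i q → Exceeds (swapAt i q) S →
                   Exceeds q S × Exceeds q (swapAt i S)
  exceeds-raised i@here q@(outside ∷ inside ∷ _) S (refl , refl) (now lt) = exceeds-now i q S lt
  exceeds-raised here (outside ∷ inside ∷ q) (x ∷ z ∷ S) (refl , refl) (later (later e)) =
    later (later e) , later (later e)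
  exceeds-raised here (outside ∷ inside ∷ q) (x ∷ z ∷ S) (refl , refl) (later (now lt)) =
    later (now (ℕ.m<n⇒m<1+n lt)) , later (now (ℕ.≤-<-trans (cons-≤ x) (s≤s (ℕ.≤-<-trans (tail-≤ z) lt))))
    where
    tail-≤ : ∀ z → ∣ S ∣ ≤ ∣ z ∷ S ∣
    tail-≤ outside = ℕ.≤-refl
    tail-≤ inside  = ℕ.n≤1+n _
    cons-≤ : ∀ x → ∣ x ∷ S ∣ ≤ suc ∣ S ∣
    cons-≤ outside = ℕ.n≤1+n _
    cons-≤ inside  = ℕ.≤-refl
  exceeds-raised i@(there _) q@(_ ∷ _) S raised (now lt) = exceeds-now i q S lt
  exceeds-raised (there i) (y ∷ q) (x ∷ S) raised (later e)
    with e₁ , e₂ ← exceeds-raised i q S raised e = later e₁ , later e₂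

  raised-exceeds : ∀ (i : Adj n) q → Raised i q → Exceeds q (swapAt i q)
  raised-exceeds here      (outside ∷ inside ∷ q) (refl , refl) = later (now ℕ.≤-refl)
  raised-exceeds (there i) (x ∷ q)                raised        = later (raised-exceeds i q raised)

  -- Where p first differs from the initial segment q, it lacks an element of q, and so it has more
  -- elements than q afterwards.
  exceeds-descending : ∀ {q : Subset n} → Descending q → ∀ p → ∣ p ∣ ≡ ∣ q ∣ → p ≢ q → Exceeds p q
  exceeds-descending {n} allOutside p eq p≢q = contradiction (noElements p (trans eq (∣outside∣ n))) p≢q
    where
    ∣outside∣ : ∀ n → ∣ replicate n outside ∣ ≡ 0
    ∣outside∣ zero    = refl
    ∣outside∣ (suc n) = ∣outside∣ n
    noElements : ∀ {n} (p : Subset n) → ∣ p ∣ ≡ 0 → p ≡ replicate n outside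
    noElements []            eq = refl
    noElements (outside ∷ p) eq = cong (outside ∷_) (noElements p eq)
  exceeds-descending (inside∷ desc) (outside ∷ p) eq p≢q = later (now (ℕ.≤-reflexive (sym eq)))
  exceeds-descending (inside∷ desc) (inside ∷ p)  eq p≢q =
    later (exceeds-descending desc p (ℕ.suc-injective eq) (p≢q ∘ cong (inside ∷_)))

  ∣p∣<∣S∣⇒difference : ∀ (p S : Subset n) → ∣ p ∣ < ∣ S ∣ → ∃ λ j → lookup p j ≡ outside × lookup S j ≡ inside
  ∣p∣<∣S∣⇒difference (outside ∷ p) (inside ∷ S)  lt = zero , refl , refl
  ∣p∣<∣S∣⇒difference (outside ∷ p) (outside ∷ S) lt with j , e ← ∣p∣<∣S∣⇒difference p S lt = suc j , e
  ∣p∣<∣S∣⇒difference (inside ∷ p)  (outside ∷ S) lt with j , e ← ∣p∣<∣S∣⇒difference p S (ℕ.<-trans (ℕ.n<1+n _) lt) = suc j , e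
  ∣p∣<∣S∣⇒difference (inside ∷ p)  (inside ∷ S)  lt with j , e ← ∣p∣<∣S∣⇒difference p S (ℕ.s<s⁻¹ lt) = suc j , e

  ≢⇒difference : ∀ (p S : Subset n) → ∣ p ∣ ≡ ∣ S ∣ → p ≢ S → ∃ λ j → lookup p j ≡ outside × lookup S j ≡ inside
  ≢⇒difference []            []            eq ne = contradiction refl ne
  ≢⇒difference (outside ∷ p) (inside ∷ S)  eq ne = zero , refl , refl
  ≢⇒difference (outside ∷ p) (outside ∷ S) eq ne with j , e ← ≢⇒difference p S eq (ne ∘ cong (outside ∷_)) = suc j , e
  ≢⇒difference (inside ∷ p)  (inside ∷ S)  eq ne with j , e ← ≢⇒difference p S (ℕ.suc-injective eq) (ne ∘ cong (inside ∷_)) = suc j , e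
  ≢⇒difference (inside ∷ p)  (outside ∷ S) eq ne with j , e ← ∣p∣<∣S∣⇒difference p S (ℕ.≤-reflexive eq) = suc j , e

  -- Increasing enumerations of subsets

  data Enum : Subset n → Vec (Fin n) k → Set where
    []        : Enum [] []
    inside∷_  : ∀ {S : Subset n} {v : Vec (Fin n) k} → Enum S v → Enum (inside ∷ S) (zero ∷ Vec.map suc v)
    outside∷_ : ∀ {S : Subset n} {v : Vec (Fin n) k} → Enum S v → Enum (outside ∷ S) (Vec.map suc v)

  enum : ∀ (S : Subset n) → ∣ S ∣ ≡ k → ∃ λ (v : Vec (Fin n) k) → Enum S v
  enum {k = zero} []            refl = [] , []
  enum            (outside ∷ S) eq   with v , e ← enum S eq = Vec.map suc v , outside∷ e
  enum {k = suc k} (inside ∷ S) eq   with v , e ← enum S (ℕ.suc-injective eq) = zero ∷ Vec.map suc v , inside∷ e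

  ∣enum∣ : ∀ {S : Subset n} {v : Vec (Fin n) k} → Enum S v → ∣ S ∣ ≡ k
  ∣enum∣ []           = refl
  ∣enum∣ (inside∷ e)  = cong suc (∣enum∣ e)
  ∣enum∣ (outside∷ e) = ∣enum∣ e

  enum-∈ : ∀ {S : Subset n} {v : Vec (Fin n) k} → Enum S v → ∀ a → lookup S (lookup v a) ≡ inside
  enum-∈ (inside∷ e) zero = refl
  enum-∈ {v = zero ∷ _} (inside∷_ {S = S} {v} e) (suc a) = trans (cong (lookup (inside ∷ S)) (lookup-map a suc v)) (enum-∈ e a)
  enum-∈ (outside∷_ {S = S} {v} e) a = trans (cong (lookup (outside ∷ S)) (lookup-map a suc v)) (enum-∈ e a)

  enum-index : ∀ {S : Subset n} {v : Vec (Fin n) k} → Enum S v → ∀ j → lookup S j ≡ inside → ∃ λ a → lookup v a ≡ j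
  enum-index (inside∷ e)  zero    _  = zero , refl
  enum-index (inside∷_ {v = v} e)  (suc j) j∈ with a , eq ← enum-index e j j∈ = suc a , trans (lookup-map a suc v) (cong suc eq)
  enum-index (outside∷_ {v = v} e) (suc j) j∈ with a , eq ← enum-index e j j∈ = a , trans (lookup-map a suc v) (cong suc eq)

  enum-increasing : ∀ {S : Subset n} {v : Vec (Fin n) k} → Enum S v → ∀ {a b} → a Fin.< b → lookup v a Fin.< lookup v b
  enum-increasing (inside∷_ {v = v} e) {zero}  {suc b} _ = subst (λ j → 0 < toℕ j) (sym (lookup-map b suc v)) (s≤s z≤n)
  enum-increasing (inside∷_ {v = v} e) {suc a} {suc b} (s≤s a<b) =
    subst (Fin._< lookup (Vec.map suc v) b) (sym (lookup-map a suc v))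
      (subst (suc (lookup v a) Fin.<_) (sym (lookup-map b suc v)) (s≤s (enum-increasing e a<b)))
  enum-increasing (outside∷_ {v = v} e) {a} {b} a<b =
    subst (Fin._< lookup (Vec.map suc v) b) (sym (lookup-map a suc v))
      (subst (suc (lookup v a) Fin.<_) (sym (lookup-map b suc v)) (s≤s (enum-increasing e a<b)))

  increasing⇒injective : ∀ {ι : Fin k → Fin n} → (∀ {a b} → a Fin.< b → ι a Fin.< ι b) → Injective _≡_ _≡_ ι
  increasing⇒injective inc {a} {b} eq with Fin.<-cmp a b
  ... | tri< a<b _ _ = contradiction (inc a<b) (Fin.<-irrefl eq)
  ... | tri≈ _ a≡b _ = a≡b
  ... | tri> _ _ b<a = contradiction (inc b<a) (Fin.<-irrefl (sym eq))

  enum-injective : ∀ {S : Subset n} {v : Vec (Fin n) k} → Enum S v → Injective _≡_ _≡_ (lookup v)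
  enum-injective e = increasing⇒injective (enum-increasing e)

  reindex : ∀ {ι κ : Fin k → Fin n} → Injective _≡_ _≡_ ι → Injective _≡_ _≡_ κ →
    (∀ a → ∃ λ b → ι b ≡ κ a) → (∀ b → ∃ λ a → κ a ≡ ι b) →
    Σ (Permutation′ k) λ π → ∀ a → ι (π ⟨$⟩ʳ a) ≡ κ a
  reindex ι-inj κ-inj f g =
    permutation (proj₁ ∘ f) (proj₁ ∘ g)
      (λ b → ι-inj (trans (proj₂ (f _)) (proj₂ (g b))))
      (λ a → κ-inj (trans (proj₂ (g _)) (proj₂ (f a)))) ,
    proj₂ ∘ f

  enum-swapAt : ∀ (i : Adj n) {S} {v v′ : Vec (Fin n) k} → Enum S v → Enum (swapAt i S) v′ →
    Σ (Permutation′ k) λ π → ∀ a → lookup v′ (π ⟨$⟩ʳ a) ≡ τ i (lookup v a)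
  enum-swapAt i {S} {v} {v′} e e′ = reindex (enum-injective e′)
    (λ eq → enum-injective e (trans (sym (τ-involutive i _)) (trans (cong (τ i) eq) (τ-involutive i _))))
    (λ a → enum-index e′ (τ i (lookup v a)) (trans (lookup-swapAt i S _) (trans (cong (lookup S) (τ-involutive i _)) (enum-∈ e a))))
    (λ b → let (a , eq) = enum-index e (τ i (lookup v′ b)) (trans (sym (lookup-swapAt i S _)) (enum-∈ e′ b)) in
           a , trans (cong (τ i) eq) (τ-involutive i _))

  enum-reverse : ∀ {S} {v v′ : Vec (Fin n) k} → Enum S v → Enum (reverse S) v′ →
    Σ (Permutation′ k) λ π → ∀ a → lookup v′ (π ⟨$⟩ʳ a) ≡ opposite (lookup v a)
  enum-reverse {S = S} {v} {v′} e e′ = reindex (enum-injective e′)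
    (λ eq → enum-injective e (trans (sym (Fin.opposite-involutive _)) (trans (cong opposite eq) (Fin.opposite-involutive _))))
    (λ a → enum-index e′ (opposite (lookup v a)) (trans (lookup-reverse-opposite S _) (enum-∈ e a)))
    (λ b → let (a , eq) = enum-index e (opposite (lookup v′ b)) (trans (sym (lookup-reverse S _)) (enum-∈ e′ b)) in
           a , trans (cong opposite eq) (Fin.opposite-involutive _))

  image : (Fin k → Fin n) → Subset n
  image ι = tabulate λ j → does (Fin.any? λ a → ι a Fin.≟ j)

  -- Reduces values at injective specialisations, up to a permutation of the x's, to values at fixed
  -- points.
  enum-image : ∀ (ι : Fin k → Fin n) → Injective _≡_ _≡_ ι →
    ∃₂ λ S (v : Vec (Fin n) k) → Enum S v × Σ (Permutation′ k) λ π → ∀ a → lookup v (π ⟨$⟩ʳ a) ≡ ι a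
  enum-image {k} {n} ι inj =
    let (v , e) = enum S refl
        -- The first enumeration has length ∣ S ∣ by construction; comparing it with ι in both
        -- directions shows that this length is k.
        k≡∣S∣ = Fin.cantor-schröder-bernstein
          {f = λ a → proj₁ (enum-index e (ι a) (∈S a))} {g = λ b → proj₁ (S∈ _ (enum-∈ e b))}
          (λ {a} {b} eq → inj (trans (sym (proj₂ (enum-index e (ι a) (∈S a)))) (trans (cong (lookup v) eq) (proj₂ (enum-index e (ι b) (∈S b))))))
          (λ {a} {b} eq → enum-injective e (trans (sym (proj₂ (S∈ _ (enum-∈ e a)))) (trans (cong ι eq) (proj₂ (S∈ _ (enum-∈ e b))))))
        (v′ , e′) = enum S (sym k≡∣S∣)
    in S , v′ , e′ , reindex (enum-injective e′) inj (λ a → enum-index e′ (ι a) (∈S a)) (λ b → S∈ _ (enum-∈ e′ b))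
    where
    S = image ι
    ∈S : ∀ a → lookup S (ι a) ≡ inside
    ∈S a = trans (lookup∘tabulate _ (ι a)) (dec-true (Fin.any? λ b → ι b Fin.≟ ι a) (a , refl))
    S∈ : ∀ j → lookup S j ≡ inside → ∃ λ a → ι a ≡ j
    S∈ j j∈ with Fin.any? (λ a → ι a Fin.≟ j) | lookup∘tabulate (λ j → does (Fin.any? λ a → ι a Fin.≟ j)) j
    ... | yes found | _  = found
    ... | no _      | eq = contradiction (trans (sym eq) j∈) λ ()

-- Values of Grothendieck polynomials at fixed points

-- An interface to Laurent polynomials, so that the lists representing them are
-- never unfolded.
record LaurentTheory : Set₁ where
  field
    laurent : ℕ → CommutativeRing 0ℓ 0ℓ
  module R {m : ℕ} = CommutativeRing (laurent m)
  field
    Y Y⁻¹    : ∀ {m} → Fin m → R.Carrier {m}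
    Y*Y⁻¹≈1  : ∀ {m} (i : Fin m) → Y i R.* Y⁻¹ i R.≈ R.1#
    cancel   : ∀ {m} {i j : Fin m} → i ≢ j → ∀ f → (Y i R.- Y j) R.* f R.≈ R.0# → f R.≈ R.0#
    ren      : ∀ {m p} → (Fin m → Fin p) → R.Carrier {m} → R.Carrier {p}
    ren-cong : ∀ {m p} (ρ : Fin m → Fin p) {f g} → f R.≈ g → ren ρ f R.≈ ren ρ g
    ren-+    : ∀ {m p} (ρ : Fin m → Fin p) f g → ren ρ (f R.+ g) R.≈ ren ρ f R.+ ren ρ g
    ren-*    : ∀ {m p} (ρ : Fin m → Fin p) f g → ren ρ (f R.* g) R.≈ ren ρ f R.* ren ρ g
    ren-neg  : ∀ {m p} (ρ : Fin m → Fin p) f → ren ρ (R.- f) R.≈ R.- ren ρ f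
    ren-0    : ∀ {m p} (ρ : Fin m → Fin p) → ren ρ R.0# R.≈ R.0#
    ren-1    : ∀ {m p} (ρ : Fin m → Fin p) → ren ρ R.1# R.≈ R.1#
    ren-Y    : ∀ {m p} (ρ : Fin m → Fin p) i → ren ρ (Y i) R.≈ Y (ρ i)
    ren-Y⁻¹  : ∀ {m p} (ρ : Fin m → Fin p) i → ren ρ (Y⁻¹ i) R.≈ Y⁻¹ (ρ i)
    ren-∘    : ∀ {m p q} (ρ : Fin p → Fin q) (σ : Fin m → Fin p) f → ren ρ (ren σ f) R.≈ ren (ρ ∘ σ) f
    ren-≗    : ∀ {m p} {ρ σ : Fin m → Fin p} → (∀ i → ρ i ≡ σ i) → ∀ f → ren ρ f R.≈ ren σ f
    ren-id   : ∀ {m} (f : R.Carrier {m}) → ren id f R.≈ f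

module Products (R : CommutativeRing 0ℓ 0ℓ) where
  open CommutativeRing R hiding (zero)
  open import Algebra.Definitions.RawSemiring (Semiring.rawSemiring semiring) public using (product)
  open import Algebra.Properties.CommutativeMonoid.Sum *-commutativeMonoid public
    using () renaming (sum-permute to product-permute; ∑-distrib-+ to product-*)
  product-cong : {f g : Fin m → Carrier} → (∀ a → f a ≈ g a) → product f ≈ product g
  product-cong {zero}  f≈g = refl
  product-cong {suc m} f≈g = *-cong (f≈g zero) (product-cong (f≈g ∘ suc))

  product-zero : ∀ (f : Fin m → Carrier) a → f a ≈ 0# → product f ≈ 0#
  product-zero f zero    fa≈0 = trans (*-congʳ fa≈0) (zeroˡ _)
  product-zero f (suc a) fa≈0 = trans (*-congˡ (product-zero (f ∘ suc) a fa≈0)) (zeroʳ _)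

  product-one : ∀ {f : Fin m → Carrier} → (∀ a → f a ≈ 1#) → product f ≈ 1#
  product-one {zero}  f≈1 = refl
  product-one {suc m} f≈1 = trans (*-cong (f≈1 zero) (product-one (f≈1 ∘ suc))) (*-identityˡ 1#)

  -- One row of the product that defines G for the full rectangle. As a product over the complement
  -- of the frame, it shows at once how `τ i` permutes the factors.
  outsideProduct : Subset m → (Fin m → Carrier) → Carrier
  outsideProduct []            f = 1#
  outsideProduct (outside ∷ p) f = f zero * outsideProduct p (f ∘ suc)
  outsideProduct (inside ∷ p)  f = outsideProduct p (f ∘ suc)

  outsideProduct-cong : ∀ (p : Subset m) {f g} → (∀ j → f j ≈ g j) → outsideProduct p f ≈ outsideProduct p g
  outsideProduct-cong []            f≈g = refl
  outsideProduct-cong (outside ∷ p) f≈g = *-cong (f≈g zero) (outsideProduct-cong p (f≈g ∘ suc))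
  outsideProduct-cong (inside ∷ p)  f≈g = outsideProduct-cong p (f≈g ∘ suc)

  outsideProduct-zero : ∀ (p : Subset m) f j → lookup p j ≡ outside → f j ≈ 0# → outsideProduct p f ≈ 0#
  outsideProduct-zero (outside ∷ p) f zero    _   fj≈0 = trans (*-congʳ fj≈0) (zeroˡ _)
  outsideProduct-zero (outside ∷ p) f (suc j) j∉p fj≈0 =
    trans (*-congˡ (outsideProduct-zero p (f ∘ suc) j j∉p fj≈0)) (zeroʳ _)
  outsideProduct-zero (inside ∷ p)  f (suc j) j∉p fj≈0 = outsideProduct-zero p (f ∘ suc) j j∉p fj≈0

  outsideProduct-τ : ∀ (i : Adj m) p f → outsideProduct p (f ∘ τ i) ≈ outsideProduct (swapAt i p) f
  outsideProduct-τ here (outside ∷ outside ∷ p) f =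
    trans (sym (*-assoc _ _ _)) (trans (*-congʳ (*-comm _ _)) (*-assoc _ _ _))
  outsideProduct-τ here (outside ∷ inside ∷ p)  f = refl
  outsideProduct-τ here (inside ∷ outside ∷ p)  f = refl
  outsideProduct-τ here (inside ∷ inside ∷ p)   f = refl
  outsideProduct-τ (there i) (outside ∷ p) f = *-congˡ (outsideProduct-τ i p (f ∘ suc))
  outsideProduct-τ (there i) (inside ∷ p)  f = outsideProduct-τ i p (f ∘ suc)

  outsideProduct-allInside : ∀ m f → outsideProduct (replicate m inside) f ≈ 1#
  outsideProduct-allInside zero    f = refl
  outsideProduct-allInside (suc m) f = outsideProduct-allInside m (f ∘ suc)

module Renaming (𝓛 : LaurentTheory) where
  open LaurentTheory 𝓛

  ren-sub : ∀ {m p} (ρ : Fin m → Fin p) f g → ren ρ (f R.- g) R.≈ ren ρ f R.- ren ρ g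
  ren-sub ρ f g = R.trans (ren-+ ρ f (R.- g)) (R.+-congˡ (ren-neg ρ g))

  ren-product : ∀ {m p} (ρ : Fin m → Fin p) {l} (f : Fin l → R.Carrier) →
    ren ρ (Products.product (laurent m) f) R.≈ Products.product (laurent p) (ren ρ ∘ f)
  ren-product ρ {zero}  f = ren-1 ρ
  ren-product ρ {suc l} f = R.trans (ren-* ρ _ _) (R.*-congˡ (ren-product ρ (f ∘ suc)))

  ren-∑ : ∀ {m p} (ρ : Fin m → Fin p) {A : Set} (xs : List A) f →
    ren ρ (RingTools.∑ (laurent m) xs f) R.≈ RingTools.∑ (laurent p) xs (ren ρ ∘ f)
  ren-∑ ρ []       f = ren-0 ρ
  ren-∑ ρ (x ∷ xs) f = R.trans (ren-+ ρ _ _) (R.+-congˡ (ren-∑ ρ xs f))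

-- The braid relation without division

module BraidAlgebra (R : CommutativeRing 0ℓ 0ℓ) where
  open CommutativeRing R hiding (zero)
  open RingTools R hiding (∑)
  open import Relation.Binary.Reasoning.Setoid setoid

  -- The two ways of computing D_j D_i f when s_j f = f; F and B stand for
  -- s_i f and s_j s_i f, and s for the action of s_i.
  braid-before : ∀ {a b c f F B g g′ h sg sg′ sh} →
    (a - b) * g ≈ a * f - b * F → (a - c) * g′ ≈ a * f - c * B → (b - c) * h ≈ b * g - c * g′ →
    (b - a) * sg ≈ b * F - a * f → (b - c) * sg′ ≈ b * F - c * B → (a - c) * sh ≈ a * sg - c * sg′ →
    (a - b) * ((a - c) * ((b - c) * h)) ≈ (a - b) * ((a - c) * ((b - c) * sh))
  braid-before {a} {b} {c} {f} {F} {B} {g} {g′} {h} {sg} {sg′} {sh} e₁ e₂ e₃ e₄ e₅ e₆ = begin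
    (a - b) * ((a - c) * ((b - c) * h))
      ≈⟨ *-congˡ (*-congˡ e₃) ⟩
    (a - b) * ((a - c) * (b * g - c * g′))
      ≈⟨ solve 5 (λ a b c g g′ → (a :- b) :* ((a :- c) :* (b :* g :- c :* g′)) :=
           b :* (a :- c) :* ((a :- b) :* g) :- c :* (a :- b) :* ((a :- c) :* g′)) refl a b c g g′ ⟩
    b * (a - c) * ((a - b) * g) - c * (a - b) * ((a - c) * g′)
      ≈⟨ +-cong (*-congˡ e₁) (-‿cong (*-congˡ e₂)) ⟩
    b * (a - c) * (a * f - b * F) - c * (a - b) * (a * f - c * B)
      ≈⟨ solve 6 (λ a b c f F B →
           b :* (a :- c) :* (a :* f :- b :* F) :- c :* (a :- b) :* (a :* f :- c :* B) :=
           :- (a :* (b :- c)) :* (b :* F :- a :* f) :- c :* (a :- b) :* (b :* F :- c :* B)) refl a b c f F B ⟩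
    - (a * (b - c)) * (b * F - a * f) - c * (a - b) * (b * F - c * B)
      ≈⟨ +-cong (*-congˡ e₄) (-‿cong (*-congˡ e₅)) ⟨
    - (a * (b - c)) * ((b - a) * sg) - c * (a - b) * ((b - c) * sg′)
      ≈⟨ solve 5 (λ a b c g g′ → (a :- b) :* ((b :- c) :* (a :* g :- c :* g′)) :=
           :- (a :* (b :- c)) :* ((b :- a) :* g) :- c :* (a :- b) :* ((b :- c) :* g′)) refl a b c sg sg′ ⟨
    (a - b) * ((b - c) * (a * sg - c * sg′))
      ≈⟨ *-congˡ (*-congˡ e₆) ⟨
    (a - b) * ((b - c) * ((a - c) * sh))
      ≈⟨ solve 3 (λ x u v → x :* (u :* v) := x :* (v :* u)) refl (a - b) (b - c) ((a - c) * sh) ⟩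
    (a - b) * (((a - c) * sh) * (b - c))
      ≈⟨ solve 4 (λ x u v s → x :* ((u :* s) :* v) := x :* (u :* (v :* s))) refl (a - b) (a - c) (b - c) sh ⟩
    (a - b) * ((a - c) * ((b - c) * sh)) ∎

  braid-after : ∀ {a b c f F B g g′ h sg sg′ sh} →
    (b - c) * g ≈ b * f - c * F → (a - c) * g′ ≈ a * f - c * B → (a - b) * h ≈ a * g - b * g′ →
    (c - b) * sg ≈ c * F - b * f → (a - b) * sg′ ≈ a * F - b * B → (a - c) * sh ≈ a * sg - c * sg′ →
    (a - b) * ((a - c) * ((b - c) * h)) ≈ (a - b) * ((a - c) * ((b - c) * sh))
  braid-after {a} {b} {c} {f} {F} {B} {g} {g′} {h} {sg} {sg′} {sh} e₁ e₂ e₃ e₄ e₅ e₆ = begin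
    (a - b) * ((a - c) * ((b - c) * h))
      ≈⟨ solve 4 (λ x u v s → x :* (u :* (v :* s)) := u :* (v :* (x :* s))) refl (a - b) (a - c) (b - c) h ⟩
    (a - c) * ((b - c) * ((a - b) * h))
      ≈⟨ *-congˡ (*-congˡ e₃) ⟩
    (a - c) * ((b - c) * (a * g - b * g′))
      ≈⟨ solve 5 (λ a b c g g′ → (a :- c) :* ((b :- c) :* (a :* g :- b :* g′)) :=
           a :* (a :- c) :* ((b :- c) :* g) :- b :* (b :- c) :* ((a :- c) :* g′)) refl a b c g g′ ⟩
    a * (a - c) * ((b - c) * g) - b * (b - c) * ((a - c) * g′)
      ≈⟨ +-cong (*-congˡ e₁) (-‿cong (*-congˡ e₂)) ⟩
    a * (a - c) * (b * f - c * F) - b * (b - c) * (a * f - c * B)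
      ≈⟨ solve 6 (λ a b c f F B →
           a :* (a :- c) :* (b :* f :- c :* F) :- b :* (b :- c) :* (a :* f :- c :* B) :=
           :- (a :* (a :- b)) :* (c :* F :- b :* f) :- c :* (b :- c) :* (a :* F :- b :* B)) refl a b c f F B ⟩
    - (a * (a - b)) * (c * F - b * f) - c * (b - c) * (a * F - b * B)
      ≈⟨ +-cong (*-congˡ e₄) (-‿cong (*-congˡ e₅)) ⟨
    - (a * (a - b)) * ((c - b) * sg) - c * (b - c) * ((a - b) * sg′)
      ≈⟨ solve 5 (λ a b c g g′ → (a :- b) :* ((b :- c) :* (a :* g :- c :* g′)) :=
           :- (a :* (a :- b)) :* ((c :- b) :* g) :- c :* (b :- c) :* ((a :- b) :* g′)) refl a b c sg sg′ ⟨
    (a - b) * ((b - c) * (a * sg - c * sg′))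
      ≈⟨ *-congˡ (*-congˡ e₆) ⟨
    (a - b) * ((b - c) * ((a - c) * sh))
      ≈⟨ solve 4 (λ x u v s → x :* (v :* (u :* s)) := x :* (u :* (v :* s))) refl (a - b) (a - c) (b - c) sh ⟩
    (a - b) * ((a - c) * ((b - c) * sh)) ∎

-- The action of the simple reflections on values

module Localised (𝓛 : LaurentTheory) (n k : ℕ) where
  open LaurentTheory 𝓛
  open Renaming 𝓛
  open CommutativeRing (laurent n) hiding (zero)
  open RingTools (laurent n) hiding (∑; ⟦_⟧)
  open Amplitude (laurent n) (Fin n) Y Y⁻¹ Y*Y⁻¹≈1
  open Products (laurent n)
  open import Algebra.Properties.Group +-group using (x∙y⁻¹≈ε⇒x≈y)
  open import Relation.Binary.Reasoning.Setoid setoid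

  cancel-≈ : ∀ {i j} → i ≢ j → ∀ {f g} → (Y i - Y j) * f ≈ (Y i - Y j) * g → f ≈ g
  cancel-≈ {i} {j} i≢j {f} {g} eq = x∙y⁻¹≈ε⇒x≈y f g (cancel i≢j (f - g) (begin
    (Y i - Y j) * (f - g)                 ≈⟨ solve 3 (λ c f g → c :* (f :- g) := c :* f :- c :* g) refl (Y i - Y j) f g ⟩
    (Y i - Y j) * f - (Y i - Y j) * g     ≈⟨ +-congʳ eq ⟩
    (Y i - Y j) * g - (Y i - Y j) * g     ≈⟨ -‿inverseʳ _ ⟩
    0#                                    ∎))

  Values : Set
  Values = (Fin k → Fin n) → Carrier

  -- Replaces function extensionality for the specialisations of x.
  Ext : Values → Set
  Ext F = ∀ {ι κ} → (∀ a → ι a ≡ κ a) → F ι ≈ F κ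

  -- The action of the i-th simple reflection on y, seen on the values at all
  -- specialisations of x.
  s : Adj n → Values → Values
  s i F ι = ren (τ i) (F (τ i ∘ ι))

  s-cong : ∀ i {F G : Values} → (∀ ι → F ι ≈ G ι) → ∀ ι → s i F ι ≈ s i G ι
  s-cong i F≈G ι = ren-cong (τ i) (F≈G (τ i ∘ ι))

  s-involutive : ∀ i {F} → Ext F → ∀ ι → s i (s i F) ι ≈ F ι
  s-involutive i {F} F-ext ι = begin
    ren (τ i) (ren (τ i) (F (τ i ∘ τ i ∘ ι)))  ≈⟨ ren-∘ (τ i) (τ i) _ ⟩
    ren (τ i ∘ τ i) (F (τ i ∘ τ i ∘ ι))        ≈⟨ ren-≗ (τ-involutive i) _ ⟩
    ren id (F (τ i ∘ τ i ∘ ι))                 ≈⟨ ren-id _ ⟩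
    F (τ i ∘ τ i ∘ ι)                          ≈⟨ F-ext (λ a → τ-involutive i (ι a)) ⟩
    F ι                                        ∎

  s-far : ∀ {i j} → Far i j → ∀ {F} → Ext F → ∀ ι → s i (s j F) ι ≈ s j (s i F) ι
  s-far {i} {j} f {F} F-ext ι = begin
    ren (τ i) (ren (τ j) (F (τ j ∘ τ i ∘ ι)))  ≈⟨ ren-∘ (τ i) (τ j) _ ⟩
    ren (τ i ∘ τ j) (F (τ j ∘ τ i ∘ ι))        ≈⟨ ren-≗ (far-τ f) _ ⟩
    ren (τ j ∘ τ i) (F (τ j ∘ τ i ∘ ι))        ≈⟨ ren-cong (τ j ∘ τ i) (F-ext λ a → ≡.sym (far-τ f (ι a))) ⟩
    ren (τ j ∘ τ i) (F (τ i ∘ τ j ∘ ι))        ≈⟨ ren-∘ (τ j) (τ i) _ ⟨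
    ren (τ j) (ren (τ i) (F (τ i ∘ τ j ∘ ι)))  ∎

  s-braid : ∀ {i j} → (∀ l → τ i (τ j (τ i l)) ≡ τ j (τ i (τ j l))) →
            ∀ {F} → Ext F → ∀ ι → s i (s j (s i F)) ι ≈ s j (s i (s j F)) ι
  s-braid {i} {j} br {F} F-ext ι = begin
    ren (τ i) (ren (τ j) (ren (τ i) (F ι₁)))  ≈⟨ ren-cong (τ i) (ren-∘ (τ j) (τ i) _) ⟩
    ren (τ i) (ren (τ j ∘ τ i) (F ι₁))        ≈⟨ ren-∘ (τ i) (τ j ∘ τ i) _ ⟩
    ren (τ i ∘ τ j ∘ τ i) (F ι₁)              ≈⟨ ren-≗ br _ ⟩
    ren (τ j ∘ τ i ∘ τ j) (F ι₁)              ≈⟨ ren-cong (τ j ∘ τ i ∘ τ j) (F-ext λ a → br (ι a)) ⟩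
    ren (τ j ∘ τ i ∘ τ j) (F ι₂)              ≈⟨ ren-∘ (τ j) (τ i ∘ τ j) _ ⟨
    ren (τ j) (ren (τ i ∘ τ j) (F ι₂))        ≈⟨ ren-cong (τ j) (ren-∘ (τ i) (τ j) _) ⟨
    ren (τ j) (ren (τ i) (ren (τ j) (F ι₂)))  ∎
    where
    ι₁ = τ i ∘ τ j ∘ τ i ∘ ι
    ι₂ = τ j ∘ τ i ∘ τ j ∘ ι

  s-relation : ∀ i {F G H : Values} {a b a′ b′ : Fin n} → τ i a ≡ a′ → τ i b ≡ b′ →
    (∀ ι → (Y a - Y b) * F ι ≈ Y a * G ι - Y b * H ι) →
    ∀ ι → (Y a′ - Y b′) * s i F ι ≈ Y a′ * s i G ι - Y b′ * s i H ι
  s-relation i {F} {G} {H} {a} {b} ≡.refl ≡.refl rel ι = begin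
    (Y (τ i a) - Y (τ i b)) * s i F ι
      ≈⟨ *-congʳ (trans (ren-sub (τ i) (Y a) (Y b)) (+-cong (ren-Y (τ i) a) (-‿cong (ren-Y (τ i) b)))) ⟨
    ren (τ i) (Y a - Y b) * s i F ι
      ≈⟨ ren-* (τ i) (Y a - Y b) _ ⟨
    ren (τ i) ((Y a - Y b) * F (τ i ∘ ι))
      ≈⟨ ren-cong (τ i) (rel (τ i ∘ ι)) ⟩
    ren (τ i) (Y a * G (τ i ∘ ι) - Y b * H (τ i ∘ ι))
      ≈⟨ ren-sub (τ i) _ _ ⟩
    ren (τ i) (Y a * G (τ i ∘ ι)) - ren (τ i) (Y b * H (τ i ∘ ι))
      ≈⟨ +-cong (trans (ren-* (τ i) (Y a) _) (*-congʳ (ren-Y (τ i) a)))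
                (-‿cong (trans (ren-* (τ i) (Y b) _) (*-congʳ (ren-Y (τ i) b)))) ⟩
    Y (τ i a) * s i G ι - Y (τ i b) * s i H ι ∎

  ren-w : ∀ (ρ : Fin n → Fin n) i j → ren ρ (w i j) ≈ w (ρ i) (ρ j)
  ren-w ρ i j = trans (ren-* ρ (Y i) (Y⁻¹ j)) (*-cong (ren-Y ρ i) (ren-Y⁻¹ ρ j))

  ren-1-w : ∀ (ρ : Fin n → Fin n) i j → ren ρ (1# - w i j) ≈ 1# - w (ρ i) (ρ j)
  ren-1-w ρ i j = trans (ren-sub ρ 1# (w i j)) (+-cong (ren-1 ρ) (-‿cong (ren-w ρ i j)))

  ren-outsideProduct : ∀ (ρ : Fin n → Fin n) {m} (p : Subset m) f →
    ren ρ (outsideProduct p f) ≈ outsideProduct p (ren ρ ∘ f)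
  ren-outsideProduct ρ []            f = ren-1 ρ
  ren-outsideProduct ρ (outside ∷ p) f = trans (ren-* ρ _ _) (*-congˡ (ren-outsideProduct ρ p (f ∘ suc)))
  ren-outsideProduct ρ (inside ∷ p)  f = ren-outsideProduct ρ p (f ∘ suc)

  column : ∀ {m} → Fin n → Vec (Fin n) m → Subset m → Carrier
  column j []       []            = 1#
  column j (i ∷ ys) (inside ∷ p)  = (1# - w i j) * column j ys p
  column j (i ∷ ys) (outside ∷ p) = column j ys p

  -- The value of G^p at the fixed point p.
  diagonal : ∀ {m} → Vec (Fin n) m → Subset m → Carrier
  diagonal []       []            = 1#
  diagonal (j ∷ ys) (inside ∷ p)  = diagonal ys p
  diagonal (j ∷ ys) (outside ∷ p) = column j ys p * diagonal ys p

  ren-column : ∀ (ρ : Fin n → Fin n) {m} j (ys : Vec (Fin n) m) p →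
    ren ρ (column j ys p) ≈ column (ρ j) (Vec.map ρ ys) p
  ren-column ρ j []       []            = ren-1 ρ
  ren-column ρ j (i ∷ ys) (inside ∷ p)  = trans (ren-* ρ _ _) (*-cong (ren-1-w ρ i j) (ren-column ρ j ys p))
  ren-column ρ j (i ∷ ys) (outside ∷ p) = ren-column ρ j ys p

  ren-diagonal : ∀ (ρ : Fin n → Fin n) {m} (ys : Vec (Fin n) m) p →
    ren ρ (diagonal ys p) ≈ diagonal (Vec.map ρ ys) p
  ren-diagonal ρ []       []            = ren-1 ρ
  ren-diagonal ρ (j ∷ ys) (inside ∷ p)  = ren-diagonal ρ ys p
  ren-diagonal ρ (j ∷ ys) (outside ∷ p) = trans (ren-* ρ _ _) (*-cong (ren-column ρ j ys p) (ren-diagonal ρ ys p))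

  column-swapAt : ∀ {m} (i : Adj m) j ys p → column j ys (swapAt i p) ≈ column j (swapAt i ys) p
  column-swapAt here j (a ∷ b ∷ ys) (inside ∷ inside ∷ p)   =
    solve 3 (λ x z c → x :* (z :* c) := z :* (x :* c)) refl _ _ _
  column-swapAt here j (a ∷ b ∷ ys) (inside ∷ outside ∷ p)  = refl
  column-swapAt here j (a ∷ b ∷ ys) (outside ∷ inside ∷ p)  = refl
  column-swapAt here j (a ∷ b ∷ ys) (outside ∷ outside ∷ p) = refl
  column-swapAt (there i) j (a ∷ ys) (inside ∷ p)  = *-congˡ (column-swapAt i j ys p)
  column-swapAt (there i) j (a ∷ ys) (outside ∷ p) = column-swapAt i j ys p

  -- The factors run over a non-element and a later element. The swap creates or removes just the
  -- factor of the two exchanged positions.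
  diagonal-swapAt : ∀ {m} (i : Adj m) ys q → Raised i q →
    (1# - w (entryˡ i ys) (entryʳ i ys)) * diagonal ys (swapAt i q) ≈ diagonal (swapAt i ys) q
  diagonal-swapAt here (a ∷ b ∷ ys) (outside ∷ inside ∷ q) (≡.refl , ≡.refl) = sym (*-assoc _ _ _)
  diagonal-swapAt (there i) (a ∷ ys) (inside ∷ q)  raised = diagonal-swapAt i ys q raised
  diagonal-swapAt (there i) (a ∷ ys) (outside ∷ q) raised = begin
    (1# - w (entryˡ i ys) (entryʳ i ys)) * (column a ys (swapAt i q) * diagonal ys (swapAt i q))
      ≈⟨ solve 3 (λ x c d → x :* (c :* d) := c :* (x :* d)) refl _ _ _ ⟩
    column a ys (swapAt i q) * ((1# - w (entryˡ i ys) (entryʳ i ys)) * diagonal ys (swapAt i q))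
      ≈⟨ *-cong (column-swapAt i a ys q) (diagonal-swapAt i ys q raised) ⟩
    column a (swapAt i ys) q * diagonal (swapAt i ys) q ∎

  diagonal-descending : ∀ {m} (ys : Vec (Fin n) m) {q} → Descending q → diagonal ys q ≈ 1#
  diagonal-descending []       allOutside     = refl
  diagonal-descending (j ∷ ys) allOutside     = trans (*-cong (column-1 ys) (diagonal-descending ys allOutside)) (*-identityˡ 1#)
    where
    column-1 : ∀ {m} (ys : Vec (Fin n) m) → column j ys (replicate m outside) ≈ 1#
    column-1 []       = refl
    column-1 (i ∷ ys) = column-1 ys
  diagonal-descending (j ∷ ys) (inside∷ desc) = diagonal-descending ys desc

  column-enum : ∀ {m l} {p : Subset m} {v : Vec (Fin m) l} → Enum p v → ∀ (lab : Fin m → Fin n) j →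
    product (λ a → 1# - w (lab (lookup v a)) j) ≈ column j (tabulate lab) p
  column-enum []                     lab j = refl
  column-enum (inside∷_ {v = v} e)  lab j = *-congˡ (trans
    (product-cong λ a → reflexive (≡.cong (λ x → 1# - w (lab x) j) (lookup-map a suc v)))
    (column-enum e (lab ∘ suc) j))
  column-enum (outside∷_ {v = v} e) lab j = trans
    (product-cong λ a → reflexive (≡.cong (λ x → 1# - w (lab x) j) (lookup-map a suc v)))
    (column-enum e (lab ∘ suc) j)

  -- In a sorted word every element comes after every non-element, so the full product has no
  -- factors besides those of `diagonal`.
  diagonal-sorted : ∀ {m l} {p : Subset m} {v : Vec (Fin m) l} → Sorted p → Enum p v → ∀ (lab : Fin m → Fin n) →
    product (λ a → outsideProduct p (λ j → 1# - w (lab (lookup v a)) (lab j))) ≈ diagonal (tabulate lab) p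
  diagonal-sorted {m} {v = v} allInside e lab =
    trans (product-one λ a → outsideProduct-allInside m λ j → 1# - w (lab (lookup v a)) (lab j)) (sym (diagonal-1 m lab))
    where
    diagonal-1 : ∀ m (lab : Fin m → Fin n) → diagonal (tabulate lab) (replicate m inside) ≈ 1#
    diagonal-1 zero    lab = refl
    diagonal-1 (suc m) lab = diagonal-1 m (lab ∘ suc)
  diagonal-sorted (outside∷_ {p = p} sorted) (outside∷_ {v = v} e) lab = begin
    product (λ a → outsideProduct (outside ∷ p) (λ j → 1# - w (lab (lookup (Vec.map suc v) a)) (lab j)))
      ≈⟨ product-cong (λ a → reflexive (≡.cong (λ x → outsideProduct (outside ∷ p) (λ j → 1# - w (lab x) (lab j))) (lookup-map a suc v))) ⟩
    product (λ a → (1# - w (lab (suc (lookup v a))) (lab zero)) *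
                   outsideProduct p (λ j → 1# - w (lab (suc (lookup v a))) (lab (suc j))))
      ≈⟨ product-* (λ a → 1# - w (lab (suc (lookup v a))) (lab zero))
                   (λ a → outsideProduct p (λ j → 1# - w (lab (suc (lookup v a))) (lab (suc j)))) ⟩
    product (λ a → 1# - w (lab (suc (lookup v a))) (lab zero)) *
    product (λ a → outsideProduct p (λ j → 1# - w (lab (suc (lookup v a))) (lab (suc j))))
      ≈⟨ *-cong (column-enum e (lab ∘ suc) (lab zero)) (diagonal-sorted sorted e (lab ∘ suc)) ⟩
    column (lab zero) (tabulate (lab ∘ suc)) p * diagonal (tabulate (lab ∘ suc)) p ∎

-- Exchange relations and fixed-point values of the polynomials G

module Family (𝓛 : LaurentTheory) (n k : ℕ)
  (g : Subset n → (Fin k → Fin n) → CommutativeRing.Carrier (LaurentTheory.laurent 𝓛 n)) where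
  open LaurentTheory 𝓛
  open Renaming 𝓛
  open CommutativeRing (laurent n) hiding (zero)
  open RingTools (laurent n) hiding (∑; ⟦_⟧)
  open Local (laurent n)
  open Amplitude (laurent n) (Fin n) Y Y⁻¹ Y*Y⁻¹≈1
  open Products (laurent n)
  open BraidAlgebra (laurent n)
  open Localised 𝓛 n k
  open import Relation.Binary.Reasoning.Setoid setoid

  -- Indexed by all subsets, with the value 0 for those of the wrong size. Swaps and sums then need
  -- no proofs about sizes.
  record IsGrothendieckFamily : Set where
    field
      g-ext   : ∀ p → Ext (g p)
      g-out   : ∀ p → ∣ p ∣ ≢ k → ∀ ι → g p ι ≈ 0#
      g-full  : ∀ p → Sorted p → ∣ p ∣ ≡ k → ∀ ι →
                g p ι ≈ product λ a → outsideProduct p λ j → 1# - w (ι a) j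
      g-lower : ∀ i q → Raised i q → ∀ ι →
                (Y (left i) - Y (right i)) * g (swapAt i q) ι ≈ Y (left i) * g q ι - Y (right i) * s i (g q) ι

  module Properties (isFamily : IsGrothendieckFamily) where
    open IsGrothendieckFamily isFamily

    base : ∀ {P : Subset n → Set} →
           (∀ p → (∀ ι → g p ι ≈ 0#) → P p) →
           (∀ p → Sorted p → ∣ p ∣ ≡ k → P p) → ∀ p → Sorted p → P p
    base zeroCase fullCase p sorted with ∣ p ∣ ℕ.≟ k
    ... | yes eq = fullCase p sorted eq
    ... | no ne  = zeroCase p (g-out p ne)

    g-permute : ∀ p ι (π : Permutation′ k) → g p (ι ∘ (π ⟨$⟩ʳ_)) ≈ g p ι
    g-permute p ι π = lowering-rec (λ p → ∀ ι → g p (ι ∘ (π ⟨$⟩ʳ_)) ≈ g p ι)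
      (base (λ p g≈0 ι → trans (g≈0 _) (sym (g≈0 ι)))
        λ p sorted eq ι → trans (g-full p sorted eq _)
          (trans (sym (product-permute (λ a → outsideProduct p λ j → 1# - w (ι a) j) π)) (sym (g-full p sorted eq ι))))
      (λ i q raised rec ι → cancel-≈ (left≢right i) (begin
        (Y (left i) - Y (right i)) * g (swapAt i q) (ι ∘ (π ⟨$⟩ʳ_))
          ≈⟨ g-lower i q raised _ ⟩
        Y (left i) * g q (ι ∘ (π ⟨$⟩ʳ_)) - Y (right i) * s i (g q) (ι ∘ (π ⟨$⟩ʳ_))
          ≈⟨ +-cong (*-congˡ (rec ι)) (-‿cong (*-congˡ (ren-cong (τ i) (rec (τ i ∘ ι))))) ⟩
        Y (left i) * g q ι - Y (right i) * s i (g q) ι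
          ≈⟨ g-lower i q raised ι ⟨
        (Y (left i) - Y (right i)) * g (swapAt i q) ι ∎))
      p ι

    -- In the quotient that defines D_i, numerator and denominator both change sign under the
    -- reflection.
    s-lowered : ∀ i q → Raised i q → ∀ ι → s i (g (swapAt i q)) ι ≈ g (swapAt i q) ι
    s-lowered i q raised ι = cancel-≈ (left≢right i ∘ ≡.sym) (begin
      (Y (right i) - Y (left i)) * s i (g (swapAt i q)) ι
        ≈⟨ s-relation i (τ-left i) (τ-right i) (g-lower i q raised) ι ⟩
      Y (right i) * s i (g q) ι - Y (left i) * s i (s i (g q)) ι
        ≈⟨ +-congˡ (-‿cong (*-congˡ (s-involutive i (g-ext q) ι))) ⟩
      Y (right i) * s i (g q) ι - Y (left i) * g q ι
        ≈⟨ solve 4 (λ l r x z → r :* x :- l :* z := :- (l :* z :- r :* x)) refl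
             (Y (left i)) (Y (right i)) (s i (g q) ι) (g q ι) ⟩
      - (Y (left i) * g q ι - Y (right i) * s i (g q) ι)
        ≈⟨ -‿cong (g-lower i q raised ι) ⟨
      - ((Y (left i) - Y (right i)) * g (swapAt i q) ι)
        ≈⟨ solve 3 (λ l r x → :- ((l :- r) :* x) := (r :- l) :* x) refl (Y (left i)) (Y (right i)) _ ⟩
      (Y (right i) - Y (left i)) * g (swapAt i q) ι ∎)

    SymmetricAt : Subset n → Set
    SymmetricAt p = ∀ i → entryˡ i p ≡ entryʳ i p → ∀ ι → s i (g p) ι ≈ g p ι

    -- Since i and i+1 are both in p or both outside, the reflection permutes the columns j ∉ p of
    -- the product.
    symmetric-sorted : ∀ p → Sorted p → SymmetricAt p
    symmetric-sorted = base (λ p g≈0 i _ ι → trans (ren-cong (τ i) (g≈0 _)) (trans (ren-0 (τ i)) (sym (g≈0 ι))))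
      λ p sorted eq i same ι → begin
        ren (τ i) (g p (τ i ∘ ι))
          ≈⟨ ren-cong (τ i) (g-full p sorted eq _) ⟩
        ren (τ i) (product λ a → outsideProduct p λ j → 1# - w (τ i (ι a)) j)
          ≈⟨ ren-product (τ i) (λ a → outsideProduct p λ j → 1# - w (τ i (ι a)) j) ⟩
        product (λ a → ren (τ i) (outsideProduct p λ j → 1# - w (τ i (ι a)) j))
          ≈⟨ product-cong (λ a → begin
               ren (τ i) (outsideProduct p λ j → 1# - w (τ i (ι a)) j)
                 ≈⟨ ren-outsideProduct (τ i) p (λ j → 1# - w (τ i (ι a)) j) ⟩
               outsideProduct p (λ j → ren (τ i) (1# - w (τ i (ι a)) j))
                 ≈⟨ outsideProduct-cong p (λ j → trans (ren-1-w (τ i) (τ i (ι a)) j)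
                      (reflexive (≡.cong (λ x → 1# - w x (τ i j)) (τ-involutive i (ι a))))) ⟩
               outsideProduct p (λ j → 1# - w (ι a) (τ i j))
                 ≈⟨ outsideProduct-τ i p (λ j → 1# - w (ι a) j) ⟩
               outsideProduct (swapAt i p) (λ j → 1# - w (ι a) j)
                 ≡⟨ ≡.cong (λ p → outsideProduct p (λ j → 1# - w (ι a) j)) (swapAt-equal i p same) ⟩
               outsideProduct p (λ j → 1# - w (ι a) j) ∎) ⟩
        product (λ a → outsideProduct p λ j → 1# - w (ι a) j)
          ≈⟨ g-full p sorted eq ι ⟨
        g p ι ∎

    unlower : ∀ i q → Raised i (swapAt i q) → ∀ ι →
      (Y (left i) - Y (right i)) * g q ι ≈ Y (left i) * g (swapAt i q) ι - Y (right i) * s i (g (swapAt i q)) ι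
    unlower i q raised ι = trans
      (*-congˡ (reflexive (≡.cong (λ p → g p ι) (≡.sym (swapAt-involutive i q)))))
      (g-lower i (swapAt i q) raised ι)

    module _ (i j : Adj n) (q : Subset n) (raised-j : Raised j q) (raised-i : Raised i (swapAt i q))
             (f-symmetric : ∀ ι → s j (g (swapAt i q)) ι ≈ g (swapAt i q) ι) where
      private
        f = g (swapAt i q)
        F = s i f
        B = s j F
        h = g (swapAt j q)

      module _ (br : ∀ l → τ i (τ j (τ i l)) ≡ τ j (τ i (τ j l))) where
        s-B : ∀ ι → s i B ι ≈ B ι
        s-B ι = trans (s-braid br (g-ext (swapAt i q)) ι) (s-cong j (s-cong i f-symmetric) ι)

        s-F : ∀ ι → s i F ι ≈ f ι
        s-F = s-involutive i (g-ext (swapAt i q))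

      s-q : ∀ {b c} → τ j (left i) ≡ b → τ j (right i) ≡ c → ∀ ι → (Y b - Y c) * s j (g q) ι ≈ Y b * f ι - Y c * B ι
      s-q b≡ c≡ ι = trans (s-relation j b≡ c≡ (unlower i q raised-i) ι) (+-congʳ (*-congˡ (f-symmetric ι)))

      -- Here f is invariant under s_j, so D_j f = f. By the braid relation h = D_j D_i f = D_j D_i
      -- D_j f = D_i D_j D_i f, and everything in the image of D_i is invariant under s_i.
      -- `braid-before` is this argument multiplied by the three denominators.
      symmetric-before : Consecutive i j → ∀ ι → s i h ι ≈ h ι
      symmetric-before c ι = sym (cancel-≈ (left≢right i) (cancel-≈ (left≢right⁺ c) (cancel-≈ (left≢right j) (begin
        (Y lj - Y rj) * ((Y li - Y rj) * ((Y li - Y ri) * h ι))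
          ≈⟨ reorder (h ι) ⟩
        (Y li - Y ri) * ((Y li - Y rj) * ((Y ri - Y rj) * h ι))
          ≈⟨ braid-before (unlower i q raised-i ι) (e₂ ι) (e₃ ι)
               (trans (s-relation i (τ-left i) (τ-right i) (unlower i q raised-i) ι) (+-congˡ (-‿cong (*-congˡ (s-F br ι)))))
               (trans (s-relation i (τ-left i) (τ-right⁺ c) e₂ ι) (+-congˡ (-‿cong (*-congˡ (s-B br ι)))))
               (s-relation i (τ-right i) (τ-right⁺ c) e₃ ι) ⟩
        (Y li - Y ri) * ((Y li - Y rj) * ((Y ri - Y rj) * s i h ι))
          ≈⟨ reorder (s i h ι) ⟨
        (Y lj - Y rj) * ((Y li - Y rj) * ((Y li - Y ri) * s i h ι)) ∎))))
        where
        br = braid c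
        li = left i
        ri = right i
        lj = left j
        rj = right j
        ri≡lj = right≡left c
        e₂ : ∀ ι → (Y li - Y rj) * s j (g q) ι ≈ Y li * f ι - Y rj * B ι
        e₂ = s-q (τ-left⁻ c) (≡.trans (≡.cong (τ j) ri≡lj) (τ-left j))
        e₃ : ∀ ι → (Y ri - Y rj) * h ι ≈ Y ri * g q ι - Y rj * s j (g q) ι
        e₃ ι = ≡.subst (λ l → (Y l - Y rj) * h ι ≈ Y l * g q ι - Y rj * s j (g q) ι) (≡.sym ri≡lj) (g-lower j q raised-j ι)
        reorder : ∀ x → (Y lj - Y rj) * ((Y li - Y rj) * ((Y li - Y ri) * x)) ≈ (Y li - Y ri) * ((Y li - Y rj) * ((Y ri - Y rj) * x))
        reorder x rewrite ri≡lj =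
          solve 4 (λ u v t x → u :* (v :* (t :* x)) := t :* (v :* (u :* x))) refl (Y lj - Y rj) (Y li - Y rj) (Y li - Y lj) x

      symmetric-after : Consecutive j i → ∀ ι → s i h ι ≈ h ι
      symmetric-after c ι = sym (cancel-≈ (left≢right i) (cancel-≈ (left≢right⁺ c) (cancel-≈ (left≢right j) (begin
        (Y lj - Y rj) * ((Y lj - Y ri) * ((Y li - Y ri) * h ι))
          ≈⟨ swapped (h ι) ⟩
        (Y lj - Y li) * ((Y lj - Y ri) * ((Y li - Y ri) * h ι))
          ≈⟨ braid-after (unlower i q raised-i ι) (e₂ ι) (e₃ ι)
               (trans (s-relation i (τ-left i) (τ-right i) (unlower i q raised-i) ι) (+-congˡ (-‿cong (*-congˡ (s-F br ι)))))
               (trans (s-relation i (τ-left⁻ c) (τ-right i) e₂ ι) (+-congˡ (-‿cong (*-congˡ (s-B br ι)))))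
               (s-relation i (τ-left⁻ c) (τ-left i) e₃ ι) ⟩
        (Y lj - Y li) * ((Y lj - Y ri) * ((Y li - Y ri) * s i h ι))
          ≈⟨ swapped (s i h ι) ⟨
        (Y lj - Y rj) * ((Y lj - Y ri) * ((Y li - Y ri) * s i h ι)) ∎))))
        where
        br : ∀ l → τ i (τ j (τ i l)) ≡ τ j (τ i (τ j l))
        br l = ≡.sym (braid c l)
        li = left i
        ri = right i
        lj = left j
        rj = right j
        rj≡li = right≡left c
        e₂ : ∀ ι → (Y lj - Y ri) * s j (g q) ι ≈ Y lj * f ι - Y ri * B ι
        e₂ = s-q (≡.trans (≡.cong (τ j) (≡.sym rj≡li)) (τ-right j)) (τ-right⁺ c)
        e₃ : ∀ ι → (Y lj - Y li) * h ι ≈ Y lj * g q ι - Y li * s j (g q) ι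
        e₃ ι = ≡.subst (λ l → (Y lj - Y l) * h ι ≈ Y lj * g q ι - Y l * s j (g q) ι) rj≡li (g-lower j q raised-j ι)
        swapped : ∀ x → (Y lj - Y rj) * ((Y lj - Y ri) * ((Y li - Y ri) * x)) ≈ (Y lj - Y li) * ((Y lj - Y ri) * ((Y li - Y ri) * x))
        swapped x = *-congʳ (reflexive (≡.cong (λ l → Y lj - Y l) rj≡li))

    symmetric-far : ∀ {i j} → Far i j → ∀ q → Raised j q → SymmetricAt q →
      entryˡ i (swapAt j q) ≡ entryʳ i (swapAt j q) → ∀ ι → s i (g (swapAt j q)) ι ≈ g (swapAt j q) ι
    symmetric-far {i} {j} f q raised sym-q same ι = cancel-≈ (left≢right j) (begin
      (Y (left j) - Y (right j)) * s i (g (swapAt j q)) ι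
        ≈⟨ s-relation i (far-left f) (far-right f) (g-lower j q raised) ι ⟩
      Y (left j) * s i (g q) ι - Y (right j) * s i (s j (g q)) ι
        ≈⟨ +-cong (*-congˡ (fixed ι)) (-‿cong (*-congˡ (trans (s-far f (g-ext q) ι) (s-cong j fixed ι)))) ⟩
      Y (left j) * g q ι - Y (right j) * s j (g q) ι
        ≈⟨ g-lower j q raised ι ⟨
      (Y (left j) - Y (right j)) * g (swapAt j q) ι ∎)
      where
      fixed : ∀ ι → s i (g q) ι ≈ g q ι
      fixed = sym-q i (≡.trans (≡.sym (far-entryˡ f q)) (≡.trans same (far-entryʳ f q)))

    -- Let the last box have been removed at j. If j is far from i, the reflections commute. If j is
    -- next to i, equal entries at i force the previous box to come from i, and the word before that
    -- has equal entries at j, so the induction gives the invariance needed for the braid relation.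
    symmetric : ∀ p → SymmetricAt p
    symmetric = rank-rec SymmetricAt λ p rec → cases p rec (sorted-or-lowered p)
      where
      cases : ∀ p → (∀ q → rank q < rank p → SymmetricAt q) →
              Sorted p ⊎ ∃₂ (λ j q → Raised j q × p ≡ swapAt j q) → SymmetricAt p
      cases p rec (inj₁ sorted) = symmetric-sorted p sorted
      cases .(swapAt j q) rec (inj₂ (j , q , raised , ≡.refl)) i same = byPosition (position i j)
        where
        q<p : rank q < rank (swapAt j q)
        q<p = rank-raised j q raised
        r<q : Raised i (swapAt i q) → rank (swapAt i q) < rank q
        r<q raised-i = ≡.subst (λ v → rank (swapAt i q) < rank v) (swapAt-involutive i q) (rank-raised i (swapAt i q) raised-i)
        byPosition : Position i j → ∀ ι → s i (g (swapAt j q)) ι ≈ g (swapAt j q) ι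
        byPosition equal = contradiction
          (≡.trans (≡.sym (proj₂ raised)) (≡.trans (≡.sym (entryˡ-swapAt i q)) (≡.trans same (≡.trans (entryʳ-swapAt i q) (proj₁ raised)))))
          λ ()
        byPosition (before c) with raised-i , same-j ← before-raised c q raised same =
          symmetric-before i j q raised raised-i (rec (swapAt i q) (ℕ.<-trans (r<q raised-i) q<p) j same-j) c
        byPosition (after c) with raised-i , same-j ← after-raised c q raised same =
          symmetric-after i j q raised raised-i (rec (swapAt i q) (ℕ.<-trans (r<q raised-i) q<p) j same-j) c
        byPosition (far f) = symmetric-far f q raised (rec q q<p) same

    act : Adj n → (State → State → Rule) → (Side → State) → Carrier → (Subset n → Carrier) → Subset n → Carrier
    act i rule f t F p =
      diag (rule (f (entryˡ i p)) (f (entryʳ i p))) t * F p +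
      off (rule (f (entryˡ i p)) (f (entryʳ i p))) t * F (swapAt i p)

    -- For the entries outside, inside, the definition of D_i is solved for the reflected
    -- polynomial. In the other three cases the polynomial is invariant.
    g-relation : ∀ i p ι → s i (g p) ι ≈ act i ruleᵇ rightState (w (left i) (right i)) (λ p → g p ι) p
    g-relation i p ι with entryˡ i p in eqˡ | entryʳ i p in eqʳ
    ... | outside | outside = trans (symmetric p i (≡.trans eqˡ (≡.sym eqʳ)) ι) (unit-combination _ _)
    ... | inside  | inside  = trans (symmetric p i (≡.trans eqˡ (≡.sym eqʳ)) ι)
      (unit-combination _ _)
    ... | inside  | outside = trans fixed (unit-combination _ _)
      where
      fixed : s i (g p) ι ≈ g p ι
      fixed = ≡.subst (λ q → s i (g q) ι ≈ g q ι) (swapAt-involutive i p)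
        (s-lowered i (swapAt i p) (≡.trans (entryˡ-swapAt i p) eqʳ , ≡.trans (entryʳ-swapAt i p) eqˡ) ι)
    ... | outside | inside  = begin
      s i (g p) ι
        ≈⟨ *-identityˡ _ ⟨
      1# * s i (g p) ι
        ≈⟨ *-congʳ (Y*Y⁻¹≈1 (right i)) ⟨
      (r * r⁻¹) * s i (g p) ι
        ≈⟨ solve 5 (λ l r r⁻¹ x z → (r :* r⁻¹) :* x := r⁻¹ :* (l :* z :- (l :* z :- r :* x))) refl l r r⁻¹ _ (g p ι) ⟩
      r⁻¹ * (l * g p ι - (l * g p ι - r * s i (g p) ι))
        ≈⟨ *-congˡ (+-congˡ (-‿cong (g-lower i p (eqˡ , eqʳ) ι))) ⟨
      r⁻¹ * (l * g p ι - (l - r) * g (swapAt i p) ι)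
        ≈⟨ solve 5 (λ l r r⁻¹ x z → r⁻¹ :* (l :* x :- (l :- r) :* z) := (l :* r⁻¹) :* x :+ (r :* r⁻¹ :- l :* r⁻¹) :* z) refl l r r⁻¹ (g p ι) (g (swapAt i p) ι) ⟩
      (l * r⁻¹) * g p ι + (r * r⁻¹ - l * r⁻¹) * g (swapAt i p) ι
        ≈⟨ +-congˡ (*-congʳ (+-congʳ (Y*Y⁻¹≈1 (right i)))) ⟩
      w (left i) (right i) * g p ι + (1# - w (left i) (right i)) * g (swapAt i p) ι ∎
      where
      l = Y (left i)
      r = Y (right i)
      r⁻¹ = Y⁻¹ (right i)

    g-swapAt : ∀ i p {S v v′} → Enum S v → Enum (swapAt i S) v′ → g p (τ i ∘ lookup v) ≈ g p (lookup v′)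
    g-swapAt i p e e′ with π , eq ← enum-swapAt i e e′ = trans (g-ext p (λ a → ≡.sym (eq a))) (g-permute p _ π)

    -- For a full rectangle, an element j of S outside p yields the factor 1 - y_j / y_j. Removing a
    -- box expresses the value at S by values at S and at its reflection, and `exceeds-raised`
    -- covers both.
    g-vanishes : ∀ p {S v} → Enum S v → Exceeds p S → g p (lookup v) ≈ 0#
    g-vanishes p = lowering-rec (λ p → ∀ {S v} → Enum S v → Exceeds p S → g p (lookup v) ≈ 0#)
      (base (λ p g≈0 e ex → g≈0 _) λ p sorted eq {S} {v} e ex →
        let (j , j∉p , j∈S) = ≢⇒difference p S (≡.trans eq (≡.sym (∣enum∣ e))) (λ { ≡.refl → exceeds-irrefl ex })
            (a , va≡j) = enum-index e j j∈S
        in trans (g-full p sorted eq (lookup v)) (product-zero _ a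
             (outsideProduct-zero p _ j j∉p (begin
               1# - w (lookup v a) j  ≡⟨ ≡.cong (λ x → 1# - w x j) va≡j ⟩
               1# - w j j             ≈⟨ +-congˡ (-‿cong (Y*Y⁻¹≈1 j)) ⟩
               1# - 1#                ≈⟨ -‿inverseʳ 1# ⟩
               0#                     ∎))))
      (λ i q raised rec {S} {v} e ex →
        let (ex₁ , ex₂) = exceeds-raised i q S raised ex
            (v′ , e′) = enum (swapAt i S) (≡.trans (∣swapAt∣ i S) (∣enum∣ e))
        in cancel-≈ (left≢right i) (begin
          (Y (left i) - Y (right i)) * g (swapAt i q) (lookup v)
            ≈⟨ g-lower i q raised (lookup v) ⟩
          Y (left i) * g q (lookup v) - Y (right i) * ren (τ i) (g q (τ i ∘ lookup v))
            ≈⟨ +-cong (*-congˡ (rec e ex₁)) (-‿cong (*-congˡ (trans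
                 (ren-cong (τ i) (trans (g-swapAt i q e e′) (rec e′ ex₂))) (ren-0 (τ i))))) ⟩
          Y (left i) * 0# - Y (right i) * 0#
            ≈⟨ solve 2 (λ l r → l :* con 0ℤ :- r :* con 0ℤ := (l :- r) :* con 0ℤ) refl (Y (left i)) (Y (right i)) ⟩
          (Y (left i) - Y (right i)) * 0# ∎))
      p

    labels : Vec (Fin n) n
    labels = tabulate id

    swapAt-labels : ∀ i → Vec.map (τ i) labels ≡ swapAt i labels
    swapAt-labels i = lookup-ext λ j → ≡.trans (lookup-map j (τ i) labels)
      (≡.trans (≡.cong (τ i) (lookup∘tabulate id j)) (≡.sym (≡.trans (lookup-swapAt i labels j) (lookup∘tabulate id (τ i j)))))

    entryˡ-labels : ∀ i → entryˡ i labels ≡ left i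
    entryˡ-labels i = ≡.trans (entryˡ-lookup i labels) (lookup∘tabulate id (left i))

    entryʳ-labels : ∀ i → entryʳ i labels ≡ right i
    entryʳ-labels i = ≡.trans (entryʳ-lookup i labels) (lookup∘tabulate id (right i))

    -- When a box is removed, the larger diagram vanishes at the new fixed point by
    -- `raised-exceeds`. Only the reflected term survives, and it comes from the diagonal value of
    -- the larger diagram.
    g-diagonal : ∀ p {v} → Enum p v → g p (lookup v) ≈ diagonal labels p
    g-diagonal p = lowering-rec (λ p → ∀ {v : Vec (Fin n) k} → Enum p v → g p (lookup v) ≈ diagonal labels p)
      (λ p sorted {v} e → trans (g-full p sorted (∣enum∣ e) (lookup v)) (diagonal-sorted sorted e id))
      (λ i q raised rec {v} e →
        let (v′ , e′) = enum q (≡.trans (≡.sym (∣swapAt∣ i q)) (∣enum∣ e))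
            e″ = ≡.subst (λ S → Enum S v′) (≡.sym (swapAt-involutive i q)) e′
            l = Y (left i)
            r = Y (right i)
            d = diagonal labels (swapAt i q)
        in cancel-≈ (left≢right i) (begin
          (l - r) * g (swapAt i q) (lookup v)
            ≈⟨ g-lower i q raised (lookup v) ⟩
          l * g q (lookup v) - r * ren (τ i) (g q (τ i ∘ lookup v))
            ≈⟨ +-cong (*-congˡ (g-vanishes q e (raised-exceeds i q raised)))
                 (-‿cong (*-congˡ (ren-cong (τ i) (trans (g-swapAt i q e e″) (rec e′))))) ⟩
          l * 0# - r * ren (τ i) (diagonal labels q)
            ≈⟨ +-congˡ (-‿cong (*-congˡ (begin
                 ren (τ i) (diagonal labels q)
                   ≈⟨ ren-diagonal (τ i) labels q ⟩
                 diagonal (Vec.map (τ i) labels) q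
                   ≡⟨ ≡.cong (λ ys → diagonal ys q) (swapAt-labels i) ⟩
                 diagonal (swapAt i labels) q
                   ≈⟨ diagonal-swapAt i labels q raised ⟨
                 (1# - w (entryˡ i labels) (entryʳ i labels)) * d
                   ≡⟨ ≡.cong₂ (λ a b → (1# - w a b) * d) (entryˡ-labels i) (entryʳ-labels i) ⟩
                 (1# - w (left i) (right i)) * d ∎))) ⟩
          l * 0# - r * ((1# - w (left i) (right i)) * d)
            ≈⟨ solve 4 (λ l r r⁻¹ d → l :* con 0ℤ :- r :* ((con 1ℤ :- l :* r⁻¹) :* d) := (l :* (r :* r⁻¹) :- r) :* d) refl l r (Y⁻¹ (right i)) d ⟩
          (l * (r * Y⁻¹ (right i)) - r) * d
            ≈⟨ *-congʳ (+-congʳ (trans (*-congˡ (Y*Y⁻¹≈1 (right i))) (*-identityʳ l))) ⟩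
          (l - r) * d ∎))
      p

    g-descending-on : ∀ {q v} → Descending q → Enum q v → g q (lookup v) ≈ 1#
    g-descending-on {q} desc e = trans (g-diagonal q e) (diagonal-descending labels desc)

    g-descending-off : ∀ {q v} → Descending q → Enum q v → ∀ p → p ≢ q → g p (lookup v) ≈ 0#
    g-descending-off desc e p p≢q with ∣ p ∣ ℕ.≟ k
    ... | no ne  = g-out p ne _
    ... | yes eq = g-vanishes p e (exceeds-descending desc p (≡.trans eq (≡.sym (∣enum∣ e))) p≢q)

-- Reversal of words

descending-∷ʳ : ∀ {n} {q : Subset n} → Descending q → Descending (q ∷ʳ outside)
descending-∷ʳ (allOutside {n}) = ≡.subst Descending (≡.sym (replicate-∷ʳ n)) (allOutside {suc n})
  where
  replicate-∷ʳ : ∀ n → replicate n outside ∷ʳ outside ≡ replicate (suc n) outside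
  replicate-∷ʳ zero    = ≡.refl
  replicate-∷ʳ (suc n) = ≡.cong (outside ∷_) (replicate-∷ʳ n)
descending-∷ʳ (inside∷ desc) = inside∷ descending-∷ʳ desc

descending-reverse : ∀ {n} {p : Subset n} → Sorted p → Descending (reverse p)
descending-reverse (allInside {n}) = ≡.subst Descending (≡.sym reverse-replicate) (descending-inside n)
  where
  descending-inside : ∀ n → Descending (replicate n inside)
  descending-inside zero    = allOutside
  descending-inside (suc n) = inside∷ descending-inside n
  reverse-replicate : reverse (replicate n inside) ≡ replicate n inside
  reverse-replicate = lookup-ext λ j → ≡.trans (lookup-reverse (replicate n inside) j)
    (≡.trans (lookup-replicate (opposite j) inside) (≡.sym (lookup-replicate j inside)))
descending-reverse (outside∷_ {p = p} sorted) =
  ≡.subst Descending (≡.sym (reverse-∷ outside p)) (descending-∷ʳ (descending-reverse sorted))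

∣∷∣-cong : ∀ x {n m} (p : Subset n) (q : Subset m) → ∣ p ∣ ≡ ∣ q ∣ → ∣ x ∷ p ∣ ≡ ∣ x ∷ q ∣
∣∷∣-cong outside p q eq = eq
∣∷∣-cong inside  p q eq = ≡.cong suc eq

∣∷∣-comm : ∀ x z {n} (p : Subset n) → ∣ z ∷ x ∷ p ∣ ≡ ∣ x ∷ z ∷ p ∣
∣∷∣-comm outside outside p = ≡.refl
∣∷∣-comm outside inside  p = ≡.refl
∣∷∣-comm inside  outside p = ≡.refl
∣∷∣-comm inside  inside  p = ≡.refl

∣∷ʳ∣ : ∀ {n} (p : Subset n) x → ∣ p ∷ʳ x ∣ ≡ ∣ x ∷ p ∣
∣∷ʳ∣ []      x = ≡.refl
∣∷ʳ∣ (z ∷ p) x = ≡.trans (∣∷∣-cong z (p ∷ʳ x) (x ∷ p) (∣∷ʳ∣ p x)) (∣∷∣-comm x z p)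

∣reverse∣ : ∀ {n} (p : Subset n) → ∣ reverse p ∣ ≡ ∣ p ∣
∣reverse∣ []      = ≡.refl
∣reverse∣ (x ∷ p) = ≡.trans (≡.cong ∣_∣ (reverse-∷ x p))
  (≡.trans (∣∷ʳ∣ (reverse p) x) (∣∷∣-cong x (reverse p) p (∣reverse∣ p)))

-- The expansion of products

module SubsetSums (R : CommutativeRing 0ℓ 0ℓ) where
  open CommutativeRing R hiding (zero)
  open RingTools R
  open import Relation.Binary.Reasoning.Setoid setoid

  ∑-subsets : ∀ {n} (F : Subset (suc n) → Carrier) →
    ∑ (subsets (suc n)) F ≈ ∑ (subsets n) (F ∘ (outside ∷_)) + ∑ (subsets n) (F ∘ (inside ∷_))
  ∑-subsets {n} F = trans (∑-++ (List.map (outside ∷_) (subsets n)) _ F)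
    (+-cong (∑-map (outside ∷_) (subsets n) F) (∑-map (inside ∷_) (subsets n) F))

  ∑-swapAt : ∀ {n} (i : Adj n) F → ∑ (subsets n) (F ∘ swapAt i) ≈ ∑ (subsets n) F
  ∑-swapAt {suc (suc n)} here F = begin
    ∑ (subsets (suc (suc n))) (F ∘ swapAt here)
      ≈⟨ trans (∑-subsets {suc n} _) (+-cong (∑-subsets {n} _) (∑-subsets {n} _)) ⟩
    (T outside outside + T inside outside) + (T outside inside + T inside inside)
      ≈⟨ solve 4 (λ a b c d → (a :+ b) :+ (c :+ d) := (a :+ c) :+ (b :+ d)) refl _ _ _ _ ⟩
    (T outside outside + T outside inside) + (T inside outside + T inside inside)
      ≈⟨ trans (∑-subsets {suc n} _) (+-cong (∑-subsets {n} _) (∑-subsets {n} _)) ⟨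
    ∑ (subsets (suc (suc n))) F ∎
    where
    T : Side → Side → Carrier
    T x z = ∑ (subsets n) λ p → F (x ∷ z ∷ p)
  ∑-swapAt (there i) F = trans (∑-subsets (F ∘ swapAt (there i)))
    (trans (+-cong (∑-swapAt i (F ∘ (outside ∷_))) (∑-swapAt i (F ∘ (inside ∷_)))) (sym (∑-subsets F)))

  ∑-single : ∀ {n} (q : Subset n) F → (∀ r → r ≢ q → F r ≈ 0#) → ∑ (subsets n) F ≈ F q
  ∑-single []            F F≈0 = +-identityʳ _
  ∑-single {suc n} (outside ∷ q) F F≈0 = trans (∑-subsets F) (trans (+-cong
    (∑-single q (F ∘ (outside ∷_)) λ r r≢q → F≈0 _ (r≢q ∘ ≡.cong Vec.tail))
    (∑-zero (subsets n) λ r → F≈0 _ λ ())) (+-identityʳ _))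
  ∑-single {suc n} (inside ∷ q)  F F≈0 = trans (∑-subsets F) (trans (+-cong
    (∑-zero (subsets n) λ r → F≈0 _ λ ())
    (∑-single q (F ∘ (inside ∷_)) λ r r≢q → F≈0 _ (r≢q ∘ ≡.cong Vec.tail))) (+-identityˡ _))

module Expansion (𝓛 : LaurentTheory) (n k : ℕ)
  (g : Subset n → (Fin k → Fin n) → CommutativeRing.Carrier (LaurentTheory.laurent 𝓛 n))
  (isFamily : Family.IsGrothendieckFamily 𝓛 n k g) where
  open LaurentTheory 𝓛
  open Renaming 𝓛
  open CommutativeRing (laurent n) hiding (zero)
  open RingTools (laurent n) hiding (⟦_⟧)
  open SubsetSums (laurent n)
  open Local (laurent n) hiding (∑)
  open Amplitude (laurent n) (Fin n) Y Y⁻¹ Y*Y⁻¹≈1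
  open Products (laurent n)
  open Localised 𝓛 n k
  open Family 𝓛 n k g
  open IsGrothendieckFamily isFamily
  open Properties isFamily
  open import Algebra.Properties.Group +-group using (x∙y⁻¹≈ε⇒x≈y)
  open import Relation.Binary.Reasoning.Setoid setoid

  -- The values of G(x;ȳ) for the reversed word: q is read along the left or bottom side from the
  -- bottom left corner, against the direction that encodes the diagram.
  h : Subset n → Values
  h q ι = ren opposite (g (reverse q) (opposite ∘ ι))

  h-ext : ∀ q → Ext (h q)
  h-ext q eq = ren-cong opposite (g-ext (reverse q) (≡.cong opposite ∘ eq))

  h-permute : ∀ q ι (π : Permutation′ k) → h q (ι ∘ (π ⟨$⟩ʳ_)) ≈ h q ι
  h-permute q ι π = ren-cong opposite (g-permute (reverse q) (opposite ∘ ι) π)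

  h-out : ∀ q → ∣ q ∣ ≢ k → ∀ ι → h q ι ≈ 0#
  h-out q ne ι = trans (ren-cong opposite (g-out (reverse q) (ne ∘ ≡.trans (≡.sym (∣reverse∣ q))) _)) (ren-0 opposite)

  ren-diag : ∀ (ρ : Fin n → Fin n) r t → ren ρ (diag r t) ≈ diag r (ren ρ t)
  ren-diag ρ stay  t = ren-1 ρ
  ren-diag ρ scale t = refl
  ren-diag ρ split t = refl
  ren-diag ρ move  t = ren-1 ρ

  ren-off : ∀ (ρ : Fin n → Fin n) r t → ren ρ (off r t) ≈ off r (ren ρ t)
  ren-off ρ stay  t = ren-0 ρ
  ren-off ρ scale t = ren-0 ρ
  ren-off ρ split t = trans (ren-sub ρ 1# t) (+-congʳ (ren-1 ρ))
  ren-off ρ move  t = trans (ren-sub ρ 1# t) (+-congʳ (ren-1 ρ))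

  diag-cong : ∀ r {t t′} → t ≈ t′ → diag r t ≈ diag r t′
  diag-cong stay  eq = refl
  diag-cong scale eq = eq
  diag-cong split eq = eq
  diag-cong move  eq = refl

  off-cong : ∀ r {t t′} → t ≈ t′ → off r t ≈ off r t′
  off-cong stay  eq = refl
  off-cong scale eq = refl
  off-cong split eq = +-congˡ (-‿cong eq)
  off-cong move  eq = +-congˡ (-‿cong eq)

  ruleᵇ-ruleᵃ : ∀ x z → ruleᵇ (rightState z) (rightState x) ≡ ruleᵃ (leftState x) (leftState z)
  ruleᵇ-ruleᵃ outside outside = ≡.refl
  ruleᵇ-ruleᵃ outside inside  = ≡.refl
  ruleᵇ-ruleᵃ inside  outside = ≡.refl
  ruleᵇ-ruleᵃ inside  inside  = ≡.refl

  -- This is `g-relation` conjugated by the reversal of y, which interchanges the two entries and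
  -- inverts the parameter. On boundary states, interchanging the entries leads from `ruleᵇ` to
  -- `ruleᵃ`.
  h-relation : ∀ i q ι → s i (h q) ι ≈ act i ruleᵃ leftState (w (right i) (left i)) (λ q → h q ι) q
  h-relation i q ι = begin
    ren (τ i) (ren opposite (g rq (opposite ∘ τ i ∘ ι)))
      ≈⟨ ren-∘ (τ i) opposite _ ⟩
    ren (τ i ∘ opposite) (g rq (opposite ∘ τ i ∘ ι))
      ≈⟨ ren-≗ τ-opposite _ ⟩
    ren (opposite ∘ τ i′) (g rq (opposite ∘ τ i ∘ ι))
      ≈⟨ ren-cong (opposite ∘ τ i′) (g-ext rq λ a → ≡.sym (τ-mirror i (ι a))) ⟩
    ren (opposite ∘ τ i′) (g rq (τ i′ ∘ opposite ∘ ι))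
      ≈⟨ ren-∘ opposite (τ i′) _ ⟨
    ren opposite (s i′ (g rq) (opposite ∘ ι))
      ≈⟨ ren-cong opposite (g-relation i′ rq (opposite ∘ ι)) ⟩
    ren opposite (diag ρ t′ * g rq (opposite ∘ ι) + off ρ t′ * g (swapAt i′ rq) (opposite ∘ ι))
      ≈⟨ trans (ren-+ opposite _ _) (+-cong (ren-* opposite _ _) (ren-* opposite _ _)) ⟩
    ren opposite (diag ρ t′) * h q ι + ren opposite (off ρ t′) * ren opposite (g (swapAt i′ rq) (opposite ∘ ι))
      ≈⟨ +-cong (*-congʳ (trans (ren-diag opposite ρ t′) (diag-cong ρ t′≈t)))
                (*-cong (trans (ren-off opposite ρ t′) (off-cong ρ t′≈t))
                        (reflexive (≡.cong (λ p → ren opposite (g p (opposite ∘ ι))) (reverse-swapAt i q)))) ⟩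
    diag ρ t * h q ι + off ρ t * h (swapAt i q) ι
      ≡⟨ ≡.cong (λ r → diag r t * h q ι + off r t * h (swapAt i q) ι) ρ≡ ⟩
    act i ruleᵃ leftState t (λ q → h q ι) q ∎
    where
    i′ = mirror i
    rq = reverse q
    t = w (right i) (left i)
    t′ = w (left i′) (right i′)
    ρ = ruleᵇ (rightState (entryˡ i′ rq)) (rightState (entryʳ i′ rq))
    ρ≡ : ρ ≡ ruleᵃ (leftState (entryˡ i q)) (leftState (entryʳ i q))
    ρ≡ = ≡.trans (≡.cong₂ (λ x z → ruleᵇ (rightState x) (rightState z)) (entryˡ-mirror i q) (entryʳ-mirror i q))
                 (ruleᵇ-ruleᵃ (entryˡ i q) (entryʳ i q))
    t′≈t : ren opposite t′ ≈ t
    t′≈t = trans (ren-w opposite (left i′) (right i′)) (reflexive (≡.cong₂ w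
      (≡.trans (≡.cong opposite (left-mirror i)) (Fin.opposite-involutive (right i)))
      (≡.trans (≡.cong opposite (right-mirror i)) (Fin.opposite-involutive (left i)))))
    τ-opposite : ∀ j → τ i (opposite j) ≡ opposite (τ i′ j)
    τ-opposite j = ≡.trans (≡.sym (Fin.opposite-involutive _))
      (≡.cong opposite (≡.trans (≡.sym (τ-mirror i (opposite j))) (≡.cong (τ i′) (Fin.opposite-involutive j))))

  Z : Vec (Fin n) n → (left right bottom : Subset n) → Carrier
  Z ys r p q = amplitude ys (Vec.map leftState r) (Vec.map rightState p) (Vec.map bottomState q)

  actᵀ : Adj n → (State → State → Rule) → (Side → State) → Carrier → (Subset n → Carrier) → Subset n → Carrier
  actᵀ i rule f t F p =
    diag (rule (f (entryˡ i p)) (f (entryʳ i p))) t * F p +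
    off (rule (f (entryʳ i p)) (f (entryˡ i p))) t * F (swapAt i p)

  -- `swapAt i` permutes the subsets, so it can be substituted in the off-diagonal part of the sum.
  ∑-actᵀ : ∀ i rule f t F H →
    ∑ (subsets n) (λ r → actᵀ i rule f t F r * H r) ≈ ∑ (subsets n) (λ r → F r * act i rule f t H r)
  ∑-actᵀ i rule f t F H = begin
    ∑ (subsets n) (λ r → actᵀ i rule f t F r * H r)
      ≈⟨ ∑-cong (subsets n) (λ r → solve 5 (λ d x o y h → (d :* x :+ o :* y) :* h := d :* (x :* h) :+ o :* (y :* h)) refl _ _ _ _ _) ⟩
    ∑ (subsets n) (λ r → D r * (F r * H r) + O′ r * (F (swapAt i r) * H r))
      ≈⟨ ∑-+ (subsets n) _ _ ⟩
    ∑ (subsets n) (λ r → D r * (F r * H r)) + ∑ (subsets n) (λ r → O′ r * (F (swapAt i r) * H r))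
      ≈⟨ +-congˡ (∑-swapAt i (λ r → O′ r * (F (swapAt i r) * H r))) ⟨
    ∑ (subsets n) (λ r → D r * (F r * H r)) + ∑ (subsets n) (λ r → O′ (swapAt i r) * (F (swapAt i (swapAt i r)) * H (swapAt i r)))
      ≈⟨ ∑-+ (subsets n) _ _ ⟨
    ∑ (subsets n) (λ r → D r * (F r * H r) + O′ (swapAt i r) * (F (swapAt i (swapAt i r)) * H (swapAt i r)))
      ≈⟨ ∑-cong (subsets n) (λ r → trans
           (+-congˡ (*-cong (reflexive (O′≡ r)) (*-congʳ (reflexive (≡.cong F (swapAt-involutive i r))))))
           (solve 5 (λ d x o h h′ → d :* (x :* h) :+ o :* (x :* h′) := x :* (d :* h :+ o :* h′)) refl _ _ _ _ _)) ⟩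
    ∑ (subsets n) (λ r → F r * act i rule f t H r) ∎
    where
    D O O′ : Subset n → Carrier
    D r = diag (rule (f (entryˡ i r)) (f (entryʳ i r))) t
    O r = off (rule (f (entryˡ i r)) (f (entryʳ i r))) t
    O′ r = off (rule (f (entryʳ i r)) (f (entryˡ i r))) t
    O′≡ : ∀ r → O′ (swapAt i r) ≡ O r
    O′≡ r = ≡.cong₂ (λ x z → off (rule (f x) (f z)) t) (entryʳ-swapAt i r) (entryˡ-swapAt i r)

  actAtᵇ-map : ∀ i t F p → actAtᵇ i t F (Vec.map rightState p) ≡ act i ruleᵇ rightState t (F ∘ Vec.map rightState) p
  actAtᵇ-map i t F p rewrite entryˡ-map rightState i p | entryʳ-map rightState i p | swapAt-map rightState i p = ≡.refl

  actAtᵃ-map : ∀ i t F p → actAtᵃ i t F (Vec.map leftState p) ≡ actᵀ i ruleᵃ leftState t (F ∘ Vec.map leftState) p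
  actAtᵃ-map i t F p rewrite entryˡ-map leftState i p | entryʳ-map leftState i p | swapAt-map leftState i p = ≡.refl

  Lowerable : Adj n → Subset n → Set
  Lowerable i q = entryˡ i q ≡ inside × entryʳ i q ≡ outside

  Z-exchange : ∀ i r p q → Lowerable i q →
    w (right i) (left i) * act i ruleᵇ rightState (w (left i) (right i)) (λ p → Z labels r p q) p +
    (1# - w (right i) (left i)) * act i ruleᵇ rightState (w (left i) (right i)) (λ p → Z labels r p (swapAt i q)) p ≈
    actᵀ i ruleᵃ leftState (w (right i) (left i)) (λ r → Z (swapAt i labels) r p q) r
  Z-exchange i r p q (in-q , out-q)
    with ex ← exchange i labels (Vec.map leftState r) (Vec.map rightState p) (Vec.map bottomState q)
                (≡.trans (entryˡ-map bottomState i q) (≡.cong bottomState in-q))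
                (≡.trans (entryʳ-map bottomState i q) (≡.cong bottomState out-q))
    rewrite entryˡ-labels i | entryʳ-labels i | swapAt-map bottomState i q
          | actAtᵇ-map i (w (left i) (right i)) (λ v → amplitude labels (Vec.map leftState r) v (Vec.map bottomState q)) p
          | actAtᵇ-map i (w (left i) (right i)) (λ v → amplitude labels (Vec.map leftState r) v (Vec.map bottomState (swapAt i q))) p
          | actAtᵃ-map i (w (right i) (left i)) (λ v → amplitude (swapAt i labels) v (Vec.map rightState p) (Vec.map bottomState q)) r
    = ex

  ren-scalar : ∀ (ρ : Fin n → Fin n) c x → ren ρ (⟦ c ⟧ₛ x) ≈ ⟦ c ⟧ₛ (ren ρ x)
  ren-scalar ρ one           x = ren-1 ρ
  ren-scalar ρ minusOne      x = trans (ren-neg ρ 1#) (-‿cong (ren-1 ρ))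
  ren-scalar ρ param         x = refl
  ren-scalar ρ oneMinusParam x = trans (ren-sub ρ 1# x) (+-congʳ (ren-1 ρ))

  ren-cross : ∀ (ρ : Fin n → Fin n) i j a b k → ren ρ (cross (w i j) a b k) ≈ cross (w (ρ i) (ρ j)) a b (λ x z → ren ρ (k x z))
  ren-cross ρ i j a b k = trans (ren-∑ ρ (lozenges a b) _) (∑-cong (lozenges a b) λ (u , d) →
    trans (ren-* ρ _ _) (*-congʳ (trans (ren-scalar ρ (scalar u d) (w i j)) (⟦⟧ₛ-cong (scalar u d) (ren-w ρ i j)))))

  ren-pass : ∀ (ρ : Fin n → Fin n) {m} j (ys : Vec (Fin n) m) as b k →
    ren ρ (pass j ys as b k) ≈ pass (ρ j) (Vec.map ρ ys) as b (λ v x → ren ρ (k v x))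
  ren-pass ρ j []       []       b k = refl
  ren-pass ρ j (i ∷ ys) (a ∷ as) b k = trans (ren-pass ρ j ys as b _)
    (pass-cong (ρ j) (Vec.map ρ ys) as b λ as′ b′ → ren-cross ρ i j a b′ λ b″ a′ → k (a′ ∷ as′) b″)

  ren-amplitude : ∀ (ρ : Fin n → Fin n) {m} (ys : Vec (Fin n) m) as bs hs →
    ren ρ (amplitude ys as bs hs) ≈ amplitude (Vec.map ρ ys) as bs hs
  ren-amplitude ρ []       []       []       []       = ren-1 ρ
  ren-amplitude ρ (j ∷ ys) (a ∷ as) (b ∷ bs) (h ∷ hs) = trans (ren-pass ρ j ys as b _)
    (pass-cong (ρ j) (Vec.map ρ ys) as b λ as′ b′ →
      trans (ren-* ρ _ _) (*-cong (trans (ren-∑ ρ (capTiles a b′ h) λ _ → 1#) (∑-cong (capTiles a b′ h) λ _ → ren-1 ρ)) (ren-amplitude ρ ys as′ bs hs)))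

  Φ : (p q : Subset n) → Values
  Φ p q ι = g p ι * h q ι - ∑ (subsets n) λ r → Z labels r p q * h r ι

  -- The product transforms by the matrix for p and by the row t, 1 - t for q. In the sum, the
  -- matrix acting on h is first moved onto Z by `∑-actᵀ`, and `Z-exchange` then replaces it by the
  -- same matrix for p and the same row for q.
  Φ-exchange : ∀ i p q → Lowerable i q → ∀ ι →
    s i (Φ p q) ι ≈
    w (right i) (left i) * act i ruleᵇ rightState (w (left i) (right i)) (λ p → Φ p q ι) p +
    (1# - w (right i) (left i)) * act i ruleᵇ rightState (w (left i) (right i)) (λ p → Φ p (swapAt i q) ι) p
  Φ-exchange i p q lowerable@(in-q , out-q) ι = begin
    s i (Φ p q) ι
      ≈⟨ ren-sub (τ i) _ _ ⟩
    ren (τ i) (g p (τ i ∘ ι) * h q (τ i ∘ ι)) - ren (τ i) (∑ (subsets n) λ r → Z labels r p q * h r (τ i ∘ ι))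
      ≈⟨ +-cong (ren-* (τ i) _ _) (-‿cong sum) ⟩
    s i (g p) ι * s i (h q) ι - X
      ≈⟨ +-congʳ (*-cong (g-relation i p ι) (trans (h-relation i q ι) (reflexive (≡.cong₂
           (λ x z → diag (ruleᵃ (leftState x) (leftState z)) t * h q ι + off (ruleᵃ (leftState x) (leftState z)) t * h q′ ι) in-q out-q)))) ⟩
    (D * g p ι + O * g p′ ι) * (t * h q ι + (1# - t) * h q′ ι) - X
      ≈⟨ +-congˡ (-‿cong (sumSplit)) ⟩
    (D * g p ι + O * g p′ ι) * (t * h q ι + (1# - t) * h q′ ι) -
      (t * (D * Σ′ p q + O * Σ′ p′ q) + (1# - t) * (D * Σ′ p q′ + O * Σ′ p′ q′))
      ≈⟨ solve 12 (λ D O t u gp gp′ hq hq′ a b c d →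
           (D :* gp :+ O :* gp′) :* (t :* hq :+ u :* hq′) :- (t :* (D :* a :+ O :* b) :+ u :* (D :* c :+ O :* d)) :=
           t :* (D :* (gp :* hq :- a) :+ O :* (gp′ :* hq :- b)) :+ u :* (D :* (gp :* hq′ :- c) :+ O :* (gp′ :* hq′ :- d)))
           refl D O t (1# - t) (g p ι) (g p′ ι) (h q ι) (h q′ ι) (Σ′ p q) (Σ′ p′ q) (Σ′ p q′) (Σ′ p′ q′) ⟩
    t * act i ruleᵇ rightState t⁻¹ (λ p → Φ p q ι) p + (1# - t) * act i ruleᵇ rightState t⁻¹ (λ p → Φ p q′ ι) p ∎
    where
    t = w (right i) (left i)
    t⁻¹ = w (left i) (right i)
    p′ = swapAt i p
    q′ = swapAt i q
    D = diag (ruleᵇ (rightState (entryˡ i p)) (rightState (entryʳ i p))) t⁻¹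
    O = off (ruleᵇ (rightState (entryˡ i p)) (rightState (entryʳ i p))) t⁻¹
    Σ′ : Subset n → Subset n → Carrier
    Σ′ p q = ∑ (subsets n) λ r → Z labels r p q * h r ι
    X = ∑ (subsets n) λ r → actᵀ i ruleᵃ leftState t (λ r → Z (swapAt i labels) r p q) r * h r ι
    sum : ren (τ i) (∑ (subsets n) λ r → Z labels r p q * h r (τ i ∘ ι)) ≈ X
    sum = begin
      ren (τ i) (∑ (subsets n) λ r → Z labels r p q * h r (τ i ∘ ι))
        ≈⟨ ren-∑ (τ i) (subsets n) _ ⟩
      ∑ (subsets n) (λ r → ren (τ i) (Z labels r p q * h r (τ i ∘ ι)))
        ≈⟨ ∑-cong (subsets n) (λ r → trans (ren-* (τ i) _ _) (*-cong
             (trans (ren-amplitude (τ i) labels _ _ _) (reflexive (≡.cong (λ ys → Z ys r p q) (swapAt-labels i))))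
             (h-relation i r ι))) ⟩
      ∑ (subsets n) (λ r → Z (swapAt i labels) r p q * act i ruleᵃ leftState t (λ r → h r ι) r)
        ≈⟨ ∑-actᵀ i ruleᵃ leftState t (λ r → Z (swapAt i labels) r p q) (λ r → h r ι) ⟨
      X ∎
    sumSplit : X ≈ t * (D * Σ′ p q + O * Σ′ p′ q) + (1# - t) * (D * Σ′ p q′ + O * Σ′ p′ q′)
    sumSplit = begin
      X
        ≈⟨ ∑-cong (subsets n) (λ r → *-congʳ (sym (Z-exchange i r p q lowerable))) ⟩
      ∑ (subsets n) (λ r → (t * (D * Z labels r p q + O * Z labels r p′ q) +
                            (1# - t) * (D * Z labels r p q′ + O * Z labels r p′ q′)) * h r ι)
        ≈⟨ ∑-cong (subsets n) (λ r → solve 9 (λ t u D O a b c d h →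
             (t :* (D :* a :+ O :* b) :+ u :* (D :* c :+ O :* d)) :* h :=
             t :* (D :* (a :* h) :+ O :* (b :* h)) :+ u :* (D :* (c :* h) :+ O :* (d :* h))) refl
             t (1# - t) D O (Z labels r p q) (Z labels r p′ q) (Z labels r p q′) (Z labels r p′ q′) (h r ι)) ⟩
      ∑ (subsets n) (λ r → t * (D * (Z labels r p q * h r ι) + O * (Z labels r p′ q * h r ι)) +
                           (1# - t) * (D * (Z labels r p q′ * h r ι) + O * (Z labels r p′ q′ * h r ι)))
        ≈⟨ trans (∑-linear (subsets n) t (1# - t) _ _)
             (+-cong (*-congˡ (∑-linear (subsets n) D O _ _)) (*-congˡ (∑-linear (subsets n) D O _ _))) ⟩
      t * (D * Σ′ p q + O * Σ′ p′ q) + (1# - t) * (D * Σ′ p q′ + O * Σ′ p′ q′) ∎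

  -- Multiplication by y_i turns the factor 1 - y_j / y_i into a difference of variables.
  cancel-1-w : ∀ {i j} → i ≢ j → ∀ f → (1# - w j i) * f ≈ 0# → f ≈ 0#
  cancel-1-w {i} {j} i≢j f eq = cancel i≢j f (begin
    (Y i - Y j) * f                       ≈⟨ *-congʳ (+-congˡ (-‿cong (*-identityʳ (Y j)))) ⟨
    (Y i - Y j * 1#) * f                  ≈⟨ *-congʳ (+-congˡ (-‿cong (*-congˡ (Y*Y⁻¹≈1 i)))) ⟨
    (Y i - Y j * (Y i * Y⁻¹ i)) * f       ≈⟨ solve 4 (λ a b a⁻¹ f → (a :- b :* (a :* a⁻¹)) :* f := a :* ((con 1ℤ :- b :* a⁻¹) :* f)) refl (Y i) (Y j) (Y⁻¹ i) f ⟩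
    Y i * ((1# - w j i) * f)              ≈⟨ *-congˡ eq ⟩
    Y i * 0#                              ≈⟨ zeroʳ (Y i) ⟩
    0#                                    ∎)

  -- The matrix is triangular with units on its diagonal: only the rows with entries outside, inside
  -- have an off-diagonal part, and it refers to a word whose row is trivial.
  act-injective : ∀ i (F : Subset n → Carrier) →
    (∀ p → act i ruleᵇ rightState (w (left i) (right i)) F p ≈ 0#) → ∀ p → F p ≈ 0#
  act-injective i F act≈0 p with entryˡ i p in eqˡ | entryʳ i p in eqʳ | act≈0 p
  ... | outside | outside | eq = trans (unit-combination _ _) eq
  ... | inside  | inside  | eq = trans (unit-combination _ _) eq
  ... | inside  | outside | eq = trans (unit-combination _ _) eq
  ... | outside | inside  | eq = begin
    F p                                          ≈⟨ *-identityˡ _ ⟨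
    1# * F p                                     ≈⟨ *-congʳ (w-inverse (right i) (left i)) ⟨
    (t⁻¹ * t) * F p                              ≈⟨ solve 4 (λ t⁻¹ t x z → (t⁻¹ :* t) :* x := t⁻¹ :* ((t :* x :+ (con 1ℤ :- t) :* z) :- (con 1ℤ :- t) :* z)) refl t⁻¹ t (F p) (F (swapAt i p)) ⟩
    t⁻¹ * ((t * F p + (1# - t) * F (swapAt i p)) - (1# - t) * F (swapAt i p))
                                                 ≈⟨ *-congˡ (+-cong eq (-‿cong (*-congˡ lowered))) ⟩
    t⁻¹ * (0# - (1# - t) * 0#)                   ≈⟨ solve 2 (λ t⁻¹ u → t⁻¹ :* (con 0ℤ :- u :* con 0ℤ) := con 0ℤ) refl t⁻¹ (1# - t) ⟩
    0#                                           ∎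
    where
    t = w (left i) (right i)
    t⁻¹ = w (right i) (left i)
    lowered : F (swapAt i p) ≈ 0#
    lowered = trans (unit-combination _ _)
      (trans (reflexive (≡.cong₂ (λ x z → diag (ruleᵇ (rightState x) (rightState z)) t * F (swapAt i p) +
                                          off (ruleᵇ (rightState x) (rightState z)) t * F (swapAt i (swapAt i p)))
                                 (≡.sym (≡.trans (entryˡ-swapAt i p) eqʳ)) (≡.sym (≡.trans (entryʳ-swapAt i p) eqˡ))))
             (act≈0 (swapAt i p)))

  -- Injections instead of increasing maps, because composition with `τ i` preserves only the
  -- former.
  Injection : (Fin k → Fin n) → Set
  Injection = Injective _≡_ _≡_

  Φ-step : ∀ i q → Lowerable i q → (∀ p ι → Injection ι → Φ p q ι ≈ 0#) →
           ∀ p ι → Injection ι → Φ p (swapAt i q) ι ≈ 0#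
  Φ-step i q lowerable hyp p ι inj = act-injective i (λ p → Φ p (swapAt i q) ι)
    (λ p → cancel-1-w (left≢right i) _ (begin
      (1# - t) * B p                          ≈⟨ solve 3 (λ t u b → u :* b := t :* con 0ℤ :+ u :* b) refl t (1# - t) (B p) ⟩
      t * 0# + (1# - t) * B p                 ≈⟨ +-congʳ (*-congˡ (trans (+-cong (trans (*-congˡ (hyp p ι inj)) (zeroʳ _)) (trans (*-congˡ (hyp _ ι inj)) (zeroʳ _))) (+-identityˡ 0#))) ⟨
      t * A p + (1# - t) * B p                ≈⟨ Φ-exchange i p q lowerable ι ⟨
      s i (Φ p q) ι                           ≈⟨ ren-cong (τ i) (hyp p (τ i ∘ ι) (inj ∘ τ-injective)) ⟩
      ren (τ i) 0#                            ≈⟨ ren-0 (τ i) ⟩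
      0#                                      ∎)) p
    where
    t = w (right i) (left i)
    A B : Subset n → Carrier
    A = act i ruleᵇ rightState (w (left i) (right i)) (λ p → Φ p q ι)
    B = act i ruleᵇ rightState (w (left i) (right i)) (λ p → Φ p (swapAt i q) ι)
    τ-injective : ∀ {a b} → τ i a ≡ τ i b → a ≡ b
    τ-injective eq = ≡.trans (≡.sym (τ-involutive i _)) (≡.trans (≡.cong (τ i) eq) (τ-involutive i _))

  h-vanishes : ∀ {q} → Sorted q → ∀ {S v} → Enum S v → reverse q ≢ S → h (reverse q) (lookup v) ≈ 0#
  h-vanishes {q} sorted {S} {v} e q̃≢S with ∣ q ∣ ℕ.≟ k
  ... | no ne  = h-out (reverse q) (ne ∘ ≡.trans (≡.sym (∣reverse∣ q))) _
  ... | yes eq = let (j , j∉q̃ , j∈S) = ≢⇒difference (reverse q) S (≡.trans (∣reverse∣ q) (≡.trans eq (≡.sym (∣enum∣ e)))) q̃≢S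
                     (a , va≡j) = enum-index e j j∈S
                     o = opposite ∘ lookup v
    in begin
    ren opposite (g (reverse (reverse q)) o)
      ≡⟨ ≡.cong (λ p → ren opposite (g p o)) (reverse-involutive q) ⟩
    ren opposite (g q o)
      ≈⟨ ren-cong opposite (trans (g-full q sorted eq o) (product-zero _ a
           (outsideProduct-zero q _ (opposite j) (≡.trans (≡.sym (lookup-reverse q j)) j∉q̃) (begin
             1# - w (opposite (lookup v a)) (opposite j)  ≡⟨ ≡.cong (λ x → 1# - w (opposite x) (opposite j)) va≡j ⟩
             1# - w (opposite j) (opposite j)             ≈⟨ +-congˡ (-‿cong (Y*Y⁻¹≈1 (opposite j))) ⟩
             1# - 1#                                      ≈⟨ -‿inverseʳ 1# ⟩
             0#                                           ∎)))) ⟩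
    ren opposite 0#
      ≈⟨ ren-0 opposite ⟩
    0# ∎

  -- As the puzzles are frozen, the sum is h q̃ if p = q̃ and 0 otherwise. At fixed points other
  -- than q̃ the factor h q̃ vanishes, and at q̃ the value of g p is 1 or 0 in the same two cases.
  Φ-base : ∀ q → Sorted q → ∀ p ι → Injection ι → Φ p (reverse q) ι ≈ 0#
  Φ-base q sorted p ι inj with S , v , e , π , eq ← enum-image ι inj = begin
    Φ p q̃ ι
      ≈⟨ +-cong (*-cong (trans (g-ext p (λ a → ≡.sym (eq a))) (g-permute p (lookup v) π)) hι≈hv)
                (-‿cong (∑-cong (subsets n) λ r → *-congˡ (trans (h-ext r (λ a → ≡.sym (eq a))) (h-permute r (lookup v) π)))) ⟩
    Φ p q̃ (lookup v)
      ≈⟨ cases (≡-dec Bool._≟_ p q̃) (≡-dec Bool._≟_ q̃ S) ⟩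
    0# ∎
    where
    q̃ = reverse q
    desc = descending-reverse sorted
    hι≈hv : h q̃ ι ≈ h q̃ (lookup v)
    hι≈hv = trans (h-ext q̃ (λ a → ≡.sym (eq a))) (h-permute q̃ (lookup v) π)
    sum-on : p ≡ q̃ → ∑ (subsets n) (λ r → Z labels r p q̃ * h r (lookup v)) ≈ h q̃ (lookup v)
    sum-on ≡.refl = trans
      (∑-single q̃ _ λ r r≢q̃ → trans (*-congʳ (amplitude-descending-off labels desc r q̃ (inj₁ r≢q̃))) (zeroˡ _))
      (trans (*-congʳ (amplitude-descending-on labels desc)) (*-identityˡ _))
    sum-off : p ≢ q̃ → ∑ (subsets n) (λ r → Z labels r p q̃ * h r (lookup v)) ≈ 0#
    sum-off p≢q̃ = ∑-zero (subsets n) λ r →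
      trans (*-congʳ (amplitude-descending-off labels desc r p (inj₂ p≢q̃))) (zeroˡ _)
    cases : Dec (p ≡ q̃) → Dec (q̃ ≡ S) → Φ p q̃ (lookup v) ≈ 0#
    cases (yes p≡q̃) (yes ≡.refl) = trans
      (+-cong (trans (*-congʳ (trans (reflexive (≡.cong (λ p → g p (lookup v)) p≡q̃)) (g-descending-on desc e))) (*-identityˡ _))
              (-‿cong (sum-on p≡q̃)))
      (-‿inverseʳ _)
    cases (yes p≡q̃) (no q̃≢S) = trans
      (+-cong (trans (*-congˡ (h-vanishes sorted e q̃≢S)) (zeroʳ _)) (-‿cong (trans (sum-on p≡q̃) (h-vanishes sorted e q̃≢S))))
      (-‿inverseʳ 0#)
    cases (no p≢q̃) (yes ≡.refl) = trans
      (+-cong (trans (*-congʳ (g-descending-off desc e p p≢q̃)) (zeroˡ _)) (-‿cong (sum-off p≢q̃)))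
      (-‿inverseʳ 0#)
    cases (no p≢q̃) (no q̃≢S) = trans
      (+-cong (trans (*-congˡ (h-vanishes sorted e q̃≢S)) (zeroʳ _)) (-‿cong (sum-off p≢q̃)))
      (-‿inverseʳ 0#)

  expansion : ∀ q p ι → Injection ι → Φ p q ι ≈ 0#
  expansion q p ι inj = ≡.subst (λ q → Φ p q ι ≈ 0#) (reverse-involutive q)
    -- Boxes are removed from μ, whose frame is the reverse of the bottom word; hence the induction
    -- runs over the reversed word.
    (lowering-rec (λ q → ∀ p ι → Injection ι → Φ p (reverse q) ι ≈ 0#) Φ-base
      (λ i q (out , in′) rec p ι inj → ≡.subst (λ q → Φ p q ι ≈ 0#) (reverse-swapAt i q)
        (Φ-step (mirror i) (reverse q) (≡.trans (entryˡ-mirror i q) in′ , ≡.trans (entryʳ-mirror i q) out) rec p ι inj))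
      (reverse q) p ι inj)

  Relation : (Subset n → Carrier) → Set
  Relation c = ∀ ι → Injection ι → ∑ (subsets n) (λ r → c r * h r ι) ≈ 0#

  h-sorted : ∀ {r v} → Sorted r → Enum r v → (h r (lookup v) ≈ 1#) × (∀ x → x ≢ r → h x (lookup v) ≈ 0#)
  h-sorted {r} {v} sorted e
    with v₀ , e₀ ← enum (reverse r) (≡.trans (∣reverse∣ r) (∣enum∣ e))
    with π , eq ← enum-reverse e e₀ =
    trans (ren-cong opposite (trans (toward r) (g-descending-on desc e₀))) (ren-1 opposite) ,
    λ x x≢r → trans (ren-cong opposite (trans (toward x)
      (g-descending-off desc e₀ (reverse x) (x≢r ∘ reverse-injective)))) (ren-0 opposite)
    where
    desc = descending-reverse sorted
    toward : ∀ x → g (reverse x) (opposite ∘ lookup v) ≈ g (reverse x) (lookup v₀)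
    toward x = trans (g-ext (reverse x) λ a → ≡.sym (eq a)) (g-permute (reverse x) (lookup v₀) π)

  -- Reflecting a relation and transposing the matrix gives a second relation c′, whose coefficient
  -- at r combines those of c at r and at `swapAt i r`. The induction must therefore cover all
  -- relations: applied to c and to c′, it leaves 1 - t times the wanted coefficient.
  independence : ∀ r c → Relation c → ∣ r ∣ ≡ k → c r ≈ 0#
  independence = lowering-rec (λ r → ∀ c → Relation c → ∣ r ∣ ≡ k → c r ≈ 0#)
    (λ r sorted c rel ∣r∣≡k → let (v , e) = enum r ∣r∣≡k
                                  (on , off′) = h-sorted sorted e in begin
      c r                                              ≈⟨ *-identityʳ (c r) ⟨
      c r * 1#                                         ≈⟨ *-congˡ on ⟨
      c r * h r (lookup v)                             ≈⟨ ∑-single r _ (λ x x≢r → trans (*-congˡ (off′ x x≢r)) (zeroʳ _)) ⟨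
      ∑ (subsets n) (λ x → c x * h x (lookup v))       ≈⟨ rel (lookup v) (enum-injective e) ⟩
      0#                                               ∎)
    step
    where
    step : ∀ i r → Raised i r → (∀ c → Relation c → ∣ r ∣ ≡ k → c r ≈ 0#) →
           ∀ c → Relation c → ∣ swapAt i r ∣ ≡ k → c (swapAt i r) ≈ 0#
    step i r (out-r , in-r) rec c rel ∣r′∣≡k = begin
      c r′                                ≈⟨ trans (ren-∘ (τ i) (τ i) _) (trans (ren-≗ (τ-involutive i) _) (ren-id _)) ⟨
      ren (τ i) (ren (τ i) (c r′))        ≈⟨ ren-cong (τ i) (cancel-1-w (left≢right i) _ vanishes) ⟩
      ren (τ i) 0#                        ≈⟨ ren-0 (τ i) ⟩
      0#                                  ∎
      where
      t = w (right i) (left i)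
      r′ = swapAt i r
      ∣r∣≡k = ≡.trans (≡.sym (∣swapAt∣ i r)) ∣r′∣≡k
      c′ : Subset n → Carrier
      c′ = actᵀ i ruleᵃ leftState t (ren (τ i) ∘ c)
      τ-injective : ∀ {a b} → τ i a ≡ τ i b → a ≡ b
      τ-injective eq = ≡.trans (≡.sym (τ-involutive i _)) (≡.trans (≡.cong (τ i) eq) (τ-involutive i _))
      rel′ : Relation c′
      rel′ ι inj = begin
        ∑ (subsets n) (λ x → c′ x * h x ι)
          ≈⟨ ∑-actᵀ i ruleᵃ leftState t (ren (τ i) ∘ c) (λ x → h x ι) ⟩
        ∑ (subsets n) (λ x → ren (τ i) (c x) * act i ruleᵃ leftState t (λ x → h x ι) x)
          ≈⟨ ∑-cong (subsets n) (λ x → trans (ren-* (τ i) _ _) (*-congˡ (h-relation i x ι))) ⟨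
        ∑ (subsets n) (λ x → ren (τ i) (c x * h x (τ i ∘ ι)))
          ≈⟨ ren-∑ (τ i) (subsets n) _ ⟨
        ren (τ i) (∑ (subsets n) (λ x → c x * h x (τ i ∘ ι)))
          ≈⟨ ren-cong (τ i) (rel (τ i ∘ ι) (inj ∘ τ-injective)) ⟩
        ren (τ i) 0#
          ≈⟨ ren-0 (τ i) ⟩
        0# ∎
      c′r : 1# * ren (τ i) (c r) + (1# - t) * ren (τ i) (c r′) ≈ 0#
      c′r = trans (reflexive (≡.cong₂ (λ x z → diag (ruleᵃ (leftState x) (leftState z)) t * ren (τ i) (c r) +
                                               off (ruleᵃ (leftState z) (leftState x)) t * ren (τ i) (c r′)) (≡.sym out-r) (≡.sym in-r)))
                  (rec c′ rel′ ∣r∣≡k)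
      vanishes : (1# - t) * ren (τ i) (c r′) ≈ 0#
      vanishes = begin
        (1# - t) * ren (τ i) (c r′)
          ≈⟨ solve 1 (λ x → x := con 1ℤ :* con 0ℤ :+ x) refl _ ⟩
        1# * 0# + (1# - t) * ren (τ i) (c r′)
          ≈⟨ +-congʳ (*-congˡ (trans (ren-cong (τ i) (rec c rel ∣r∣≡k)) (ren-0 (τ i)))) ⟨
        1# * ren (τ i) (c r) + (1# - t) * ren (τ i) (c r′)
          ≈⟨ c′r ⟩
        0# ∎

  module _ (p q : Subset n) (d : Subset n → Carrier) where
    Expands : (Fin k → Fin n) → Set
    Expands ι = g p ι * h q ι - ∑ (subsets n) (λ r → d r * h r ι) ≈ 0#

    expands : (∀ r → ∣ r ∣ ≡ k → d r ≈ Z labels r p q) → ∀ ι → Injection ι → Expands ι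
    expands d≈Z ι inj = trans (+-congˡ (-‿cong (∑-cong (subsets n) term))) (expansion q p ι inj)
      where
      term : ∀ r → d r * h r ι ≈ Z labels r p q * h r ι
      term r with ∣ r ∣ ℕ.≟ k
      ... | yes eq = *-congʳ (d≈Z r eq)
      ... | no ne  = trans (*-congˡ (h-out r ne ι)) (trans (zeroʳ _) (sym (trans (*-congˡ (h-out r ne ι)) (zeroʳ _))))

    coefficients : (∀ ι → (∀ {a b} → a Fin.< b → ι a Fin.< ι b) → Expands ι) →
                   ∀ r → ∣ r ∣ ≡ k → d r ≈ Z labels r p q
    coefficients hyp r eq = x∙y⁻¹≈ε⇒x≈y _ _ (independence r (λ r → d r - Z labels r p q) rel eq)
      where
      rel : Relation (λ r → d r - Z labels r p q)
      rel ι inj with S , v , e , π , eq ← enum-image ι inj = begin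
        ∑ (subsets n) (λ r → (d r - Z labels r p q) * h r ι)
          ≈⟨ ∑-cong (subsets n) (λ r → *-congˡ (trans (h-ext r (λ a → ≡.sym (eq a))) (h-permute r (lookup v) π))) ⟩
        ∑ (subsets n) (λ r → (d r - Z labels r p q) * h r (lookup v))
          ≈⟨ ∑-cong (subsets n) (λ r → solve 3 (λ a b c → (a :- b) :* c := (b :* c) :* con (ℤ.- 1ℤ) :+ con 1ℤ :* (a :* c)) refl (d r) (Z labels r p q) (h r (lookup v))) ⟩
        ∑ (subsets n) (λ r → (Z labels r p q * h r (lookup v)) * - 1# + 1# * (d r * h r (lookup v)))
          ≈⟨ trans (∑-+ (subsets n) _ _) (+-cong (∑-*ʳ (subsets n) (- 1#) _) (∑-*ˡ (subsets n) 1# _)) ⟩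
        A * - 1# + 1# * B
          ≈⟨ solve 3 (λ a b x → a :* con (ℤ.- 1ℤ) :+ con 1ℤ :* b := (x :- a) :- (x :- b)) refl A B (g p (lookup v) * h q (lookup v)) ⟩
        Φ p q (lookup v) - (g p (lookup v) * h q (lookup v) - B)
          ≈⟨ +-cong (expansion q p (lookup v) (enum-injective e)) (-‿cong (hyp (lookup v) (enum-increasing e))) ⟩
        0# - 0#
          ≈⟨ -‿inverseʳ 0# ⟩
        0# ∎
        where
        A = ∑ (subsets n) (λ r → Z labels r p q * h r (lookup v))
        B = ∑ (subsets n) (λ r → d r * h r (lookup v))

-- Frames and subsets

sorted-∈⁺ : ∀ {p : Subset n} → Sorted p → ∀ i → lookup p i ≡ inside → n ∸ ∣ p ∣ ≤ toℕ i
sorted-∈⁺ (allInside {n}) i _ = ≡.subst (_≤ toℕ i) (≡.sym (≡.trans (≡.cong (n ∸_) (∣⊤∣≡n n)) (ℕ.n∸n≡0 n))) z≤n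
sorted-∈⁺ (outside∷_ {n} {p} sorted) (suc i) i∈p =
  ≡.subst (_≤ suc (toℕ i)) (≡.sym (ℕ.+-∸-assoc 1 (∣p∣≤n p))) (s≤s (sorted-∈⁺ sorted i i∈p))

sorted-∈⁻ : ∀ {p : Subset n} → Sorted p → ∀ i → n ∸ ∣ p ∣ ≤ toℕ i → lookup p i ≡ inside
sorted-∈⁻ (allInside {n}) i _ = Vec.lookup-replicate i inside
sorted-∈⁻ (outside∷_ {n} {p} sorted) zero le
  with () ← ≡.subst (_≤ 0) (ℕ.+-∸-assoc 1 (∣p∣≤n p)) le
sorted-∈⁻ (outside∷_ {n} {p} sorted) (suc i) le =
  sorted-∈⁻ sorted i (ℕ.s≤s⁻¹ (≡.subst (_≤ suc (toℕ i)) (ℕ.+-∸-assoc 1 (∣p∣≤n p)) le))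

sorted⇒full : ∀ {p : Subset n} → Sorted p → (eq : ∣ p ∣ ≡ k) → IsFullRectangle {n} {k} (p , eq)
sorted⇒full {p = p} sorted ≡.refl i =
  mk⇔ (sorted-∈⁺ sorted i ∘ []=⇒lookup) (lookup⇒[]= i p ∘ sorted-∈⁻ sorted i)

raised⇒lowers : ∀ (i : Adj n) q → Raised i q → (eq : ∣ q ∣ ≡ k) (eq′ : ∣ swapAt i q ∣ ≡ k) →
                Lowers {n} {k} (left i) (right i) (q , eq) (swapAt i q , eq′)
raised⇒lowers i q (out , in′) eq eq′ =
  toℕ-right i , lookup⇒[]= (right i) q q-right ,
  (λ l∈q → contradiction (≡.trans (≡.sym ([]=⇒lookup l∈q)) q-left) λ ()) ,
  lookup-ext λ j → ≡.trans (lookup-swapAt i q j) (≡.sym (entries j))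
  where
  q-left = ≡.trans (≡.sym (entryˡ-lookup i q)) out
  q-right = ≡.trans (≡.sym (entryʳ-lookup i q)) in′
  q₁ = q [ right i ]≔ outside
  entries : ∀ j → lookup (q [ right i ]≔ outside [ left i ]≔ inside) j ≡ lookup q (τ i j)
  entries j with j Fin.≟ left i
  ... | yes ≡.refl = ≡.trans (lookup∘update (left i) q₁ inside) (≡.sym (≡.trans (≡.cong (lookup q) (τ-left i)) q-right))
  ... | no j≢l with j Fin.≟ right i
  ...   | yes ≡.refl = ≡.trans (lookup∘update′ j≢l q₁ inside) (≡.trans (lookup∘update (right i) q outside)
                         (≡.sym (≡.trans (≡.cong (lookup q) (τ-right i)) q-left)))
  ...   | no j≢r     = ≡.trans (lookup∘update′ j≢l q₁ inside) (≡.trans (lookup∘update′ j≢r q outside)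
                         (≡.cong (lookup q) (≡.sym (τ-other i j j≢l j≢r))))

module FrameSums (R : CommutativeRing 0ℓ 0ℓ) where
  open CommutativeRing R hiding (zero)
  open RingTools R
  open SubsetSums R
  open Products R
  open import Relation.Binary.Reasoning.Setoid setoid

  -- The non-elements of a sorted word are its first positions.
  product-inject≤ : ∀ {p : Subset n} → Sorted p → ∀ m (m≤n : m ≤ n) → m ℕ.+ ∣ p ∣ ≡ n → ∀ f →
    product (λ (j : Fin m) → f (inject≤ j m≤n)) ≈ outsideProduct p f
  product-inject≤ (allInside {n}) zero m≤n eq f = sym (outsideProduct-allInside n f)
  product-inject≤ (allInside {n}) (suc m) m≤n eq f =
    contradiction (≡.trans (≡.cong (λ l → suc m ℕ.+ l) (≡.sym (∣⊤∣≡n n))) eq) (ℕ.m+1+n≢n _ ∘ λ e → ≡.trans (ℕ.+-suc m n) e)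
  product-inject≤ (outside∷_ {n} {p} sorted) zero m≤n eq f =
    contradiction (∣p∣≤n p) (ℕ.<⇒≱ (ℕ.≤-reflexive (≡.sym eq)))
  product-inject≤ (outside∷ sorted) (suc m) (s≤s m≤n) eq f =
    *-congˡ (product-inject≤ sorted m m≤n (ℕ.suc-injective eq) (f ∘ suc))

  extend : (Frame n k → Carrier) → Subset n → Carrier
  extend {k = k} F p with ∣ p ∣ ℕ.≟ k
  ... | yes eq = F (p , eq)
  ... | no _   = 0#

  extend-yes : ∀ (F : Frame n k → Carrier) p (eq : ∣ p ∣ ≡ k) → extend F p ≡ F (p , eq)
  extend-yes {k = k} F p eq with ∣ p ∣ ℕ.≟ k
  ... | yes eq′ = ≡.cong (λ e → F (p , e)) (ℕ.≡-irrelevant eq′ eq)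
  ... | no ne   = contradiction eq ne

  extend-no : ∀ (F : Frame n k → Carrier) p → ∣ p ∣ ≢ k → extend F p ≡ 0#
  extend-no {k = k} F p ne with ∣ p ∣ ℕ.≟ k
  ... | yes eq = contradiction eq ne
  ... | no _   = ≡.refl

  ∑-frames : ∀ n k (F : Frame n k → Carrier) → ∑ (frames n k) F ≈ ∑ (subsets n) (extend F)
  ∑-frames n k F = go (subsets n)
    where
    frame : Subset n → Maybe (Frame n k)
    frame p = Maybe.map (p ,_) (dec⇒maybe (∣ p ∣ ℕ.≟ k))
    go : ∀ ps → ∑ (mapMaybe frame ps) F ≈ ∑ ps (extend F)
    go []       = refl
    go (p ∷ ps) with ∣ p ∣ ℕ.≟ k
    ... | yes eq = +-congˡ (go ps)
    ... | no _   = trans (go ps) (sym (+-identityˡ _))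

  _≟ᵖ_ : (p q : Subset n) → Dec (p ≡ q)
  _≟ᵖ_ = ≡-dec Bool._≟_

  -- Both sides equal the sum of F r over the pairs p, r with r = reverse p, summed first over r or
  -- first over p.
  ∑-reverse : ∀ {n} (F : Subset n → Carrier) → ∑ (subsets n) (F ∘ reverse) ≈ ∑ (subsets n) F
  ∑-reverse {n} F = begin
    ∑ (subsets n) (λ p → F (reverse p))
      ≈⟨ ∑-cong (subsets n) (λ p → trans
           (∑-single (reverse p) _ λ r r≢p → when-no (r ≟ᵖ reverse p) r≢p (F r))
           (when-yes (reverse p ≟ᵖ reverse p) ≡.refl _)) ⟨
    ∑ (subsets n) (λ p → ∑ (subsets n) λ r → when (r ≟ᵖ reverse p) (F r))
      ≈⟨ ∑-comm (subsets n) (subsets n) _ ⟩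
    ∑ (subsets n) (λ r → ∑ (subsets n) λ p → when (r ≟ᵖ reverse p) (F r))
      ≈⟨ ∑-cong (subsets n) (λ r → trans
           (∑-single (reverse r) _ λ p p≢r → when-no (r ≟ᵖ reverse p) (λ { ≡.refl → p≢r (≡.sym (reverse-involutive p)) }) (F r))
           (when-yes (r ≟ᵖ reverse (reverse r)) (≡.sym (reverse-involutive r)) (F r))) ⟩
    ∑ (subsets n) F ∎

-- Polynomials and their specialisations

module Specialisation (𝓛 : LaurentTheory) (n k : ℕ) where
  open LaurentTheory 𝓛
  open Renaming 𝓛
  private
    module A = CommutativeRing (laurent (k ℕ.+ n))
    module B = CommutativeRing (laurent n)

  x : Fin k → A.Carrier
  x i = Y (i ↑ˡ n)

  y y⁻¹ : Fin n → A.Carrier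
  y   j = Y (k ↑ʳ j)
  y⁻¹ j = Y⁻¹ (k ↑ʳ j)

  onX : (Fin k → Fin k) → Fin (k ℕ.+ n) → Fin (k ℕ.+ n)
  onX σ = join k n ∘ Sum.map₁ σ ∘ splitAt k

  onY : (Fin n → Fin n) → Fin (k ℕ.+ n) → Fin (k ℕ.+ n)
  onY σ = join k n ∘ Sum.map₂ σ ∘ splitAt k

  at : (Fin k → Fin n) → Fin (k ℕ.+ n) → Fin n
  at ι = Sum.[ ι , id ]′ ∘ splitAt k

  mapX : (Fin k → Fin k) → A.Carrier → A.Carrier
  mapX σ = ren (onX σ)

  mapY : (Fin n → Fin n) → A.Carrier → A.Carrier
  mapY σ = ren (onY σ)

  specialize : (Fin k → Fin n) → A.Carrier → B.Carrier
  specialize ι = ren (at ι)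

  fromY : B.Carrier → A.Carrier
  fromY = ren (k ↑ʳ_)

  on-splits : ∀ {m} {ρ σ : Fin (k ℕ.+ n) → Fin m} → (∀ a → ρ (a ↑ˡ n) ≡ σ (a ↑ˡ n)) → (∀ j → ρ (k ↑ʳ j) ≡ σ (k ↑ʳ j)) →
              ∀ i → ρ i ≡ σ i
  on-splits {ρ = ρ} {σ} onˡ onʳ i = ≡.subst (λ i → ρ i ≡ σ i) (Fin.join-splitAt k n i) (go (splitAt k i))
    where
    go : ∀ s → ρ (join k n s) ≡ σ (join k n s)
    go (inj₁ a) = onˡ a
    go (inj₂ j) = onʳ j

  onX-x : ∀ σ a → onX σ (a ↑ˡ n) ≡ σ a ↑ˡ n
  onX-x σ a = ≡.cong (join k n ∘ Sum.map₁ σ) (Fin.splitAt-↑ˡ k a n)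

  onX-y : ∀ σ j → onX σ (k ↑ʳ j) ≡ k ↑ʳ j
  onX-y σ j = ≡.cong (join k n ∘ Sum.map₁ σ) (Fin.splitAt-↑ʳ k n j)

  onY-x : ∀ σ a → onY σ (a ↑ˡ n) ≡ a ↑ˡ n
  onY-x σ a = ≡.cong (join k n ∘ Sum.map₂ σ) (Fin.splitAt-↑ˡ k a n)

  onY-y : ∀ σ j → onY σ (k ↑ʳ j) ≡ k ↑ʳ σ j
  onY-y σ j = ≡.cong (join k n ∘ Sum.map₂ σ) (Fin.splitAt-↑ʳ k n j)

  at-x : ∀ ι a → at ι (a ↑ˡ n) ≡ ι a
  at-x ι a = ≡.cong Sum.[ ι , id ]′ (Fin.splitAt-↑ˡ k a n)

  at-y : ∀ ι j → at ι (k ↑ʳ j) ≡ j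
  at-y ι j = ≡.cong Sum.[ ι , id ]′ (Fin.splitAt-↑ʳ k n j)

  specialize-ext : ∀ {ι κ} → (∀ a → ι a ≡ κ a) → ∀ f → specialize ι f B.≈ specialize κ f
  specialize-ext {ι} {κ} eq = ren-≗ (on-splits
    (λ a → ≡.trans (at-x ι a) (≡.trans (eq a) (≡.sym (at-x κ a))))
    (λ j → ≡.trans (at-y ι j) (≡.sym (at-y κ j))))

  specialize-fromY : ∀ ι f → specialize ι (fromY f) B.≈ f
  specialize-fromY ι f = B.trans (ren-∘ (at ι) (k ↑ʳ_) f) (B.trans (ren-≗ (at-y ι) f) (ren-id f))

  -- `mapY` leaves the x's alone, whereas `ren σ` after specialisation also moves the y's put in
  -- their place; composing ι with the involution σ compensates for this. It is the origin of the
  -- formula for `s`.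
  specialize-mapY : ∀ ι {σ} → (∀ j → σ (σ j) ≡ j) → ∀ f → specialize ι (mapY σ f) B.≈ ren σ (specialize (σ ∘ ι) f)
  specialize-mapY ι {σ} inv f = B.trans (ren-∘ (at ι) (onY σ) f) (B.trans (ren-≗ (on-splits
    (λ a → ≡.trans (≡.cong (at ι) (onY-x σ a)) (≡.trans (at-x ι a) (≡.trans (≡.sym (inv (ι a))) (≡.cong σ (≡.sym (at-x (σ ∘ ι) a))))))
    (λ j → ≡.trans (≡.cong (at ι) (onY-y σ j)) (≡.trans (at-y ι (σ j)) (≡.cong σ (≡.sym (at-y (σ ∘ ι) j)))))) f)
    (B.sym (ren-∘ σ (at (σ ∘ ι)) f)))

  mapX-mapY : ∀ π σ f → mapX π (mapY σ f) A.≈ mapY σ (mapX π f)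
  mapX-mapY π σ f = A.trans (ren-∘ (onX π) (onY σ) f) (A.trans (ren-≗ (on-splits
    (λ a → ≡.trans (≡.cong (onX π) (onY-x σ a)) (≡.trans (onX-x π a) (≡.sym (≡.trans (≡.cong (onY σ) (onX-x π a)) (onY-x σ (π a))))))
    (λ j → ≡.trans (≡.cong (onX π) (onY-y σ j)) (≡.trans (onX-y π (σ j)) (≡.sym (≡.trans (≡.cong (onY σ) (onX-y π j)) (onY-y σ j)))))) f)
    (A.sym (ren-∘ (onY σ) (onX π) f)))

  mapX-fromY : ∀ π f → mapX π (fromY f) A.≈ fromY f
  mapX-fromY π f = A.trans (ren-∘ (onX π) (k ↑ʳ_) f) (ren-≗ (onX-y π) f)

  mapY-cong-≗ : ∀ {σ τ} → (∀ j → σ j ≡ τ j) → ∀ f → mapY σ f A.≈ mapY τ f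
  mapY-cong-≗ {σ} {τ} eq = ren-≗ (on-splits
    (λ a → ≡.trans (onY-x σ a) (≡.sym (onY-x τ a)))
    (λ j → ≡.trans (onY-y σ j) (≡.trans (≡.cong (k ↑ʳ_) (eq j)) (≡.sym (onY-y τ j)))))

  Symmetric : A.Carrier → Set
  Symmetric f = (π : Permutation′ k) → mapX (π ⟨$⟩ʳ_) f A.≈ f

  symmetric-+ : ∀ {f g} → Symmetric f → Symmetric g → Symmetric (f A.+ g)
  symmetric-+ sf sg π = A.trans (ren-+ _ _ _) (A.+-cong (sf π) (sg π))

  symmetric-- : ∀ {f g} → Symmetric f → Symmetric g → Symmetric (f A.- g)
  symmetric-- sf sg π = A.trans (ren-sub _ _ _) (A.+-cong (sf π) (A.-‿cong (sg π)))

  symmetric-* : ∀ {f g} → Symmetric f → Symmetric g → Symmetric (f A.* g)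
  symmetric-* sf sg π = A.trans (ren-* _ _ _) (A.*-cong (sf π) (sg π))

  symmetric-∑ : ∀ {A : Set} (xs : List A) f → (∀ x → Symmetric (f x)) → Symmetric (RingTools.∑ (laurent (k ℕ.+ n)) xs f)
  symmetric-∑ []       f sf π = ren-0 _
  symmetric-∑ (x ∷ xs) f sf   = symmetric-+ (sf x) (symmetric-∑ xs f sf)

  symmetric-mapY : ∀ σ {f} → Symmetric f → Symmetric (mapY σ f)
  symmetric-mapY σ sf π = A.trans (mapX-mapY _ σ _) (ren-cong (onY σ) (sf π))

  module FrameFamily (G : Frame n k → A.Carrier)
    (G-full : ∀ κ → IsFullRectangle κ → G κ A.≈
      Products.product (laurent (k ℕ.+ n)) λ (i : Fin k) → Products.product (laurent (k ℕ.+ n)) λ (j : Fin (n ∸ k)) →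
        A.1# A.- x i A.* y⁻¹ (inject≤ j (ℕ.m∸n≤m n k)))
    (G-lower : ∀ i i⁺ κ ν → Lowers i i⁺ κ ν →
      (y i A.- y i⁺) A.* G ν A.≈ y i A.* G κ A.- y i⁺ A.* mapY (transpose i i⁺) (G κ)) where

    open Products using (product)

    factor : Fin k → Fin (n ∸ k) → A.Carrier
    factor i j = A.1# A.- x i A.* y⁻¹ (inject≤ j (ℕ.m∸n≤m n k))

    rowProduct : Fin k → A.Carrier
    rowProduct i = product (laurent (k ℕ.+ n)) (factor i)

    open FrameSums (laurent (k ℕ.+ n)) using (extend; extend-yes; extend-no)

    Ĝ : Subset n → A.Carrier
    Ĝ = extend G

    Ĝ-full : ∀ p → Sorted p → ∣ p ∣ ≡ k → Ĝ p A.≈ product (laurent (k ℕ.+ n)) rowProduct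
    Ĝ-full p sorted eq = A.trans (A.reflexive (extend-yes G p eq)) (G-full (p , eq) (sorted⇒full sorted eq))

    Ĝ-lower : ∀ i q → Raised i q →
      (y (left i) A.- y (right i)) A.* Ĝ (swapAt i q) A.≈ y (left i) A.* Ĝ q A.- y (right i) A.* mapY (τ i) (Ĝ q)
    Ĝ-lower i q raised with ∣ q ∣ ℕ.≟ k
    ... | no ne  = A.trans
      (A.trans (A.*-congˡ (A.reflexive (extend-no G (swapAt i q) (ne ∘ ≡.trans (≡.sym (∣swapAt∣ i q)))))) (A.zeroʳ _))
      (A.sym (A.trans (A.+-cong (A.zeroʳ _) (A.-‿cong (A.trans (A.*-congˡ (ren-0 _)) (A.zeroʳ _)))) (A.-‿inverseʳ A.0#)))
    ... | yes eq = A.trans (A.*-congˡ (A.reflexive (extend-yes G (swapAt i q) eq′)))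
      (A.trans (G-lower (left i) (right i) (q , eq) (swapAt i q , eq′) (raised⇒lowers i q raised eq eq′))
               (A.+-congˡ (A.-‿cong (A.*-congˡ (mapY-cong-≗ (transpose≗τ i) (G (q , eq)))))))
      where eq′ = ≡.trans (∣swapAt∣ i q) eq

    g : Subset n → (Fin k → Fin n) → B.Carrier
    g p ι = specialize ι (Ĝ p)

    ren-1-x/y : ∀ {m} (ρ : Fin (k ℕ.+ n) → Fin m) i j {a b} → ρ i ≡ a → ρ j ≡ b →
      ren ρ (A.1# A.- Y i A.* Y⁻¹ j) R.≈ R.1# R.- Y a R.* Y⁻¹ b
    ren-1-x/y ρ i j ≡.refl ≡.refl = R.trans (ren-sub ρ _ _)
      (R.+-cong (ren-1 ρ) (R.-‿cong (R.trans (ren-* ρ _ _) (R.*-cong (ren-Y ρ i) (ren-Y⁻¹ ρ j)))))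

    isFamily : Family.IsGrothendieckFamily 𝓛 n k g
    isFamily = record
      { g-ext   = λ p eq → specialize-ext eq (Ĝ p)
      ; g-out   = λ p ne ι → B.trans (ren-cong (at ι) (A.reflexive (extend-no G p ne))) (ren-0 (at ι))
      ; g-full  = full
      ; g-lower = lower
      }
      where
      full : ∀ p → Sorted p → ∣ p ∣ ≡ k → ∀ ι → g p ι B.≈
        product (laurent n) λ a → Products.outsideProduct (laurent n) p λ j → B.1# B.- Y (ι a) B.* Y⁻¹ j
      full p sorted eq ι = B.trans (ren-cong (at ι) (Ĝ-full p sorted eq)) (B.trans (ren-product (at ι) rowProduct)
        (Products.product-cong (laurent n) λ a → B.trans (ren-product (at ι) (factor a)) (B.trans
          (Products.product-cong (laurent n) λ j → ren-1-x/y (at ι) (a ↑ˡ n) (k ↑ʳ inject≤ j (ℕ.m∸n≤m n k)) (at-x ι a) (at-y ι _))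
          (FrameSums.product-inject≤ (laurent n) sorted (n ∸ k) (ℕ.m∸n≤m n k)
            (≡.trans (≡.cong (n ∸ k ℕ.+_) eq) (ℕ.m∸n+n≡m (≡.subst (_≤ n) eq (∣p∣≤n p)))) λ j → B.1# B.- Y (ι a) B.* Y⁻¹ j))))
      lower : ∀ i q → Raised i q → ∀ ι →
        (Y (left i) B.- Y (right i)) B.* g (swapAt i q) ι B.≈
        Y (left i) B.* g q ι B.- Y (right i) B.* ren (τ i) (g q (τ i ∘ ι))
      lower i q raised ι = B.trans
        (B.sym (B.trans (ren-* (at ι) _ _) (B.*-congʳ (B.trans (ren-sub (at ι) _ _) (B.+-cong (at-Y (left i)) (B.-‿cong (at-Y (right i))))))))
        (B.trans (ren-cong (at ι) (Ĝ-lower i q raised))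
        (B.trans (ren-sub (at ι) _ _) (B.+-cong
          (B.trans (ren-* (at ι) _ _) (B.*-congʳ (at-Y (left i))))
          (B.-‿cong (B.trans (ren-* (at ι) _ _) (B.*-cong (at-Y (right i)) (specialize-mapY ι (τ-involutive i) (Ĝ q))))))))
        where
        at-Y : ∀ j → specialize ι (y j) B.≈ Y j
        at-Y j = B.trans (ren-Y (at ι) (k ↑ʳ j)) (B.reflexive (≡.cong Y (at-y ι j)))

    cancelᴬ : ∀ {i j} → i ≢ j → ∀ {f f′} → (Y i A.- Y j) A.* f A.≈ (Y i A.- Y j) A.* f′ → f A.≈ f′
    cancelᴬ {i} {j} i≢j {f} {f′} eq = x∙y⁻¹≈ε⇒x≈y f f′ (cancel i≢j (f A.- f′)
      (A.trans (solve 3 (λ c f g → c :* (f :- g) := c :* f :- c :* g) A.refl (Y i A.- Y j) f f′)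
      (A.trans (A.+-congʳ eq) (A.-‿inverseʳ _))))
      where
      open import Algebra.Properties.Group A.+-group using (x∙y⁻¹≈ε⇒x≈y)
      open RingTools (laurent (k ℕ.+ n)) using (solve; _:*_; _:-_; _:=_)

    -- Equality in K_T demands invariance of the polynomials themselves, which `g-permute`, a
    -- statement about values, does not give. The induction over removed boxes is repeated on
    -- polynomials.
    Ĝ-symmetric : ∀ p → Symmetric (Ĝ p)
    Ĝ-symmetric = lowering-rec (Symmetric ∘ Ĝ) base step
      where
      base : ∀ p → Sorted p → Symmetric (Ĝ p)
      base p sorted π with ∣ p ∣ ℕ.≟ k
      ... | no ne  = ren-0 _
      ... | yes eq = A.trans (ren-cong _ (G-full (p , eq) (sorted⇒full sorted eq))) (A.trans (ren-product (onX (π ⟨$⟩ʳ_)) rowProduct)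
        (A.trans (Products.product-cong (laurent (k ℕ.+ n)) λ a → A.trans (ren-product (onX (π ⟨$⟩ʳ_)) (factor a))
          (Products.product-cong (laurent (k ℕ.+ n)) λ j → ren-1-x/y (onX (π ⟨$⟩ʳ_)) (a ↑ˡ n) (k ↑ʳ inject≤ j (ℕ.m∸n≤m n k)) (onX-x _ a) (onX-y _ _)))
        (A.trans (A.sym (Products.product-permute (laurent (k ℕ.+ n)) rowProduct π))
          (A.sym (G-full (p , eq) (sorted⇒full sorted eq))))))
      step : ∀ i q → Raised i q → Symmetric (Ĝ q) → Symmetric (Ĝ (swapAt i q))
      step i q raised sq π = cancelᴬ (left≢right i ∘ Fin.↑ʳ-injective k _ _)
        (A.trans (A.*-congʳ (A.sym yl-yr)) (A.trans (A.sym (ren-* ρ _ _))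
        (A.trans (ren-cong ρ (Ĝ-lower i q raised)) (A.trans (ren-sub ρ _ _)
        (A.trans (A.+-cong (A.trans (ren-* ρ _ _) (A.*-cong (fixY (left i)) (sq π)))
                           (A.-‿cong (A.trans (ren-* ρ _ _) (A.*-cong (fixY (right i)) (symmetric-mapY (τ i) sq π)))))
        (A.sym (Ĝ-lower i q raised)))))))
        where
        ρ = onX (π ⟨$⟩ʳ_)
        fixY : ∀ j → ren ρ (y j) A.≈ y j
        fixY j = A.trans (ren-Y ρ (k ↑ʳ j)) (A.reflexive (≡.cong Y (onX-y _ j)))
        yl-yr : ren ρ (y (left i) A.- y (right i)) A.≈ y (left i) A.- y (right i)
        yl-yr = A.trans (ren-sub ρ _ _) (A.+-cong (fixY (left i)) (A.-‿cong (fixY (right i))))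

    G-symmetric : ∀ κ → Symmetric (G κ)
    G-symmetric (p , eq) = ≡.subst Symmetric (extend-yes G p eq) (Ĝ-symmetric p)

    open Expansion 𝓛 n k g isFamily using (h; h-out; Z; Injection; expands; coefficients)
    open Family.Properties 𝓛 n k g isFamily using (labels)

    module Coefficients (κ μ : Frame n k) (d : Frame n k → B.Carrier) where
      open RingTools using (∑)

      difference : A.Carrier
      difference = G κ A.* mapY opposite (G μ) A.- ∑ (laurent (k ℕ.+ n)) (frames n k) λ ν → fromY (d ν) A.* mapY opposite (G ν)

      puzzleAmplitude : Frame n k → B.Carrier
      puzzleAmplitude ν = Z labels (reverse (proj₁ ν)) (proj₁ κ) (reverse (proj₁ μ))

      -- Reversed to match the indexing of h, and extended by 0 to all subsets.
      d̃ : Subset n → B.Carrier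
      d̃ r = FrameSums.extend (laurent n) d (reverse r)

      specialize-reverse : ∀ ν ι → specialize ι (mapY opposite (G ν)) B.≈ h (reverse (proj₁ ν)) ι
      specialize-reverse (p , eq) ι = B.trans (specialize-mapY ι Fin.opposite-involutive (G (p , eq)))
        (ren-cong opposite (ren-cong (at (opposite ∘ ι)) (A.reflexive
          (≡.trans (≡.sym (extend-yes G p eq)) (≡.cong Ĝ (≡.sym (reverse-involutive p)))))))

      specialize-difference : ∀ ι → specialize ι difference B.≈
        g (proj₁ κ) ι B.* h (reverse (proj₁ μ)) ι B.- ∑ (laurent n) (subsets n) λ r → d̃ r B.* h r ι
      specialize-difference ι = B.trans (ren-sub (at ι) _ _) (B.+-cong
        (B.trans (ren-* (at ι) _ _) (B.*-cong
          (ren-cong (at ι) (A.reflexive (≡.sym (extend-yes G (proj₁ κ) (proj₂ κ)))))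
          (specialize-reverse μ ι)))
        (B.-‿cong (B.trans (ren-∑ (at ι) (frames n k) _)
          (B.trans (∑-cong (frames n k) λ ν → B.trans (ren-* (at ι) _ _) (B.*-cong (specialize-fromY ι (d ν)) (specialize-reverse ν ι)))
          (B.trans (∑-frames n k term) (B.trans (∑-cong (subsets n) extended)
          (∑-reverse λ r → d̃ r B.* h r ι)))))))
        where
        open RingTools (laurent n) using (∑-cong)
        open FrameSums (laurent n) renaming (extend to extendᴮ; extend-yes to extendᴮ-yes; extend-no to extendᴮ-no)
        term : Frame n k → B.Carrier
        term ν = d ν B.* h (reverse (proj₁ ν)) ι
        extended : ∀ p → extendᴮ term p B.≈ d̃ (reverse p) B.* h (reverse p) ι
        extended p = cases (∣ p ∣ ℕ.≟ k)
          where
          d̃≡ : d̃ (reverse p) ≡ extendᴮ d p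
          d̃≡ = ≡.cong (extendᴮ d) (reverse-involutive p)
          cases : Dec (∣ p ∣ ≡ k) → extendᴮ term p B.≈ d̃ (reverse p) B.* h (reverse p) ι
          cases (yes eq) = B.trans (B.reflexive (extendᴮ-yes term p eq))
            (B.*-congʳ (B.reflexive (≡.sym (≡.trans d̃≡ (extendᴮ-yes d p eq)))))
          cases (no ne)  = B.trans (B.reflexive (extendᴮ-no term p ne)) (B.sym (B.trans
            (B.*-congʳ (B.reflexive (≡.trans d̃≡ (extendᴮ-no d p ne)))) (B.zeroˡ _)))

      d̃-reverse : ∀ p (eq : ∣ p ∣ ≡ k) → d̃ (reverse p) ≡ d (p , eq)
      d̃-reverse p eq = ≡.trans (≡.cong (FrameSums.extend (laurent n) d) (reverse-involutive p))
                               (FrameSums.extend-yes (laurent n) d p eq)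

      left-symmetric : Symmetric (G κ A.* mapY opposite (G μ))
      left-symmetric = symmetric-* (G-symmetric κ) (symmetric-mapY opposite (G-symmetric μ))

      right-symmetric : Symmetric (∑ (laurent (k ℕ.+ n)) (frames n k) λ ν → fromY (d ν) A.* mapY opposite (G ν))
      right-symmetric = symmetric-∑ (frames n k) _ λ ν →
        symmetric-* (λ π → mapX-fromY _ (d ν)) (symmetric-mapY opposite (G-symmetric ν))

      difference-symmetric : Symmetric difference
      difference-symmetric = symmetric-- left-symmetric right-symmetric

      difference-vanishes : (∀ ν → d ν B.≈ puzzleAmplitude ν) → ∀ ι → Injection ι → specialize ι difference B.≈ B.0#
      difference-vanishes d≈ ι inj = B.trans (specialize-difference ι)
        (expands (proj₁ κ) (reverse (proj₁ μ)) d̃ coefficient ι inj)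
        where
        coefficient : ∀ r → ∣ r ∣ ≡ k → d̃ r B.≈ Z labels r (proj₁ κ) (reverse (proj₁ μ))
        coefficient r eq = B.trans (B.reflexive (FrameSums.extend-yes (laurent n) d (reverse r) eq′))
          (B.trans (d≈ (reverse r , eq′)) (B.reflexive (≡.cong (λ r → Z labels r (proj₁ κ) (reverse (proj₁ μ))) (reverse-involutive r))))
          where eq′ = ≡.trans (∣reverse∣ r) eq

      difference-determines : (∀ ι → (∀ {a b} → a Fin.< b → ι a Fin.< ι b) → specialize ι difference B.≈ B.0#) →
        ∀ ν → d ν B.≈ puzzleAmplitude ν
      difference-determines hyp (p , eq) = B.trans (B.reflexive (≡.sym (d̃-reverse p eq)))
        (coefficients (proj₁ κ) (reverse (proj₁ μ)) d̃
          (λ ι inc → B.trans (B.sym (specialize-difference ι)) (hyp ι inc))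
          (reverse p) (≡.trans (∣reverse∣ p) eq))
-- Laurent polynomials

open import Defs using (var; var⁻¹; ∑; _+_; _*_; _-_; -_; _≈_; 0#; 1#)

module LaurentPolynomials where
  open import Relation.Binary.PropositionalEquality using (refl; sym; trans; cong; cong₂)
  open ≡.≡-Reasoning
  open import Data.Integer.Base using (+_)

  -- f ≈ g means equality of the pairings with all indicator functions, but all
  -- pairings then agree (≈⇒≋), and these are easier to compute for products.
  pairing : (Vec ℤ m → ℤ) → Laurent m → ℤ
  pairing φ []            = 0ℤ
  pairing φ ((c , e) ∷ f) = c ℤ.* φ e ℤ.+ pairing φ f

  infix 4 _≋_
  -- Wrapped in a record, so that f and g can be recovered from the type by unification.
  record _≋_ {m} (f g : Laurent m) : Set where
    constructor mk≋
    field pairing≡ : ∀ φ → pairing φ f ≡ pairing φ g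
  open _≋_

  pairing-ext : ∀ {φ ψ : Vec ℤ m → ℤ} f → (∀ e → φ e ≡ ψ e) → pairing φ f ≡ pairing ψ f
  pairing-ext []            φ≗ψ = refl
  pairing-ext ((c , e) ∷ f) φ≗ψ = cong₂ ℤ._+_ (cong (c ℤ.*_) (φ≗ψ e)) (pairing-ext f φ≗ψ)

  pairing-++ : ∀ (φ : Vec ℤ m → ℤ) f g → pairing φ (f ++ g) ≡ pairing φ f ℤ.+ pairing φ g
  pairing-++ φ []            g = sym (ℤ.+-identityˡ _)
  pairing-++ φ ((c , e) ∷ f) g = trans (cong (λ r → c ℤ.* φ e ℤ.+ r) (pairing-++ φ f g)) (sym (ℤ.+-assoc (c ℤ.* φ e) _ _))

  pairing-neg : ∀ (φ : Vec ℤ m → ℤ) f → pairing φ (- f) ≡ ℤ.- pairing φ f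
  pairing-neg φ []            = refl
  pairing-neg φ ((c , e) ∷ f) = trans
    (cong₂ ℤ._+_ (sym (ℤ.neg-distribˡ-* c (φ e))) (pairing-neg φ f))
    (sym (ℤ.neg-distrib-+ (c ℤ.* φ e) _))

  pairing-*ˡ : ∀ c (φ : Vec ℤ m → ℤ) f → pairing (λ e → c ℤ.* φ e) f ≡ c ℤ.* pairing φ f
  pairing-*ˡ c φ []             = sym (ℤ.*-zeroʳ c)
  pairing-*ˡ c φ ((c′ , e) ∷ f) = trans
    (cong (λ r → c′ ℤ.* (c ℤ.* φ e) ℤ.+ r) (pairing-*ˡ c φ f))
    (solve 4 (λ c c′ x r → c′ :* (c :* x) :+ c :* r := c :* (c′ :* x :+ r)) refl c c′ (φ e) (pairing φ f))
    where
    open +-*-Solver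

  pairing-+ : ∀ (φ ψ : Vec ℤ m → ℤ) f → pairing (λ e → φ e ℤ.+ ψ e) f ≡ pairing φ f ℤ.+ pairing ψ f
  pairing-+ φ ψ []            = refl
  pairing-+ φ ψ ((c , e) ∷ f) = trans
    (cong (λ r → c ℤ.* (φ e ℤ.+ ψ e) ℤ.+ r) (pairing-+ φ ψ f))
    (solve 5 (λ c x z r s → c :* (x :+ z) :+ (r :+ s) := (c :* x :+ r) :+ (c :* z :+ s)) refl
      c (φ e) (ψ e) (pairing φ f) (pairing ψ f))
    where
    open +-*-Solver

  pairing-0 : ∀ (f : Laurent m) → pairing (λ _ → 0ℤ) f ≡ 0ℤ
  pairing-0 []            = refl
  pairing-0 ((c , e) ∷ f) = cong₂ ℤ._+_ (ℤ.*-zeroʳ c) (pairing-0 f)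

  pairing-comm : ∀ (θ : Vec ℤ m → Vec ℤ n → ℤ) f g →
    pairing (λ e → pairing (θ e) g) f ≡ pairing (λ e′ → pairing (λ e → θ e e′) f) g
  pairing-comm θ []            g = sym (pairing-0 g)
  pairing-comm θ ((c , e) ∷ f) g = begin
    c ℤ.* pairing (θ e) g ℤ.+ pairing (λ e → pairing (θ e) g) f
      ≡⟨ cong₂ ℤ._+_ (sym (pairing-*ˡ c (θ e) g)) (pairing-comm θ f g) ⟩
    pairing (λ e′ → c ℤ.* θ e e′) g ℤ.+ pairing (λ e′ → pairing (λ e → θ e e′) f) g
      ≡⟨ pairing-+ _ _ g ⟨
    pairing (λ e′ → pairing (λ e → θ e e′) ((c , e) ∷ f)) g ∎

  _⊕_ : Vec ℤ m → Vec ℤ m → Vec ℤ m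
  _⊕_ = zipWith ℤ._+_

  -- With products as iterated pairings, the ring laws reduce to laws of exponent vectors and to
  -- `pairing-comm`.
  pairing-* : ∀ (φ : Vec ℤ m → ℤ) f g →
    pairing φ (f * g) ≡ pairing (λ e → pairing (λ e′ → φ (e ⊕ e′)) g) f
  pairing-* φ []            g = refl
  pairing-* φ ((c , e) ∷ f) g = begin
    pairing φ (monomial g ++ f * g)
      ≡⟨ pairing-++ φ (monomial g) (f * g) ⟩
    pairing φ (monomial g) ℤ.+ pairing φ (f * g)
      ≡⟨ cong₂ ℤ._+_ (pairing-monomial g) (pairing-* φ f g) ⟩
    c ℤ.* pairing (λ e′ → φ (e ⊕ e′)) g ℤ.+ pairing (λ e → pairing (λ e′ → φ (e ⊕ e′)) g) f ∎
    where
    monomial : Laurent _ → Laurent _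
    monomial = List.map (λ (c′ , e′) → c ℤ.* c′ , e ⊕ e′)
    pairing-monomial : ∀ g → pairing φ (monomial g) ≡ c ℤ.* pairing (λ e′ → φ (e ⊕ e′)) g
    pairing-monomial []              = sym (ℤ.*-zeroʳ c)
    pairing-monomial ((c′ , e′) ∷ g) = trans
      (cong₂ ℤ._+_ (ℤ.*-assoc c c′ _) (pairing-monomial g))
      (sym (ℤ.*-distribˡ-+ c (c′ ℤ.* φ (e ⊕ e′)) _))

  pairing-1 : ∀ (φ : Vec ℤ m → ℤ) → pairing φ 1# ≡ φ (replicate m 0ℤ)
  pairing-1 φ = trans (ℤ.+-identityʳ _) (ℤ.*-identityˡ _)

  indicator : Vec ℤ m → Vec ℤ m → ℤ
  indicator e e′ = if does (≡-dec ℤ._≟_ e′ e) then 1ℤ else 0ℤ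

  coeff≡pairing : ∀ (f : Laurent m) e → coeff f e ≡ pairing (indicator e) f
  coeff≡pairing []             e = refl
  coeff≡pairing ((c , e′) ∷ f) e = cong₂ ℤ._+_ term (coeff≡pairing f e)
    where
    term : (if does (≡-dec ℤ._≟_ e′ e) then c else 0ℤ) ≡ c ℤ.* indicator e e′
    term with does (≡-dec ℤ._≟_ e′ e)
    ... | true  = sym (ℤ.*-identityʳ c)
    ... | false = sym (ℤ.*-zeroʳ c)

  ≋⇒≈ : ∀ {f g : Laurent m} → f ≋ g → f ≈ g
  ≋⇒≈ {f = f} {g} f≋g e = trans (coeff≡pairing f e) (trans (pairing≡ f≋g (indicator e)) (sym (coeff≡pairing g e)))

  other? : ∀ (e : Vec ℤ m) (t : ℤ × Vec ℤ m) → Dec (proj₂ t ≢ e)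
  other? e (c , e′) = ¬? (≡-dec ℤ._≟_ e′ e)

  remove : Vec ℤ m → Laurent m → Laurent m
  remove e = filter (other? e)

  pairing-remove : ∀ (φ : Vec ℤ m → ℤ) e f → pairing φ f ≡ coeff f e ℤ.* φ e ℤ.+ pairing φ (remove e f)
  pairing-remove φ e []             = refl
  pairing-remove φ e ((c , e′) ∷ f) with ≡-dec ℤ._≟_ e′ e
  ... | yes refl = trans (cong (λ r → c ℤ.* φ e ℤ.+ r) (pairing-remove φ e f))
    (solve 4 (λ c x k r → c :* x :+ (k :* x :+ r) := (c :+ k) :* x :+ r) refl c (φ e) (coeff f e) (pairing φ (remove e f)))
    where
    open +-*-Solver
  ... | no _ = trans (cong (λ r → c ℤ.* φ e′ ℤ.+ r) (pairing-remove φ e f))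
    (solve 4 (λ a x k r → a :+ (k :* x :+ r) := (con 0ℤ :+ k) :* x :+ (a :+ r)) refl (c ℤ.* φ e′) (φ e) (coeff f e) (pairing φ (remove e f)))
    where
    open +-*-Solver

  coeff-remove : ∀ e (f : Laurent m) → f ≈ 0# → remove e f ≈ 0#
  coeff-remove e f f≈0 e′ = begin
    coeff (remove e f) e′                            ≡⟨ coeff≡pairing (remove e f) e′ ⟩
    pairing i (remove e f)                           ≡⟨ ℤ.+-identityˡ _ ⟨
    0ℤ ℤ.* i e ℤ.+ pairing i (remove e f)            ≡⟨ cong (λ c → c ℤ.* i e ℤ.+ pairing i (remove e f)) (f≈0 e) ⟨
    coeff f e ℤ.* i e ℤ.+ pairing i (remove e f)     ≡⟨ pairing-remove i e f ⟨
    pairing i f                                      ≡⟨ coeff≡pairing f e′ ⟨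
    coeff f e′                                       ≡⟨ f≈0 e′ ⟩
    0ℤ                                               ∎
    where
    i = indicator e′

  -- All terms with the exponents of the first term are removed together: their total coefficient is
  -- 0, and the remaining list is shorter and still has vanishing coefficients.
  ≈0⇒pairing≡0 : ∀ (φ : Vec ℤ m → ℤ) f → Acc ℕ._<_ (length f) → f ≈ 0# → pairing φ f ≡ 0ℤ
  ≈0⇒pairing≡0 φ []                  _         f≈0 = refl
  ≈0⇒pairing≡0 φ f@((c , e) ∷ f′) (acc rec) f≈0 = begin
    pairing φ f                                  ≡⟨ pairing-remove φ e f ⟩
    coeff f e ℤ.* φ e ℤ.+ pairing φ (remove e f) ≡⟨ cong₂ (λ k r → k ℤ.* φ e ℤ.+ r) (f≈0 e) (≈0⇒pairing≡0 φ (remove e f) (rec shorter) (coeff-remove e f f≈0)) ⟩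
    0ℤ                                           ∎
    where
    shorter : length (remove e f) ℕ.< length f
    shorter with ≡-dec ℤ._≟_ e e
    ... | yes _  = s≤s (List.length-filter (other? e) f′)
    ... | no e≢e = contradiction refl e≢e

  coeff-++ : ∀ (f g : Laurent m) e → coeff (f ++ g) e ≡ coeff f e ℤ.+ coeff g e
  coeff-++ f g e = trans (coeff≡pairing (f ++ g) e) (trans (pairing-++ (indicator e) f g)
    (sym (cong₂ ℤ._+_ (coeff≡pairing f e) (coeff≡pairing g e))))

  ≈⇒≋ : ∀ {f g : Laurent m} → f ≈ g → f ≋ g
  ≈⇒≋ {f = f} {g} f≈g = mk≋ λ φ → ℤ.i-j≡0⇒i≡j _ _ (begin
    pairing φ f ℤ.- pairing φ g  ≡⟨ cong (λ r → pairing φ f ℤ.+ r) (pairing-neg φ g) ⟨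
    pairing φ f ℤ.+ pairing φ (- g) ≡⟨ pairing-++ φ f (- g) ⟨
    pairing φ (f - g)            ≡⟨ ≈0⇒pairing≡0 φ (f - g) (<-wellFounded _) difference ⟩
    0ℤ ∎)
    where
    difference : f - g ≈ 0#
    difference e = begin
      coeff (f - g) e                            ≡⟨ coeff-++ f (- g) e ⟩
      coeff f e ℤ.+ coeff (- g) e                ≡⟨ cong₂ ℤ._+_ (f≈g e) (trans (coeff≡pairing (- g) e) (trans (pairing-neg (indicator e) g) (cong ℤ.-_ (sym (coeff≡pairing g e))))) ⟩
      coeff g e ℤ.- coeff g e                    ≡⟨ ℤ.+-inverseʳ (coeff g e) ⟩
      0ℤ                                         ∎

  laurentRing : ℕ → CommutativeRing 0ℓ 0ℓ
  laurentRing m = record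
    { Carrier = Laurent m ; _≈_ = _≋_ ; _+_ = _+_ ; _*_ = _*_ ; -_ = -_ ; 0# = 0# ; 1# = 1#
    ; isCommutativeRing = record
      { isRing = record
        { +-isAbelianGroup = record
          { isGroup = record
            { isMonoid = record
              { isSemigroup = record
                { isMagma = record
                  { isEquivalence = record
                    { refl  = mk≋ λ φ → refl
                    ; sym   = λ p → mk≋ λ φ → sym (pairing≡ p φ)
                    ; trans = λ p q → mk≋ λ φ → trans (pairing≡ p φ) (pairing≡ q φ) }
                  ; ∙-cong = λ {f} {f′} {g} {g′} p q → mk≋ λ φ →
                      trans (pairing-++ φ f g) (trans (cong₂ ℤ._+_ (pairing≡ p φ) (pairing≡ q φ)) (sym (pairing-++ φ f′ g′))) }
                ; assoc = λ f g h → mk≋ λ φ → cong (pairing φ) (List.++-assoc f g h) }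
              ; identity = (λ f → mk≋ λ φ → refl) , (λ f → mk≋ λ φ → cong (pairing φ) (List.++-identityʳ f)) }
            ; inverse = (λ f → mk≋ λ φ → trans (pairing-++ φ (- f) f) (trans (cong (ℤ._+ pairing φ f) (pairing-neg φ f)) (ℤ.+-inverseˡ (pairing φ f))))
                      , (λ f → mk≋ λ φ → trans (pairing-++ φ f (- f)) (trans (cong (λ r → pairing φ f ℤ.+ r) (pairing-neg φ f)) (ℤ.+-inverseʳ (pairing φ f))))
            ; ⁻¹-cong = λ {f} {g} p → mk≋ λ φ → trans (pairing-neg φ f) (trans (cong ℤ.-_ (pairing≡ p φ)) (sym (pairing-neg φ g))) }
          ; comm = λ f g → mk≋ λ φ → trans (pairing-++ φ f g) (trans (ℤ.+-comm (pairing φ f) (pairing φ g)) (sym (pairing-++ φ g f))) }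
        ; *-cong = λ {f} {f′} {g} {g′} p q → mk≋ λ φ → begin
            pairing φ (f * g)                                      ≡⟨ pairing-* φ f g ⟩
            pairing (λ e → pairing (λ e′ → φ (e ⊕ e′)) g) f        ≡⟨ pairing≡ p _ ⟩
            pairing (λ e → pairing (λ e′ → φ (e ⊕ e′)) g) f′       ≡⟨ pairing-ext f′ (λ e → pairing≡ q _) ⟩
            pairing (λ e → pairing (λ e′ → φ (e ⊕ e′)) g′) f′      ≡⟨ pairing-* φ f′ g′ ⟨
            pairing φ (f′ * g′)                                    ∎
        ; *-assoc = λ f g h → mk≋ λ φ → begin
            pairing φ ((f * g) * h)
              ≡⟨ pairing-* φ (f * g) h ⟩
            pairing (λ e → pairing (λ e″ → φ (e ⊕ e″)) h) (f * g)
              ≡⟨ pairing-* _ f g ⟩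
            pairing (λ e → pairing (λ e′ → pairing (λ e″ → φ ((e ⊕ e′) ⊕ e″)) h) g) f
              ≡⟨ pairing-ext f (λ e → pairing-ext g λ e′ → pairing-ext h λ e″ → cong φ (zipWith-assoc ℤ.+-assoc e e′ e″)) ⟩
            pairing (λ e → pairing (λ e′ → pairing (λ e″ → φ (e ⊕ (e′ ⊕ e″))) h) g) f
              ≡⟨ pairing-ext f (λ e → sym (pairing-* _ g h)) ⟩
            pairing (λ e → pairing (λ x → φ (e ⊕ x)) (g * h)) f
              ≡⟨ pairing-* φ f (g * h) ⟨
            pairing φ (f * (g * h)) ∎
        ; *-identity = (λ f → *-identityˡ f) , (λ f → mk≋ λ φ → trans (pairing≡ (*-comm f 1#) φ) (pairing≡ (*-identityˡ f) φ))
        ; distrib = (λ f g h → mk≋ λ φ → trans (pairing≡ (*-comm f (g + h)) φ) (trans (pairing≡ (distribʳ f g h) φ)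
                      (trans (pairing-++ φ (g * f) (h * f)) (trans (cong₂ ℤ._+_ (pairing≡ (*-comm g f) φ) (pairing≡ (*-comm h f) φ)) (sym (pairing-++ φ (f * g) (f * h)))))))
                  , distribʳ }
      ; *-comm = *-comm } }
    where
    *-comm : ∀ (f g : Laurent m) → f * g ≋ g * f
    *-comm f g = mk≋ λ φ → begin
      pairing φ (f * g)                                  ≡⟨ pairing-* φ f g ⟩
      pairing (λ e → pairing (λ e′ → φ (e ⊕ e′)) g) f    ≡⟨ pairing-comm _ f g ⟩
      pairing (λ e′ → pairing (λ e → φ (e ⊕ e′)) f) g    ≡⟨ pairing-ext g (λ e′ → pairing-ext f λ e → cong φ (zipWith-comm ℤ.+-comm e e′)) ⟩
      pairing (λ e′ → pairing (λ e → φ (e′ ⊕ e)) f) g    ≡⟨ pairing-* φ g f ⟨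
      pairing φ (g * f)                                  ∎
    *-identityˡ : ∀ (f : Laurent m) → 1# * f ≋ f
    *-identityˡ f = mk≋ λ φ → trans (pairing-* φ 1# f) (trans (pairing-1 (λ e → pairing (λ e′ → φ (e ⊕ e′)) f))
      (pairing-ext f λ e → cong φ (zipWith-identityˡ {f = ℤ._+_} ℤ.+-identityˡ e)))
    distribʳ : ∀ (f g h : Laurent m) → (g + h) * f ≋ g * f + h * f
    distribʳ f g h = mk≋ λ φ → trans (pairing-* φ (g + h) f) (trans (pairing-++ _ g h)
      (trans (sym (cong₂ ℤ._+_ (pairing-* φ g f) (pairing-* φ h f))) (sym (pairing-++ φ (g * f) (h * f)))))

  add : ℤ → Fin m → Vec ℤ m → Vec ℤ m
  add a i v = updateAt v i (λ b → a ℤ.+ b)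

  add-comm : ∀ a i b j (v : Vec ℤ m) → add a i (add b j v) ≡ add b j (add a i v)
  add-comm a zero    b zero    (x ∷ v) = cong (_∷ v) (solve 3 (λ a b x → a :+ (b :+ x) := b :+ (a :+ x)) refl a b x)
    where
    open +-*-Solver
  add-comm a zero    b (suc j) (x ∷ v) = refl
  add-comm a (suc i) b zero    (x ∷ v) = refl
  add-comm a (suc i) b (suc j) (x ∷ v) = cong (x ∷_) (add-comm a i b j v)

  add-add : ∀ a b i (v : Vec ℤ m) → add (a ℤ.+ b) i v ≡ add a i (add b i v)
  add-add a b zero    (x ∷ v) = cong (_∷ v) (ℤ.+-assoc a b x)
  add-add a b (suc i) (x ∷ v) = cong (x ∷_) (add-add a b i v)

  add-0 : ∀ i (v : Vec ℤ m) → add 0ℤ i v ≡ v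
  add-0 zero    (x ∷ v) = cong (_∷ v) (ℤ.+-identityˡ x)
  add-0 (suc i) (x ∷ v) = cong (x ∷_) (add-0 i v)

  add-⊕ : ∀ a b i (u v : Vec ℤ m) → add (a ℤ.+ b) i (u ⊕ v) ≡ add a i u ⊕ add b i v
  add-⊕ a b zero    (x ∷ u) (z ∷ v) = cong (_∷ (u ⊕ v))
    (solve 4 (λ a b x z → (a :+ b) :+ (x :+ z) := (a :+ x) :+ (b :+ z)) refl a b x z)
    where
    open +-*-Solver
  add-⊕ a b (suc i) (x ∷ u) (z ∷ v) = cong ((x ℤ.+ z) ∷_) (add-⊕ a b i u v)

  unit≡add : ∀ a (i : Fin m) → replicate m 0ℤ [ i ]≔ a ≡ add a i (replicate m 0ℤ)
  unit≡add a zero    = cong (_∷ _) (sym (ℤ.+-identityʳ a))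
  unit≡add a (suc i) = cong (0ℤ ∷_) (unit≡add a i)

  unit-⊕ : ∀ a i (v : Vec ℤ m) → (replicate m 0ℤ [ i ]≔ a) ⊕ v ≡ add a i v
  unit-⊕ a zero    (x ∷ v) = cong ((a ℤ.+ x) ∷_) (zipWith-identityˡ {f = ℤ._+_} ℤ.+-identityˡ v)
  unit-⊕ a (suc i) (x ∷ v) = cong₂ _∷_ (ℤ.+-identityˡ x) (unit-⊕ a i v)

  renameExponents-0 : ∀ (ρ : Fin m → Fin n) → renameExponents ρ (replicate m 0ℤ) ≡ replicate n 0ℤ
  renameExponents-0 {zero}  ρ = refl
  renameExponents-0 {suc m} ρ = trans (add-0 (ρ zero) _) (renameExponents-0 (ρ ∘ suc))

  renameExponents-⊕ : ∀ (ρ : Fin m → Fin n) u v →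
    renameExponents ρ (u ⊕ v) ≡ renameExponents ρ u ⊕ renameExponents ρ v
  renameExponents-⊕ ρ []      []      = sym (zipWith-identityˡ {f = ℤ._+_} ℤ.+-identityˡ _)
  renameExponents-⊕ ρ (x ∷ u) (z ∷ v) = trans
    (cong (add (x ℤ.+ z) (ρ zero)) (renameExponents-⊕ (ρ ∘ suc) u v))
    (add-⊕ x z (ρ zero) (renameExponents (ρ ∘ suc) u) (renameExponents (ρ ∘ suc) v))

  renameExponents-add : ∀ (ρ : Fin m → Fin n) a i v →
    renameExponents ρ (add a i v) ≡ add a (ρ i) (renameExponents ρ v)
  renameExponents-add ρ a zero    (x ∷ v) = add-add a x (ρ zero) _
  renameExponents-add ρ a (suc i) (x ∷ v) = trans
    (cong (add x (ρ zero)) (renameExponents-add (ρ ∘ suc) a i v))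
    (add-comm x (ρ zero) a (ρ (suc i)) _)

  renameExponents-unit : ∀ (ρ : Fin m → Fin n) a i →
    renameExponents ρ (replicate m 0ℤ [ i ]≔ a) ≡ replicate n 0ℤ [ ρ i ]≔ a
  renameExponents-unit {m} {n} ρ a i = begin
    renameExponents ρ (replicate m 0ℤ [ i ]≔ a)      ≡⟨ cong (renameExponents ρ) (unit≡add a i) ⟩
    renameExponents ρ (add a i (replicate m 0ℤ))     ≡⟨ renameExponents-add ρ a i (replicate m 0ℤ) ⟩
    add a (ρ i) (renameExponents ρ (replicate m 0ℤ)) ≡⟨ cong (add a (ρ i)) (renameExponents-0 ρ) ⟩
    add a (ρ i) (replicate n 0ℤ)                     ≡⟨ unit≡add a (ρ i) ⟨
    replicate n 0ℤ [ ρ i ]≔ a                        ∎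

  renameExponents-∘ : ∀ (ρ : Fin n → Fin p) (σ : Fin m → Fin n) e →
    renameExponents ρ (renameExponents σ e) ≡ renameExponents (ρ ∘ σ) e
  renameExponents-∘ ρ σ []      = renameExponents-0 ρ
  renameExponents-∘ ρ σ (a ∷ e) = trans
    (renameExponents-add ρ a (σ zero) (renameExponents (σ ∘ suc) e))
    (cong (add a (ρ (σ zero))) (renameExponents-∘ ρ (σ ∘ suc) e))

  renameExponents-cong : ∀ {ρ σ : Fin m → Fin n} → (∀ i → ρ i ≡ σ i) → ∀ e →
    renameExponents ρ e ≡ renameExponents σ e
  renameExponents-cong ρ≗σ []      = refl
  renameExponents-cong ρ≗σ (a ∷ e) = cong₂ (add a) (ρ≗σ zero) (renameExponents-cong (ρ≗σ ∘ suc) e)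

  renameExponents-suc : ∀ (ρ : Fin m → Fin n) e → renameExponents (suc ∘ ρ) e ≡ 0ℤ ∷ renameExponents ρ e
  renameExponents-suc ρ []      = refl
  renameExponents-suc ρ (a ∷ e) = cong (add a (suc (ρ zero))) (renameExponents-suc (ρ ∘ suc) e)

  renameExponents-id : ∀ (e : Vec ℤ m) → renameExponents id e ≡ e
  renameExponents-id []      = refl
  renameExponents-id (a ∷ e) = trans (cong (add a zero) (renameExponents-suc id e))
    (cong₂ _∷_ (ℤ.+-identityʳ a) (renameExponents-id e))

  pairing-rename : ∀ (ρ : Fin m → Fin n) φ f → pairing φ (rename ρ f) ≡ pairing (φ ∘ renameExponents ρ) f
  pairing-rename ρ φ []            = refl
  pairing-rename ρ φ ((c , e) ∷ f) = cong (λ r → c ℤ.* φ (renameExponents ρ e) ℤ.+ r) (pairing-rename ρ φ f)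

  rename-≋ : ∀ (ρ : Fin m → Fin n) {f g} → f ≋ g → rename ρ f ≋ rename ρ g
  rename-≋ ρ {f} {g} f≋g = mk≋ λ φ → trans (pairing-rename ρ φ f) (trans (pairing≡ f≋g _) (sym (pairing-rename ρ φ g)))

  rename-* : ∀ (ρ : Fin m → Fin n) f g → rename ρ (f * g) ≋ rename ρ f * rename ρ g
  rename-* ρ f g = mk≋ λ φ → begin
    pairing φ (rename ρ (f * g))
      ≡⟨ pairing-rename ρ φ (f * g) ⟩
    pairing (φ ∘ renameExponents ρ) (f * g)
      ≡⟨ pairing-* _ f g ⟩
    pairing (λ e → pairing (λ e′ → φ (renameExponents ρ (e ⊕ e′))) g) f
      ≡⟨ pairing-ext f (λ e → trans (pairing-ext g λ e′ → cong φ (renameExponents-⊕ ρ e e′)) (sym (pairing-rename ρ _ g))) ⟩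
    pairing (λ e → pairing (λ e′ → φ (renameExponents ρ e ⊕ e′)) (rename ρ g)) f
      ≡⟨ pairing-rename ρ _ f ⟨
    pairing (λ e → pairing (λ e′ → φ (e ⊕ e′)) (rename ρ g)) (rename ρ f)
      ≡⟨ pairing-* φ (rename ρ f) (rename ρ g) ⟨
    pairing φ (rename ρ f * rename ρ g) ∎

  rename-+ : ∀ (ρ : Fin m → Fin n) f g → rename ρ (f + g) ≋ rename ρ f + rename ρ g
  rename-+ ρ f g = mk≋ λ φ → cong (pairing φ) (List.map-++ _ f g)

  rename-neg : ∀ (ρ : Fin m → Fin n) f → rename ρ (- f) ≋ - rename ρ f
  rename-neg ρ f = mk≋ λ φ → begin
    pairing φ (rename ρ (- f))                   ≡⟨ pairing-rename ρ φ (- f) ⟩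
    pairing (φ ∘ renameExponents ρ) (- f)        ≡⟨ pairing-neg _ f ⟩
    ℤ.- pairing (φ ∘ renameExponents ρ) f        ≡⟨ cong ℤ.-_ (pairing-rename ρ φ f) ⟨
    ℤ.- pairing φ (rename ρ f)                   ≡⟨ pairing-neg φ (rename ρ f) ⟨
    pairing φ (- rename ρ f)                     ∎

  rename-1 : ∀ (ρ : Fin m → Fin n) → rename ρ 1# ≋ 1#
  rename-1 ρ = mk≋ λ φ → cong (λ e → 1ℤ ℤ.* φ e ℤ.+ 0ℤ) (renameExponents-0 ρ)

  rename-var : ∀ (ρ : Fin m → Fin n) i → rename ρ (var i) ≋ var (ρ i)
  rename-var ρ i = mk≋ λ φ → cong (λ e → 1ℤ ℤ.* φ e ℤ.+ 0ℤ) (renameExponents-unit ρ 1ℤ i)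

  rename-var⁻¹ : ∀ (ρ : Fin m → Fin n) i → rename ρ (var⁻¹ i) ≋ var⁻¹ (ρ i)
  rename-var⁻¹ ρ i = mk≋ λ φ → cong (λ e → 1ℤ ℤ.* φ e ℤ.+ 0ℤ) (renameExponents-unit ρ -1ℤ i)

  rename-∘ : ∀ (ρ : Fin n → Fin p) (σ : Fin m → Fin n) f → rename ρ (rename σ f) ≋ rename (ρ ∘ σ) f
  rename-∘ ρ σ f = mk≋ λ φ → trans (pairing-rename ρ φ (rename σ f)) (trans (pairing-rename σ _ f)
    (trans (pairing-ext f λ e → cong φ (renameExponents-∘ ρ σ e)) (sym (pairing-rename (ρ ∘ σ) φ f))))

  rename-cong : ∀ {ρ σ : Fin m → Fin n} → (∀ i → ρ i ≡ σ i) → ∀ f → rename ρ f ≋ rename σ f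
  rename-cong {ρ = ρ} {σ} ρ≗σ f = mk≋ λ φ → trans (pairing-rename ρ φ f)
    (trans (pairing-ext f λ e → cong φ (renameExponents-cong ρ≗σ e)) (sym (pairing-rename σ φ f)))

  rename-id : ∀ (f : Laurent m) → rename id f ≋ f
  rename-id f = mk≋ λ φ → trans (pairing-rename id φ f) (pairing-ext f λ e → cong φ (renameExponents-id e))

  var*var⁻¹≋1 : ∀ (i : Fin m) → var i * var⁻¹ i ≋ 1#
  var*var⁻¹≋1 {m} i = mk≋ λ φ → cong (λ e → 1ℤ ℤ.* φ e ℤ.+ 0ℤ) (begin
    (replicate m 0ℤ [ i ]≔ 1ℤ) ⊕ (replicate m 0ℤ [ i ]≔ -1ℤ) ≡⟨ unit-⊕ 1ℤ i _ ⟩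
    add 1ℤ i (replicate m 0ℤ [ i ]≔ -1ℤ)                     ≡⟨ cong (add 1ℤ i) (unit≡add -1ℤ i) ⟩
    add 1ℤ i (add -1ℤ i (replicate m 0ℤ))                    ≡⟨ add-add 1ℤ -1ℤ i _ ⟨
    add 0ℤ i (replicate m 0ℤ)                                ≡⟨ add-0 i _ ⟩
    replicate m 0ℤ                                           ∎)

  -- If (var i - var j) * f vanishes, then the pairings with f are invariant under
  -- a shift of the exponents, which moves them out of the support of f.
  module Cancellation {m} (i j : Fin m) (i≢j : i ≢ j) (f : Laurent m)
                      (hyp : (var i - var j) * f ≋ 0#) where

    shift : Vec ℤ m → Vec ℤ m
    shift e = add 1ℤ i (add -1ℤ j e)

    shift^ : ℕ → Vec ℤ m → Vec ℤ m
    shift^ zero    e = e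
    shift^ (suc N) e = shift (shift^ N e)

    pairing-var : ∀ l φ → pairing φ (var l * f) ≡ pairing (λ e → φ (add 1ℤ l e)) f
    pairing-var l φ = trans (pairing-* φ (var l) f) (trans (ℤ.+-identityʳ _) (trans (ℤ.*-identityˡ _)
      (pairing-ext f λ e → cong φ (unit-⊕ 1ℤ l e))))

    -- The hypothesis is paired with `ψ`, which lowers the j-th exponent. Multiplication by `var j`
    -- undoes this, and multiplication by `var i` completes it to `shift`.
    pairing-shift : ∀ φ → pairing φ f ≡ pairing (φ ∘ shift) f
    pairing-shift φ = sym (ℤ.i-j≡0⇒i≡j _ _ (begin
      pairing (φ ∘ shift) f ℤ.- pairing φ f
        ≡⟨ cong₂ ℤ._-_ (pairing-ext f λ e → cong φ (add-comm 1ℤ i -1ℤ j e))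
                       (pairing-ext f λ e → cong φ (trans (sym (add-0 j e)) (add-add -1ℤ 1ℤ j e))) ⟩
      pairing (λ e → ψ (add 1ℤ i e)) f ℤ.- pairing (λ e → ψ (add 1ℤ j e)) f
        ≡⟨ cong₂ ℤ._-_ (pairing-var i ψ) (pairing-var j ψ) ⟨
      pairing ψ (var i * f) ℤ.- pairing ψ (var j * f)
        ≡⟨ cong (λ r → pairing ψ (var i * f) ℤ.+ r) (trans (cong ℤ.-_ (sym (ℤ.+-identityʳ _))) (lemma)) ⟩
      pairing ψ (var i * f) ℤ.+ pairing ψ ((- var j) * f)
        ≡⟨ pairing-++ ψ (var i * f) ((- var j) * f) ⟨
      pairing ψ (var i * f + (- var j) * f)
        ≡⟨ pairing≡ (R.distribʳ f (var i) (- var j)) ψ ⟨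
      pairing ψ ((var i - var j) * f)
        ≡⟨ pairing≡ hyp ψ ⟩
      0ℤ ∎))
      where
      module R = CommutativeRing (laurentRing m)
      open import Algebra.Properties.Ring R.ring using (-‿distribˡ-*)
      ψ = φ ∘ add -1ℤ j
      lemma : ℤ.- (pairing ψ (var j * f) ℤ.+ 0ℤ) ≡ pairing ψ ((- var j) * f)
      lemma = trans (cong ℤ.-_ (ℤ.+-identityʳ _)) (trans (sym (pairing-neg ψ (var j * f)))
        (pairing≡ (-‿distribˡ-* (var j) f) ψ))

    pairing-shift^ : ∀ N φ → pairing φ f ≡ pairing (φ ∘ shift^ N) f
    pairing-shift^ zero    φ = refl
    pairing-shift^ (suc N) φ = trans (pairing-shift φ) (pairing-shift^ N (φ ∘ shift))

    lookup-shift^ : ∀ N e → lookup (shift^ N e) i ≡ + N ℤ.+ lookup e i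
    lookup-shift^ zero    e = sym (ℤ.+-identityˡ _)
    lookup-shift^ (suc N) e = begin
      lookup (shift (shift^ N e)) i              ≡⟨ lookup∘updateAt i (add -1ℤ j (shift^ N e)) ⟩
      1ℤ ℤ.+ lookup (add -1ℤ j (shift^ N e)) i   ≡⟨ cong (λ r → 1ℤ ℤ.+ r) (lookup∘updateAt′ i j i≢j (shift^ N e)) ⟩
      1ℤ ℤ.+ lookup (shift^ N e) i               ≡⟨ cong (λ r → 1ℤ ℤ.+ r) (lookup-shift^ N e) ⟩
      1ℤ ℤ.+ (+ N ℤ.+ lookup e i)                ≡⟨ ℤ.+-assoc 1ℤ (+ N) (lookup e i) ⟨
      + suc N ℤ.+ lookup e i                     ∎

    module _ (e : Vec ℤ m) where
      distance : Vec ℤ m → ℕ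
      distance e′ = ℤ.∣ lookup e i ℤ.- lookup e′ i ∣

      -- Any upper bound of the distances would do; the sum avoids maxima.
      bound : Laurent m → ℕ
      bound []             = 0
      bound ((c , e′) ∷ g) = distance e′ ℕ.+ bound g

      -- N shifts raise the i-th exponent by N, so e could be hit only from an e′ with `distance e′`
      -- equal to N.
      beyond : ∀ N g → bound g ℕ.< N → pairing (indicator e ∘ shift^ N) g ≡ 0ℤ
      beyond N []             _   = refl
      beyond N ((c , e′) ∷ g) b<N = cong₂ ℤ._+_ (trans (cong (c ℤ.*_) missed) (ℤ.*-zeroʳ c))
        (beyond N g (ℕ.≤-<-trans (ℕ.m≤n+m (bound g) (distance e′)) b<N))
        where
        missed : indicator e (shift^ N e′) ≡ 0ℤ
        missed with ≡-dec ℤ._≟_ (shift^ N e′) e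
        ... | no _   = refl
        ... | yes eq = contradiction (ℕ.≤-<-trans (ℕ.m≤m+n (distance e′) (bound g)) b<N) (ℕ.<-irrefl (cong ℤ.∣_∣ (begin
          lookup e i ℤ.- lookup e′ i                       ≡⟨ cong (λ v → lookup v i ℤ.- lookup e′ i) eq ⟨
          lookup (shift^ N e′) i ℤ.- lookup e′ i           ≡⟨ cong (ℤ._- lookup e′ i) (lookup-shift^ N e′) ⟩
          (+ N ℤ.+ lookup e′ i) ℤ.- lookup e′ i            ≡⟨ solve 2 (λ a b → (a :+ b) :- b := a) refl (+ N) (lookup e′ i) ⟩
          + N                                              ∎)))
          where
          open +-*-Solver

    f≋0 : f ≋ 0#
    f≋0 = ≈⇒≋ λ e → trans (coeff≡pairing f e)
      (trans (pairing-shift^ (suc (bound e f)) (indicator e)) (beyond e (suc (bound e f)) f ℕ.≤-refl))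

open LaurentPolynomials

laurentTheory : LaurentTheory
laurentTheory = record
  { laurent = laurentRing ; Y = var ; Y⁻¹ = var⁻¹ ; Y*Y⁻¹≈1 = var*var⁻¹≋1
  ; cancel = λ {_} {i} {j} i≢j f → Cancellation.f≋0 i j i≢j f
  ; ren = rename ; ren-cong = rename-≋ ; ren-+ = rename-+ ; ren-* = rename-* ; ren-neg = rename-neg
  ; ren-0 = λ ρ → mk≋ λ φ → ≡.refl ; ren-1 = rename-1 ; ren-Y = rename-var ; ren-Y⁻¹ = rename-var⁻¹
  ; ren-∘ = rename-∘ ; ren-≗ = rename-cong ; ren-id = rename-id }

-- Puzzle sums as values of the partition function, and the conclusion

leftSide-reverse : ∀ {m} (T : Tiling m) → leftSide T ≡ reverse (leftEdges T)
leftSide-reverse empty         = ≡.refl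
leftSide-reverse (row T ds us) = ≡.trans (≡.cong (_∷ʳ aEdge (Vec.head us)) (leftSide-reverse T))
  (≡.sym (reverse-∷ (aEdge (Vec.head us)) (leftEdges T)))

reverse-≡ : ∀ {A B : Set} {m} (f : B → A) {u : Vec A m} {v : Vec B m} → reverse u ≡ Vec.map f v → u ≡ Vec.map f (reverse v)
reverse-≡ f {u} {v} eq = ≡.trans (≡.sym (reverse-involutive u)) (≡.trans (≡.cong reverse eq) (≡.sym (map-reverse f v)))

≡-reverse : ∀ {A B : Set} {m} (f : B → A) {u : Vec A m} {v : Vec B m} → u ≡ Vec.map f (reverse v) → reverse u ≡ Vec.map f v
≡-reverse f {u} {v} eq = ≡.trans (≡.cong reverse (≡.trans eq (map-reverse f v))) (reverse-involutive (Vec.map f v))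

module PuzzleSum (n : ℕ) where
  open CommutativeRing (laurentRing n) using () renaming (trans to ≋-trans; reflexive to ≋-reflexive; refl to ≋-refl; *-cong to ≋-*-cong)
  open RingTools (laurentRing n) using (∑-cong; ∑-filter; when; when-⇔)
  open Local (laurentRing n) using (⟦_⟧ₛ)
  open Amplitude (laurentRing n) (Fin n) var var⁻¹ var*var⁻¹≋1 using (amplitude; weight; puzzle-amplitude)

  lozengeWeight≡ : ∀ (w : Laurent n) u d → lozengeWeight w u d ≡ ⟦ scalar u d ⟧ₛ w
  lozengeWeight≡ w E  d  = ≡.refl
  lozengeWeight≡ w G₁ d  = ≡.refl
  lozengeWeight≡ w R₂ d  = ≡.refl
  lozengeWeight≡ w G₂ E  = ≡.refl
  lozengeWeight≡ w G₂ G₁ = ≡.refl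
  lozengeWeight≡ w G₂ G₂ = ≡.refl
  lozengeWeight≡ w G₂ R₁ = ≡.refl
  lozengeWeight≡ w G₂ R₂ = ≡.refl
  lozengeWeight≡ w G₂ Q  = ≡.refl
  lozengeWeight≡ w R₁ E  = ≡.refl
  lozengeWeight≡ w R₁ G₁ = ≡.refl
  lozengeWeight≡ w R₁ G₂ = ≡.refl
  lozengeWeight≡ w R₁ R₁ = ≡.refl
  lozengeWeight≡ w R₁ R₂ = ≡.refl
  lozengeWeight≡ w R₁ Q  = ≡.refl
  lozengeWeight≡ w Q  E  = ≡.refl
  lozengeWeight≡ w Q  G₁ = ≡.refl
  lozengeWeight≡ w Q  G₂ = ≡.refl
  lozengeWeight≡ w Q  R₁ = ≡.refl
  lozengeWeight≡ w Q  R₂ = ≡.refl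
  lozengeWeight≡ w Q  Q  = ≡.refl
  lozengeWeight≡ w K  E  = ≡.refl
  lozengeWeight≡ w K  G₁ = ≡.refl
  lozengeWeight≡ w K  G₂ = ≡.refl
  lozengeWeight≡ w K  R₁ = ≡.refl
  lozengeWeight≡ w K  R₂ = ≡.refl
  lozengeWeight≡ w K  Q  = ≡.refl

  weightIn≋weight : ∀ {m} (dl dr : Fin m → Fin n) T → weightIn dl dr T ≋ weight dl dr T
  weightIn≋weight dl dr empty         = ≋-refl
  weightIn≋weight dl dr (row T ds us) = ≋-*-cong
    {weightIn (dl ∘ inject₁) (dr ∘ suc) T} {weight (dl ∘ inject₁) (dr ∘ suc) T}
    (weightIn≋weight (dl ∘ inject₁) (dr ∘ suc) T)
    (Products.product-cong (laurentRing n) λ c →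
      ≋-reflexive (lozengeWeight≡ (var (dr (suc c)) * var⁻¹ (dl (inject₁ c))) (lookup (bottomRow T) c) (lookup ds c)))

  puzzleSum≋amplitude : ∀ {k} (κ μ ν : Frame n k) → puzzleSum κ μ ν ≋
    amplitude (tabulate id) (Vec.map leftState (reverse (proj₁ ν))) (Vec.map rightState (proj₁ κ)) (Vec.map bottomState (reverse (proj₁ μ)))
  puzzleSum≋amplitude (κ , _) (μ , _) (ν , _) =
    ≋-trans (∑-filter (isPuzzle? κ μ ν) (tilings n) modifiedWeight)
    (≋-trans (∑-cong (tilings n) λ T → when-⇔ (isPuzzle? κ μ ν T) (fits? T as bs hs)
        (λ (con , right , bottom , left) → con , right , reverse-≡ bottomState bottom ,
          reverse-≡ leftState (≡.trans (≡.sym (leftSide-reverse T)) left))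
        (λ (con , right , bottom , left) → con , right , ≡-reverse bottomState bottom ,
          ≡.trans (leftSide-reverse T) (≡-reverse leftState left))
        (λ _ → weightIn≋weight id id T))
    (puzzle-amplitude id as bs hs))
    where
    as = Vec.map leftState (reverse ν)
    bs = Vec.map rightState κ
    hs = Vec.map bottomState (reverse μ)

theorem3 : (k n : ℕ) → k ≤ n → 1 ≤ n → let open Grassmannian k n in
    (G : Frame n k → Laurent (k +ℕ n)) → IsDoubleGrothendieck G →
    (κ μ : Frame n k) (d : Frame n k → Laurent n) →
    (G κ * reverseY (G μ) ≈ᴷ ∑ (frames n k) (λ ν → fromY (d ν) * reverseY (G ν)))
    ⇔ (∀ ν → d ν ≈ puzzleSum κ μ ν)
theorem3 k n k≤n 1≤n G isG κ μ d = mk⇔ coefficients expansion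
  where
  open Grassmannian k n
  open IsDoubleGrothendieck isG
  open PuzzleSum n
  open CommutativeRing (laurentRing n) using (trans; sym)
  open Specialisation laurentTheory n k using (module FrameFamily)
  open FrameFamily G (λ κ full-κ → ≈⇒≋ (full κ full-κ)) (λ i i⁺ κ ν lowers → ≈⇒≋ (lower i i⁺ κ ν lowers))
    using (module Coefficients)
  open Coefficients κ μ d using (left-symmetric; right-symmetric; difference-symmetric)
    renaming (difference-determines to determines; difference-vanishes to vanishes)

  coefficients : G κ * reverseY (G μ) ≈ᴷ ∑ (frames n k) (λ ν → fromY (d ν) * reverseY (G ν)) →
                 ∀ ν → d ν ≈ puzzleSum κ μ ν
  coefficients (_ , _ , _ , vanish) ν =
    ≋⇒≈ (trans (determines (λ ι increasing → ≈⇒≋ (vanish ι increasing)) ν) (sym (puzzleSum≋amplitude κ μ ν)))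

  expansion : (∀ ν → d ν ≈ puzzleSum κ μ ν) →
              G κ * reverseY (G μ) ≈ᴷ ∑ (frames n k) (λ ν → fromY (d ν) * reverseY (G ν))
  expansion d≈ =
    (λ π → ≋⇒≈ (left-symmetric π)) , (λ π → ≋⇒≈ (right-symmetric π)) , (λ π → ≋⇒≈ (difference-symmetric π)) ,
    -- The ideal tests increasing specialisations only; vanishing is known for all injective ones.
    λ ι increasing → ≋⇒≈ (vanishes (λ ν → trans (≈⇒≋ (d≈ ν)) (puzzleSum≋amplitude κ μ ν)) ι
                           (increasing⇒injective {ι = ι} increasing))
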